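{- There is a randomized algorithm which, for any matroid $\mathcal{M}$ on $n$ elements, makes polynomially many independence queries per round and recovers a basis of $\mathcal{M}$ with high probability within $\widetilde{O}(n^{4/9})$ rounds.
   Context: Independence oracle model: a query $S\subseteq E$ returns whether $S$ is independent; in each adaptive round polynomially many queries are made in parallel, depending only on answers of earlier rounds and internal randomness. $\widetilde{O}$ hides polylogarithmic factors in $n$. -}

module Defs where

open import Data.Bool using (Bool; true; false)
open import Data.Nat using (ℕ; zero; suc; _*_; _^_; _≤_; _<_)
open import Data.Nat.Logarithm using (⌊log₂_⌋)
open import Data.Fin using (Fin)
open import Data.Fin.Subset using (Subset; ⊥; _⊆_; _∪_; ⁅_⁆; ∣_∣; _∈_; _∉_)
open import Data.Vec as V using (Vec)
open import Data.List as L using (List; length; _++_)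
import Data.List.Membership.Propositional as LM
open import Data.Product using (Σ; ∃; ∃-syntax; _×_; _,_)
open import Relation.Nullary using (¬_)
open import Relation.Binary.PropositionalEquality using (_≡_)

record IsMatroid {n : ℕ} (ind : Subset n → Bool) : Set where
  field
    empty-indep : ind ⊥ ≡ true
    hereditary  : ∀ {S T : Subset n} → T ⊆ S → ind S ≡ true → ind T ≡ true
    augment     : ∀ {S T : Subset n} → ind S ≡ true → ind T ≡ true →
                  ∣ S ∣ < ∣ T ∣ →
                  ∃[ x ] (x ∈ T × x ∉ S × ind (S ∪ ⁅ x ⁆) ≡ true)

IsBasis : {n : ℕ} → (Subset n → Bool) → Subset n → Set
IsBasis {n} ind B =
  ind B ≡ true × (∀ (S : Subset n) → B ⊆ S → ind S ≡ true → S ≡ B)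

-- Adaptive-round randomized query algorithms (for a fixed n).
-- The algorithm draws rbits uniformly random bits r, runs for `rounds`
-- rounds; in each round it submits a list of queries (subsets) that
-- depends only on r and the answers of the earlier rounds (the history:
-- one list of answers per earlier round); the answers to all queries of
-- the round are returned in parallel. Finally it outputs a subset
-- computed from r and the full history.

record Alg (n : ℕ) : Set where
  field
    rbits  : ℕ
    rounds : ℕ
    query  : Vec Bool rbits → List (List Bool) → List (Subset n)
    output : Vec Bool rbits → List (List Bool) → Subset n

open Alg public

history : {n : ℕ} (A : Alg n) → (Subset n → Bool) → Vec Bool (rbits A) →
          ℕ → List (List Bool)
history A ind r zero    = L.[]
history A ind r (suc k) =
  let h = history A ind r k in h ++ L.[ L.map ind (query A r h) ]

result : {n : ℕ} (A : Alg n) → (Subset n → Bool) → Vec Bool (rbits A) → Subset n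
result A ind r = output A r (history A ind r (rounds A))

-- With high probability (failure probability ≤ 1/n over the uniformly
-- random r ∈ {0,1}^rbits): the set of random strings on which the output
-- is not a basis is contained in a list of size at most 2^rbits / n.
SucceedsWHP : {n : ℕ} (A : Alg n) → (Subset n → Bool) → Set
SucceedsWHP {n} A ind =
  ∃[ bad ] (length bad * n ≤ 2 ^ rbits A ×
            (∀ (r : Vec Bool (rbits A)) → ¬ (LM._∈_ r bad) → IsBasis ind (result A ind r)))

PolyQueries : ((n : ℕ) → Alg n) → Set
PolyQueries A = ∃[ c ] (∀ (n : ℕ) r h → length (query (A n) r h) ≤ c * suc n ^ c)

RoundsÕn4/9 : ((n : ℕ) → Alg n) → Set
RoundsÕn4/9 A = ∃[ C ] ∃[ k ] (∀ (n : ℕ) →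
  rounds (A n) ^ 9 ≤ C * suc n ^ 4 * suc ⌊log₂ n ⌋ ^ k)

{-# OPTIONS --safe #-}
module Submission where

open import Defs
open import Data.Bool using (Bool; true; false; not; _∧_; _∨_; if_then_else_)
import Data.Bool as Bool
open import Data.Bool.Properties using (¬-not; ∨-zeroʳ)
open import Data.Fin as Fin using (Fin; zero; suc; toℕ; fromℕ<)
open import Data.Fin.Properties using (toℕ<n; toℕ-fromℕ<; fromℕ<-toℕ) renaming (any? to anyFin?)
open import Data.Fin.Subset
open import Data.Fin.Subset.Properties
open import Data.List as L using (List; []; _∷_; _++_; length)
open import Data.List.Membership.Propositional using () renaming (_∈_ to _∈ˡ_)
open import Data.List.Membership.Propositional.Properties using (∈-++⁺ˡ; ∈-++⁺ʳ; ∈-map⁺; ∈-allFin)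
open import Data.List.Properties using (length-++; length-map; length-tabulate)
open import Data.List.Relation.Unary.Any using (here; there)
open import Data.Nat hiding (∣_-_∣)
open import Data.Nat.DivMod
  using (/-monoˡ-≤; m*n/n≡m; m/n*n≤m; m/n<m; m/n≡1+[m∸n]/n; m≡m%n+[m/n]*n; m%n<n)
open import Data.Nat.Logarithm using (⌊log₂_⌋; ⌊log₂⌋-mono-≤; ⌊log₂[2^n]⌋≡n)
open import Data.Nat.Properties
open import Data.Nat.Tactic.RingSolver using (solve-∀)
open import Data.Product using (Σ-syntax; ∃-syntax; _×_; _,_; proj₁; proj₂)
open import Data.Sum using (_⊎_; inj₁; inj₂; [_,_]′)
open import Data.Vec as V using (Vec; []; _∷_; lookup; tabulate; _[_]≔_; here; there)
open import Data.Vec.Properties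
  using (≡-dec; lookup⇒[]=; []=⇒lookup; lookup∘updateAt; lookup∘tabulate; tabulate-cong; take-map)
open import Data.Vec.Relation.Unary.All as All using (All; []; _∷_)
open import Data.Vec.Relation.Unary.All.Properties using (concat⁺; map⁺; take⁺)
open import Function using (_∘_; id)
open import Function.Base using (it)
open import Relation.Binary.PropositionalEquality hiding (J)
open import Relation.Nullary using (¬_; yes; no; contradiction)
open import Relation.Nullary.Decidable using (_×-dec_; ¬?)

-- Let q = n^(1/9), up to constant and polylogarithmic factors throughout. For a
-- random set S, keeping each element with probability p ≤ 1/(2q³), let X(S) be
-- the elements outside S spanned by an independent prefix of S in the index
-- order. One round tests q³ samples, and ⋃ X(S) minus ⋃ S can be deleted at
-- once. If this deletes n/q⁴ elements, it is progress. Otherwise the elements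
-- that are often in X(S) form a set H with ∣H∣ ≤ n/q⁴. Any member f of the
-- first circuit of S could be removed from S, and then f ∈ X(S − f); hence
-- members outside H are rare and the first circuit mostly lies within H. So if
-- S is often dependent, then S ∩ H is often dependent, and H is set aside.
--
-- As ∣S ∩ H∣ is about q² with standard deviation q, S ∩ H would be dependent
-- with constant probability already at the rate p/(1 + 1/q). The sets H that
-- are set aside at one rate are disjoint, so these events are independent; since
-- S was often independent at the smaller rate, O(1) sets H suffice to raise the
-- rate by the factor 1 + 1/q. After O(q log n) rounds the rate is 1/(2q³), and an
-- independent sample of n/q³ elements is found and contracted. The deletions
-- and the q³ contractions, each after q rounds, both take q⁴ rounds in total.

-- Finite sums

-- The exponent 9 is that of R·J·q² = q⁴·q³·q², where deletions remove n/R elements and the final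
-- rate is 1/(2J). A set H of about n/R elements, sampled at rate at most 1/(2J), must have expected
-- intersection O(q²) for a relative rate change of 1/q to stay within its fluctuation. The rounds
-- amount to R deletions and J contractions of q phases each.
--
-- The algorithm estimates no probabilities: unless a deletion intervenes it sets aside exactly 32
-- sets per rate, and `likely` is an invariant of the analysis only. Nor is H the true set of often
-- spanned elements. It is the union of what O(log n) batches suggest; with high probability it
-- contains every element suggested with probability 1/4, and it is small because no batch suggested
-- many.
--
-- The state is fixed before the fresh samples of a round are drawn, so a bad round has small
-- conditional probability; in every other round an integer potential decreases until it is 0. The
-- thresholds scale with the number of elements left, so the run is divided into stages that halve a
-- bound on it.

⟦_⟧ : Bool → ℕ
⟦ true ⟧  = 1
⟦ false ⟧ = 0

⟦⟧≤1 : ∀ x → ⟦ x ⟧ ≤ 1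
⟦⟧≤1 true  = ≤-refl
⟦⟧≤1 false = z≤n

⟦∧⟧ : ∀ x y → ⟦ x ∧ y ⟧ ≡ ⟦ x ⟧ * ⟦ y ⟧
⟦∧⟧ true  y = sym (*-identityˡ ⟦ y ⟧)
⟦∧⟧ false y = refl

⟦⟧-not : ∀ x → ⟦ x ⟧ + ⟦ not x ⟧ ≡ 1
⟦⟧-not true  = refl
⟦⟧-not false = refl

module _ {A : Set} (p : A → Bool) where

  all any : ∀ {n} → Vec A n → Bool
  all []      = true
  all (x ∷ v) = p x ∧ all v
  any []      = false
  any (x ∷ v) = p x ∨ any v

-- A finite measure on A, represented by its integral of ℕ-valued functions.
record Summation (A : Set) : Set where
  no-eta-equality
  field
    ∑      : (A → ℕ) → ℕ
    ∑-cong : ∀ {f g : A → ℕ} → (∀ x → f x ≡ g x) → ∑ f ≡ ∑ g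
    ∑-+    : ∀ (f g : A → ℕ) → ∑ (λ x → f x + g x) ≡ ∑ f + ∑ g

  total : ℕ
  total = ∑ (λ _ → 1)

  ∑-mono : ∀ {f g : A → ℕ} → (∀ x → f x ≤ g x) → ∑ f ≤ ∑ g
  ∑-mono {f} {g} f≤g = begin
    ∑ f                        ≤⟨ m≤m+n _ _ ⟩
    ∑ f + ∑ (λ x → g x ∸ f x)  ≡⟨ ∑-+ f _ ⟨
    ∑ (λ x → f x + (g x ∸ f x)) ≡⟨ ∑-cong (λ x → m+[n∸m]≡n (f≤g x)) ⟩
    ∑ g                        ∎
    where open ≤-Reasoning

  ∑-0 : ∑ (λ _ → 0) ≡ 0
  ∑-0 = sym (+-cancelˡ-≡ _ _ _ (trans (+-identityʳ _) (∑-+ (λ _ → 0) (λ _ → 0))))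

  ∑-*ˡ : ∀ c (f : A → ℕ) → ∑ (λ x → c * f x) ≡ c * ∑ f
  ∑-*ˡ zero    f = ∑-0
  ∑-*ˡ (suc c) f = trans (∑-+ f _) (cong (∑ f +_) (∑-*ˡ c f))

  ∑-*ʳ : ∀ (f : A → ℕ) c → ∑ (λ x → f x * c) ≡ ∑ f * c
  ∑-*ʳ f c = trans (∑-cong (λ x → *-comm (f x) c)) (trans (∑-*ˡ c f) (*-comm c (∑ f)))

  ∑-const : ∀ c → ∑ (λ _ → c) ≡ c * total
  ∑-const c = trans (∑-cong (λ _ → sym (*-identityʳ c))) (∑-*ˡ c _)

open Summation

module _ {A : Set} (S : Summation A) where

  Vecˢ : ∀ n → Summation (Vec A n)
  Vecˢ zero    = record
    { ∑ = λ f → f [] ; ∑-cong = λ e → e [] ; ∑-+ = λ _ _ → refl }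
  Vecˢ (suc n) = record
    { ∑      = λ f → ∑ S (λ x → ∑ (Vecˢ n) (λ v → f (x ∷ v)))
    ; ∑-cong = λ e → ∑-cong S (λ x → ∑-cong (Vecˢ n) (λ v → e (x ∷ v)))
    ; ∑-+    = λ f g → trans (∑-cong S (λ x → ∑-+ (Vecˢ n) _ _)) (∑-+ S _ _) }

  private T = total S

  Vecˢ-all : ∀ n (p : A → Bool) →
    ∑ (Vecˢ n) (λ v → ⟦ all p v ⟧) ≡ ∑ S (λ x → ⟦ p x ⟧) ^ n
  Vecˢ-all zero    p = refl
  Vecˢ-all (suc n) p = begin
    ∑ S (λ x → ∑ (Vecˢ n) (λ v → ⟦ p x ∧ all p v ⟧))
      ≡⟨ ∑-cong S (λ x → ∑-cong (Vecˢ n) (λ v → ⟦∧⟧ (p x) (all p v))) ⟩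
    ∑ S (λ x → ∑ (Vecˢ n) (λ v → ⟦ p x ⟧ * ⟦ all p v ⟧))
      ≡⟨ ∑-cong S (λ x → ∑-*ˡ (Vecˢ n) ⟦ p x ⟧ _) ⟩
    ∑ S (λ x → ⟦ p x ⟧ * ∑ (Vecˢ n) (λ v → ⟦ all p v ⟧))
      ≡⟨ ∑-*ʳ S _ _ ⟩
    ∑ S (λ x → ⟦ p x ⟧) * ∑ (Vecˢ n) (λ v → ⟦ all p v ⟧)
      ≡⟨ cong (∑ S (λ x → ⟦ p x ⟧) *_) (Vecˢ-all n p) ⟩
    ∑ S (λ x → ⟦ p x ⟧) ^ suc n  ∎
    where open ≡-Reasoning

  Vecˢ-total : ∀ n → total (Vecˢ n) ≡ T ^ n
  Vecˢ-total zero    = refl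
  Vecˢ-total (suc n) = begin
    ∑ S (λ x → total (Vecˢ n))   ≡⟨ ∑-const S _ ⟩
    total (Vecˢ n) * T           ≡⟨ *-comm _ T ⟩
    T * total (Vecˢ n)           ≡⟨ cong (T *_) (Vecˢ-total n) ⟩
    T * T ^ n                    ∎
    where open ≡-Reasoning

  Vecˢ-++ : ∀ m {n} (f : Vec A (m + n) → ℕ) →
    ∑ (Vecˢ (m + n)) f ≡ ∑ (Vecˢ m) (λ u → ∑ (Vecˢ n) (λ v → f (u V.++ v)))
  Vecˢ-++ zero    f = refl
  Vecˢ-++ (suc m) f = ∑-cong S (λ x → Vecˢ-++ m (λ v → f (x ∷ v)))

-- The pushforward of `S` along `g` is `S′`.
Image : ∀ {A B : Set} → (A → B) → Summation A → Summation B → Set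
Image g S S′ = ∀ f → ∑ S (λ x → f (g x)) ≡ ∑ S′ f

Vecˢ-image : ∀ {A B : Set} {g : A → B} {S S′} → Image g S S′ →
  ∀ n → Image (V.map g) (Vecˢ S n) (Vecˢ S′ n)
Vecˢ-image im zero    f = refl
Vecˢ-image {S = S} {S′} im (suc n) f =
  trans (∑-cong S (λ x → Vecˢ-image im n (λ v → f (_ ∷ v)))) (im (λ y → ∑ (Vecˢ S′ n) (λ v → f (y ∷ v))))

-- The proofs are abstract to keep conversion checking from comparing them.
abstract
  interchange : ∀ w x y z → w + x + (y + z) ≡ w + y + (x + z)
  interchange = solve-∀

  interchange-* : ∀ a b x y z w → a * (x + y) + b * (z + w) ≡ a * x + b * z + (a * y + b * w)
  interchange-* = solve-∀

Boolˢ : ℕ → ℕ → Summation Bool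
Boolˢ a b = record
  { ∑      = λ f → a * f true + b * f false
  ; ∑-cong = λ e → cong₂ (λ x y → a * x + b * y) (e true) (e false)
  ; ∑-+    = λ f g → interchange-* a b (f true) (g true) (f false) (g false) }

Finˢ : ∀ n → Summation (Fin n)
Finˢ zero    = record { ∑ = λ _ → 0 ; ∑-cong = λ _ → refl ; ∑-+ = λ _ _ → refl }
Finˢ (suc n) = record
  { ∑      = λ f → f zero + ∑ (Finˢ n) (λ i → f (suc i))
  ; ∑-cong = λ e → cong₂ _+_ (e zero) (∑-cong (Finˢ n) (λ i → e (suc i)))
  ; ∑-+    = λ f g → trans (cong (f zero + g zero +_) (∑-+ (Finˢ n) _ _))
                           (interchange (f zero) (g zero) _ _) }

∑-swap : ∀ {A : Set} (S : Summation A) n (f : A → Fin n → ℕ) →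
  ∑ S (λ x → ∑ (Finˢ n) (f x)) ≡ ∑ (Finˢ n) (λ i → ∑ S (λ x → f x i))
∑-swap S zero    f = ∑-0 S
∑-swap S (suc n) f = trans (∑-+ S _ _) (cong (∑ S (λ x → f x zero) +_) (∑-swap S n (λ x i → f x (suc i))))

∈-∑ : ∀ {n} (F : Fin n → ℕ) f → F f ≤ ∑ (Finˢ n) F
∈-∑ F zero    = m≤m+n _ _
∈-∑ F (suc f) = ≤-trans (∈-∑ (F ∘ suc) f) (m≤n+m _ (F zero))

-- Inequalities for powers

-- Bernoulli's inequality (1 + d/y)^(k+1) ≥ 1 + (k+1)d/y, multiplied by y^(k+1).
bernoulli : ∀ y d k → y ^ k * (y + d + k * d) ≤ (y + d) ^ suc k
bernoulli y d zero    = ≤-reflexive (lemma y d)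
  where
  lemma : ∀ y d → 1 * (y + d + 0) ≡ (y + d) * 1
  lemma = solve-∀
bernoulli y d (suc k) = begin
  y * y ^ k * (y + d + (d + k * d))          ≤⟨ m≤m+n _ (d * (y ^ k * (d + k * d))) ⟩
  y * y ^ k * (y + d + (d + k * d)) + d * (y ^ k * (d + k * d)) ≡⟨ lemma y d k (y ^ k) ⟩
  (y + d) * (y ^ k * (y + d + k * d))        ≤⟨ *-monoʳ-≤ (y + d) (bernoulli y d k) ⟩
  (y + d) * (y + d) ^ suc k                  ∎
  where
  open ≤-Reasoning
  lemma : ∀ y d k p → y * p * (y + d + (d + k * d)) + d * (p * (d + k * d)) ≡ (y + d) * (p * (y + d + k * d))
  lemma = solve-∀

-- (1 - d/(y+d))^k ≥ 1 - kd/(y+d) for c = y + d - kd.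
bernoulli′ : ∀ y d k c → c + k * d ≡ y + d → (y + d) ^ k * c ≤ y ^ k * (y + d)
bernoulli′ y d zero    c e = ≤-reflexive (cong (_+ 0) (trans (sym (+-identityʳ c)) e))
bernoulli′ y d (suc k) c e = begin
  x * x ^ k * c                       ≤⟨ ineq ⟩
  y * (x ^ k * (c + d))               ≤⟨ *-monoʳ-≤ y (bernoulli′ y d k (c + d) e′) ⟩
  y * (y ^ k * x)                     ≡⟨ *-assoc y _ _ ⟨
  y * y ^ k * x                       ∎
  where
  open ≤-Reasoning
  x = y + d
  e′ : c + d + k * d ≡ x
  e′ = trans (+-assoc c d (k * d)) e
  lemma₁ : ∀ x p c → x * p * c ≡ p * (x * c)
  lemma₁ = solve-∀
  lemma₂ : ∀ y p c → p * (y * c) ≡ y * (p * c)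
  lemma₂ = solve-∀
  lemma₃ : ∀ y d c → (y + d) * c ≡ y * c + d * c
  lemma₃ = solve-∀
  lemma₄ : ∀ y d c → y * (c + d) ≡ y * c + d * y
  lemma₄ = solve-∀
  c≤y : c ≤ y
  c≤y = +-cancelʳ-≤ d c y (≤-trans (m≤m+n (c + d) (k * d)) (≤-reflexive e′))
  ineq : x * x ^ k * c ≤ y * (x ^ k * (c + d))
  ineq = begin
    x * x ^ k * c              ≡⟨ lemma₁ x (x ^ k) c ⟩
    x ^ k * (x * c)            ≡⟨ cong (x ^ k *_) (lemma₃ y d c) ⟩
    x ^ k * (y * c + d * c)    ≤⟨ *-monoʳ-≤ (x ^ k) (+-monoʳ-≤ (y * c) (*-monoʳ-≤ d c≤y)) ⟩
    x ^ k * (y * c + d * y)    ≡⟨ cong (x ^ k *_) (lemma₄ y d c) ⟨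
    x ^ k * (y * (c + d))      ≡⟨ lemma₂ y (x ^ k) (c + d) ⟩
    y * (x ^ k * (c + d))      ∎

-- By `bernoulli′`, (1 - d/(y+d))^k ≥ 1 - kd/(y+d) ≥ 1/2. The case d = 0 is separate because the
-- proof cancels `y + d`, which must be nonzero.
^-double : ∀ y d k → 2 * (k * d) ≤ y + d → (y + d) ^ k ≤ 2 * y ^ k
^-double y zero    k h = begin
  (y + 0) ^ k  ≡⟨ cong (_^ k) (+-identityʳ y) ⟩
  y ^ k        ≤⟨ m≤m+n _ _ ⟩
  2 * y ^ k    ∎
  where open ≤-Reasoning
^-double y (suc d) k h = *-cancelʳ-≤ _ _ (y + suc d) {{>-nonZero (≤-trans (s≤s z≤n) (m≤n+m (suc d) y))}} (begin
  x ^ k * x                     ≤⟨ *-monoʳ-≤ (x ^ k) x≤2c ⟩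
  x ^ k * (2 * c)               ≡⟨ lemma (x ^ k) c ⟩
  2 * (x ^ k * c)               ≤⟨ *-monoʳ-≤ 2 (bernoulli′ y (suc d) k c e) ⟩
  2 * (y ^ k * x)               ≡⟨ *-assoc 2 (y ^ k) x ⟨
  2 * y ^ k * x                 ∎)
  where
  open ≤-Reasoning
  x = y + suc d
  kd≤x : k * suc d ≤ x
  kd≤x = ≤-trans (m≤m+n _ _) h
  c = x ∸ k * suc d
  e : c + k * suc d ≡ x
  e = m∸n+n≡m kd≤x
  lemma : ∀ p c → p * (2 * c) ≡ 2 * (p * c)
  lemma = solve-∀
  x≤2c : x ≤ 2 * c
  x≤2c = +-cancelʳ-≤ (2 * (k * suc d)) x (2 * c) (begin
    x + 2 * (k * suc d)         ≤⟨ +-monoʳ-≤ x h ⟩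
    x + x                       ≡⟨ cong₂ _+_ (sym e) (trans (sym e) (sym (+-identityʳ _))) ⟩
    (c + k * suc d) + ((c + k * suc d) + 0) ≡⟨ *-distribˡ-+ 2 c (k * suc d) ⟩
    2 * c + 2 * (k * suc d)     ∎)

-- Bernoulli for (1 + 1/y)^(1+y). In `amplify` it says that 1+y trials of success probability
-- 1/(1+y) all fail with probability at most 1/2.
2*y^[1+y]≤[1+y]^[1+y] : ∀ y → 2 * y ^ suc y ≤ suc y ^ suc y
2*y^[1+y]≤[1+y]^[1+y] y = begin
  2 * (y * y ^ y)             ≡⟨ lemma y (y ^ y) ⟩
  y ^ y * (y + y * 1)         ≤⟨ *-monoʳ-≤ (y ^ y) (+-monoˡ-≤ (y * 1) (m≤m+n y 1)) ⟩
  y ^ y * (y + 1 + y * 1)     ≤⟨ bernoulli y 1 y ⟩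
  (y + 1) ^ suc y             ≡⟨ cong (_^ suc y) (+-comm y 1) ⟩
  suc y ^ suc y               ∎
  where
  open ≤-Reasoning
  lemma : ∀ y p → 2 * (y * p) ≡ p * (y + y * 1)
  lemma = solve-∀

^-distribʳ-* : ∀ k m n → (m * n) ^ k ≡ m ^ k * n ^ k
^-distribʳ-* zero    m n = refl
^-distribʳ-* (suc k) m n = trans (cong (m * n *_) (^-distribʳ-* k m n)) (lemma m n (m ^ k) (n ^ k))
  where
  lemma : ∀ m n p q → m * n * (p * q) ≡ m * p * (n * q)
  lemma = solve-∀

-- Repeating an experiment of success probability at least 1/R for R·k
-- times, all fail with probability at most 2^(-k).
amplify : ∀ R .{{_ : NonZero R}} k {x t} → x * R ≤ pred R * t → x ^ (R * k) * 2 ^ k ≤ t ^ (R * k)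
amplify (suc y) k {x} {t} h = begin
  x ^ (suc y * k) * 2 ^ k      ≡⟨ cong (_* 2 ^ k) (^-*-assoc x (suc y) k) ⟨
  (x ^ suc y) ^ k * 2 ^ k      ≡⟨ ^-distribʳ-* k (x ^ suc y) 2 ⟨
  (x ^ suc y * 2) ^ k          ≤⟨ ^-monoˡ-≤ k step ⟩
  (t ^ suc y) ^ k              ≡⟨ ^-*-assoc t (suc y) k ⟩
  t ^ (suc y * k)              ∎
  where
  open ≤-Reasoning
  s = suc y
  step : x ^ s * 2 ≤ t ^ s
  step = *-cancelʳ-≤ _ _ (s ^ s) {{m^n≢0 s s}} (begin
    x ^ s * 2 * s ^ s     ≡⟨ lemma (x ^ s) (s ^ s) ⟩
    2 * (x ^ s * s ^ s)   ≡⟨ cong (2 *_) (^-distribʳ-* s x s) ⟨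
    2 * (x * s) ^ s       ≤⟨ *-monoʳ-≤ 2 (^-monoˡ-≤ s h) ⟩
    2 * (y * t) ^ s       ≡⟨ cong (2 *_) (^-distribʳ-* s y t) ⟩
    2 * (y ^ s * t ^ s)   ≡⟨ *-assoc 2 (y ^ s) (t ^ s) ⟨
    2 * y ^ s * t ^ s     ≤⟨ *-monoˡ-≤ (t ^ s) (2*y^[1+y]≤[1+y]^[1+y] y) ⟩
    s ^ s * t ^ s         ≡⟨ *-comm (s ^ s) (t ^ s) ⟩
    t ^ s * s ^ s         ∎)
    where
    lemma : ∀ p q → p * 2 * q ≡ 2 * (p * q)
    lemma = solve-∀

2xy≤x²+y² : ∀ x y → 2 * (x * y) ≤ x * x + y * y
2xy≤x²+y² zero    y       = z≤n
2xy≤x²+y² (suc x) zero    = ≤-trans (≤-reflexive (cong (2 *_) (*-zeroʳ x))) z≤n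
2xy≤x²+y² (suc x) (suc y) = begin
  2 * (suc x * suc y)                   ≡⟨ l₁ x y ⟩
  2 * (x * y) + (2 * x + 2 * y + 2)     ≤⟨ +-monoˡ-≤ _ (2xy≤x²+y² x y) ⟩
  x * x + y * y + (2 * x + 2 * y + 2)   ≡⟨ l₂ x y ⟩
  suc x * suc x + suc y * suc y         ∎
  where
  open ≤-Reasoning
  l₁ : ∀ x y → 2 * (suc x * suc y) ≡ 2 * (x * y) + (2 * x + 2 * y + 2)
  l₁ = solve-∀
  l₂ : ∀ x y → x * x + y * y + (2 * x + 2 * y + 2) ≡ suc x * suc x + suc y * suc y
  l₂ = solve-∀

-- Random subsets

-- Each element belongs to the random subset independently, with odds a : b.
μ : ℕ → ℕ → ∀ n → Summation (Subset n)
μ a b = Vecˢ (Boolˢ a b)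

μ-total : ∀ a b n → total (μ a b n) ≡ (a + b) ^ n
μ-total a b n = trans (Vecˢ-total (Boolˢ a b) n)
  (cong (_^ n) (cong₂ _+_ (*-identityʳ a) (*-identityʳ b)))

-- Pairing each S containing f with S - f changes the weight only in the coordinate f, from a to b.
μ-flip : ∀ a b {n} (f : Fin n) (F : Subset n → ℕ) →
  b * ∑ (μ a b n) (λ S → ⟦ lookup S f ⟧ * F (S [ f ]≔ false)) ≡
  a * ∑ (μ a b n) (λ S → ⟦ not (lookup S f) ⟧ * F S)
μ-flip a b {suc n} zero F = begin
  b * (a * ∑ M (λ v → F (false ∷ v) + 0) + b * ∑ M (λ v → 0))
    ≡⟨ cong (λ z → b * (a * x + b * z)) (∑-0 M) ⟩
  b * (a * x + b * 0)  ≡⟨ lemma a b x ⟩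
  a * (a * 0 + b * x)  ≡⟨ cong (λ z → a * (a * z + b * x)) (∑-0 M) ⟨
  a * (a * ∑ M (λ v → 0) + b * x) ∎
  where
  open ≡-Reasoning
  M = μ a b n
  x = ∑ M (λ v → F (false ∷ v) + 0)
  lemma : ∀ a b x → b * (a * x + b * 0) ≡ a * (a * 0 + b * x)
  lemma = solve-∀
μ-flip a b {suc n} (suc f) F = begin
  b * (a * x₁ + b * x₀)          ≡⟨ lemma a b x₁ x₀ ⟩
  a * (b * x₁) + b * (b * x₀)    ≡⟨ cong₂ (λ u v → a * u + b * v) (μ-flip a b f (F ∘ (true ∷_))) (μ-flip a b f (F ∘ (false ∷_))) ⟩
  a * (a * y₁) + b * (a * y₀)    ≡⟨ lemma′ a b y₁ y₀ ⟩
  a * (a * y₁ + b * y₀)          ∎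
  where
  open ≡-Reasoning
  M = μ a b n
  x₁ = ∑ M (λ S → ⟦ lookup S f ⟧ * F (true ∷ (S [ f ]≔ false)))
  x₀ = ∑ M (λ S → ⟦ lookup S f ⟧ * F (false ∷ (S [ f ]≔ false)))
  y₁ = ∑ M (λ S → ⟦ not (lookup S f) ⟧ * F (true ∷ S))
  y₀ = ∑ M (λ S → ⟦ not (lookup S f) ⟧ * F (false ∷ S))
  lemma : ∀ a b x y → b * (a * x + b * y) ≡ a * (b * x) + b * (b * y)
  lemma = solve-∀
  lemma′ : ∀ a b x y → a * (a * x) + b * (a * y) ≡ a * (a * x + b * y)
  lemma′ = solve-∀

μ-∈ : ∀ a b {n} (f : Fin n) →
  (a + b) * ∑ (μ a b n) (λ S → ⟦ lookup S f ⟧) ≡ a * total (μ a b n)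
μ-∈ a b {n} f = begin
  (a + b) * x        ≡⟨ *-distribʳ-+ x a b ⟩
  a * x + b * x      ≡⟨ cong (λ z → a * x + b * z) (∑-cong M (λ S → sym (*-identityʳ _))) ⟩
  a * x + b * ∑ M (λ S → ⟦ lookup S f ⟧ * 1) ≡⟨ cong (a * x +_) (μ-flip a b f (λ _ → 1)) ⟩
  a * x + a * ∑ M (λ S → ⟦ not (lookup S f) ⟧ * 1) ≡⟨ *-distribˡ-+ a x _ ⟨
  a * (x + ∑ M (λ S → ⟦ not (lookup S f) ⟧ * 1)) ≡⟨ cong (a *_) (∑-+ M _ _) ⟨
  a * ∑ M (λ S → ⟦ lookup S f ⟧ + ⟦ not (lookup S f) ⟧ * 1)
    ≡⟨ cong (a *_) (∑-cong M (λ S → trans (cong (⟦ lookup S f ⟧ +_) (*-identityʳ _)) (⟦⟧-not (lookup S f)))) ⟩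
  a * total M        ∎
  where
  open ≡-Reasoning
  M = μ a b n
  x = ∑ M (λ S → ⟦ lookup S f ⟧)

-- The coordinates inside and outside H are independent; the factor `total` appears because the
-- measure is not normalised.
μ-independent : ∀ a b {n} (H : Subset n) (F F′ : Subset n → ℕ) →
  ∑ (μ a b n) (λ S → F (S ∩ H) * F′ (S ─ H)) * total (μ a b n) ≡
  ∑ (μ a b n) (λ S → F (S ∩ H)) * ∑ (μ a b n) (λ S → F′ (S ─ H))
μ-independent a b []          F F′ = *-identityʳ _
μ-independent a b {suc n} (true ∷ H)  F F′ = begin
  (a * x₁ + b * x₀) * (a * t + b * t)        ≡⟨ lemma a b x₁ x₀ t ⟩
  (a * (x₁ * t) + b * (x₀ * t)) * (a + b)     ≡⟨ cong₂ (λ u v → (a * u + b * v) * (a + b))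
      (μ-independent a b H (F ∘ (true ∷_)) (F′ ∘ (false ∷_))) (μ-independent a b H (F ∘ (false ∷_)) (F′ ∘ (false ∷_))) ⟩
  (a * (y₁ * z) + b * (y₀ * z)) * (a + b)     ≡⟨ lemma′ a b y₁ y₀ z ⟩
  (a * y₁ + b * y₀) * (a * z + b * z)        ∎
  where
  open ≡-Reasoning
  M = μ a b n
  t = total M
  x₁ = ∑ M (λ S → F (true ∷ (S ∩ H)) * F′ (false ∷ (S ─ H)))
  x₀ = ∑ M (λ S → F (false ∷ (S ∩ H)) * F′ (false ∷ (S ─ H)))
  y₁ = ∑ M (λ S → F (true ∷ (S ∩ H)))
  y₀ = ∑ M (λ S → F (false ∷ (S ∩ H)))
  z = ∑ M (λ S → F′ (false ∷ (S ─ H)))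
  lemma : ∀ a b x y t → (a * x + b * y) * (a * t + b * t) ≡ (a * (x * t) + b * (y * t)) * (a + b)
  lemma = solve-∀
  lemma′ : ∀ a b x y t → (a * (x * t) + b * (y * t)) * (a + b) ≡ (a * x + b * y) * (a * t + b * t)
  lemma′ = solve-∀
μ-independent a b {suc n} (false ∷ H) F F′ = begin
  (a * x₁ + b * x₀) * (a * t + b * t)        ≡⟨ lemma a b x₁ x₀ t ⟩
  (a * (x₁ * t) + b * (x₀ * t)) * (a + b)     ≡⟨ cong₂ (λ u v → (a * u + b * v) * (a + b))
      (μ-independent a b H (F ∘ (false ∷_)) (F′ ∘ (true ∷_))) (μ-independent a b H (F ∘ (false ∷_)) (F′ ∘ (false ∷_))) ⟩
  (a * (y * z₁) + b * (y * z₀)) * (a + b)     ≡⟨ lemma′ a b y z₁ z₀ ⟩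
  (a * y + b * y) * (a * z₁ + b * z₀)        ∎
  where
  open ≡-Reasoning
  M = μ a b n
  t = total M
  x₁ = ∑ M (λ S → F (false ∷ (S ∩ H)) * F′ (true ∷ (S ─ H)))
  x₀ = ∑ M (λ S → F (false ∷ (S ∩ H)) * F′ (false ∷ (S ─ H)))
  y  = ∑ M (λ S → F (false ∷ (S ∩ H)))
  z₁ = ∑ M (λ S → F′ (true ∷ (S ─ H)))
  z₀ = ∑ M (λ S → F′ (false ∷ (S ─ H)))
  lemma : ∀ a b x y t → (a * x + b * y) * (a * t + b * t) ≡ (a * (x * t) + b * (y * t)) * (a + b)
  lemma = solve-∀
  lemma′ : ∀ a b y z w → (a * (y * z) + b * (y * w)) * (a + b) ≡ (a * y + b * y) * (a * z + b * w)
  lemma′ = solve-∀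

-- Cauchy-Schwarz for a change of the sampling rate inside H: the second
-- moment of the likelihood ratio is (B/A)^|H|, where
-- A = K a′ b′ and B = A + K (a - a′)² for K = a + b = a′ + b′, a = a′ + d.
μ-rate : ∀ a′ d b {n} (H : Subset n) (F : Subset n → Bool) →
  let a = a′ + d ; b′ = d + b ; K = a + b ; A = K * (a′ * b′) ; B = A + K * (d * d)
      x = ∑ (μ a b n) (λ S → ⟦ F (S ∩ H) ⟧) in
  x * x * A ^ ∣ H ∣ ≤ ∑ (μ a′ b′ n) (λ S → ⟦ F (S ∩ H) ⟧) * K ^ n * B ^ ∣ H ∣
μ-rate a′ d b [] F = ≤-reflexive (lemma (F []))
  where
  lemma : ∀ x → ⟦ x ⟧ * ⟦ x ⟧ * 1 ≡ ⟦ x ⟧ * 1 * 1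
  lemma true  = refl
  lemma false = refl
μ-rate a′ d b {suc n} (false ∷ H) F = begin
  (a * x + b * x) * (a * x + b * x) * A ^ h   ≡⟨ lemma a b x (A ^ h) ⟩
  K * K * (x * x * A ^ h)                     ≤⟨ *-monoʳ-≤ (K * K) (μ-rate a′ d b H (F ∘ (false ∷_))) ⟩
  K * K * (y * K ^ n * B ^ h)                 ≡⟨ lemma′ a′ d b y (K ^ n) (B ^ h) ⟩
  (a′ * y + b′ * y) * (K * K ^ n) * B ^ h     ∎
  where
  open ≤-Reasoning
  a = a′ + d
  b′ = d + b
  K = a + b
  A = K * (a′ * b′)
  B = A + K * (d * d)
  h = ∣ H ∣
  x = ∑ (μ a b n) (λ S → ⟦ F (false ∷ (S ∩ H)) ⟧)
  y = ∑ (μ a′ b′ n) (λ S → ⟦ F (false ∷ (S ∩ H)) ⟧)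
  lemma : ∀ a b x p → (a * x + b * x) * (a * x + b * x) * p ≡ (a + b) * (a + b) * (x * x * p)
  lemma = solve-∀
  lemma′ : ∀ a d b y p q → (a + d + b) * (a + d + b) * (y * p * q) ≡ (a * y + (d + b) * y) * ((a + d + b) * p) * q
  lemma′ = solve-∀
μ-rate a′ d b {suc n} (true ∷ H) F = begin
  (a * x₁ + b * x₀) * (a * x₁ + b * x₀) * (A * A ^ h)   ≡⟨ l₁ (a * x₁ + b * x₀) K (a′ * b′) (A ^ h) ⟩
  K * ((a * x₁ + b * x₀) * (a * x₁ + b * x₀) * (a′ * b′)) * A ^ h   ≤⟨ *-monoˡ-≤ (A ^ h) (*-monoʳ-≤ K cauchy) ⟩
  K * (C * (a′ * (x₁ * x₁) + b′ * (x₀ * x₀))) * A ^ h   ≡⟨ l₃ K C a′ b′ x₁ x₀ (A ^ h) ⟩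
  K * C * (a′ * (x₁ * x₁ * A ^ h) + b′ * (x₀ * x₀ * A ^ h))
     ≤⟨ *-monoʳ-≤ (K * C) (+-mono-≤ (*-monoʳ-≤ a′ (μ-rate a′ d b H (F ∘ (true ∷_)))) (*-monoʳ-≤ b′ (μ-rate a′ d b H (F ∘ (false ∷_))))) ⟩
  K * C * (a′ * (y₁ * K ^ n * B ^ h) + b′ * (y₀ * K ^ n * B ^ h))
     ≡⟨ l₄ K C a′ b′ y₁ y₀ (K ^ n) (B ^ h) ⟩
  (a′ * y₁ + b′ * y₀) * (K * K ^ n) * (C * B ^ h)       ≡⟨ cong (λ z → (a′ * y₁ + b′ * y₀) * (K * K ^ n) * (z * B ^ h)) (C≡B a′ d b) ⟩
  (a′ * y₁ + b′ * y₀) * (K * K ^ n) * (B * B ^ h)       ∎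
  where
  open ≤-Reasoning
  a = a′ + d
  b′ = d + b
  K = a + b
  A = K * (a′ * b′)
  B = A + K * (d * d)
  -- C/(a′b′) = a²/a′ + b²/b′ is the weighted sum of squared likelihood ratios in one coordinate,
  -- the constant in the Cauchy-Schwarz inequality.
  C = a * a * b′ + b * b * a′
  h = ∣ H ∣
  x₁ = ∑ (μ a b n) (λ S → ⟦ F (true ∷ (S ∩ H)) ⟧)
  x₀ = ∑ (μ a b n) (λ S → ⟦ F (false ∷ (S ∩ H)) ⟧)
  y₁ = ∑ (μ a′ b′ n) (λ S → ⟦ F (true ∷ (S ∩ H)) ⟧)
  y₀ = ∑ (μ a′ b′ n) (λ S → ⟦ F (false ∷ (S ∩ H)) ⟧)
  l₁ : ∀ s K c p → s * s * (K * c * p) ≡ K * (s * s * c) * p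
  l₁ = solve-∀
  l₃ : ∀ K C a b x y p → K * (C * (a * (x * x) + b * (y * y))) * p ≡ K * C * (a * (x * x * p) + b * (y * y * p))
  l₃ = solve-∀
  l₄ : ∀ K C a b x y p q → K * C * (a * (x * p * q) + b * (y * p * q)) ≡ (a * x + b * y) * (K * p) * (C * q)
  l₄ = solve-∀
  C≡B : ∀ a d b → (a + d) * (a + d) * (d + b) + b * b * a ≡ (a + d + b) * (a * (d + b)) + (a + d + b) * (d * d)
  C≡B = solve-∀
  cauchy : (a * x₁ + b * x₀) * (a * x₁ + b * x₀) * (a′ * b′) ≤ C * (a′ * (x₁ * x₁) + b′ * (x₀ * x₀))
  cauchy = begin
    (a * x₁ + b * x₀) * (a * x₁ + b * x₀) * (a′ * b′)  ≡⟨ e₁ a b a′ b′ x₁ x₀ ⟩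
    a * a * (x₁ * x₁) * (a′ * b′) + b * b * (x₀ * x₀) * (a′ * b′) + 2 * ((b * a′ * x₁) * (a * b′ * x₀))
      ≤⟨ +-monoʳ-≤ (a * a * (x₁ * x₁) * (a′ * b′) + b * b * (x₀ * x₀) * (a′ * b′)) (2xy≤x²+y² (b * a′ * x₁) (a * b′ * x₀)) ⟩
    a * a * (x₁ * x₁) * (a′ * b′) + b * b * (x₀ * x₀) * (a′ * b′) + (b * a′ * x₁ * (b * a′ * x₁) + a * b′ * x₀ * (a * b′ * x₀))
      ≡⟨ e₂ a b a′ b′ x₁ x₀ ⟩
    C * (a′ * (x₁ * x₁) + b′ * (x₀ * x₀)) ∎
    where
    e₁ : ∀ a b c d x y → (a * x + b * y) * (a * x + b * y) * (c * d) ≡ a * a * (x * x) * (c * d) + b * b * (y * y) * (c * d) + 2 * ((b * c * x) * (a * d * y))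
    e₁ = solve-∀
    e₂ : ∀ a b c d x y → a * a * (x * x) * (c * d) + b * b * (y * y) * (c * d) + (b * c * x * (b * c * x) + a * d * y * (a * d * y)) ≡ (a * a * d + b * b * c) * (c * (x * x) + d * (y * y))
    e₂ = solve-∀

-- The exponential moment of -|S ∩ G| controls the lower tail.
μ-size : ∀ a b {n} (G : Subset n) c →
  ∑ (μ a b n) (λ S → ⟦ ∣ S ∩ G ∣ ≤ᵇ c ⟧) * (2 * (a + b)) ^ ∣ G ∣ ≤
  2 ^ c * (a + b) ^ n * (a + 2 * b) ^ ∣ G ∣
μ-size a b []          c = begin
  1 * 1           ≤⟨ m^n>0 2 c ⟩
  2 ^ c           ≡⟨ lemma (2 ^ c) ⟨
  2 ^ c * 1 * 1   ∎
  where
  open ≤-Reasoning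
  lemma : ∀ p → p * 1 * 1 ≡ p
  lemma = solve-∀
μ-size a b {suc n} (false ∷ G) c = begin
  (a * x + b * x) * q                 ≡⟨ l₁ a b x q ⟩
  (a + b) * (x * q)                   ≤⟨ *-monoʳ-≤ (a + b) (μ-size a b G c) ⟩
  (a + b) * (2 ^ c * (a + b) ^ n * r) ≡⟨ l₂ (a + b) (2 ^ c) _ r ⟩
  2 ^ c * ((a + b) * (a + b) ^ n) * r ∎
  where
  open ≤-Reasoning
  x = ∑ (μ a b n) (λ S → ⟦ ∣ S ∩ G ∣ ≤ᵇ c ⟧)
  q = (2 * (a + b)) ^ ∣ G ∣
  r = (a + 2 * b) ^ ∣ G ∣
  l₁ : ∀ a b x q → (a * x + b * x) * q ≡ (a + b) * (x * q)
  l₁ = solve-∀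
  l₂ : ∀ K s p r → K * (s * p * r) ≡ s * (K * p) * r
  l₂ = solve-∀
μ-size a b {suc n} (true ∷ G) zero = begin
  (a * ∑ M (λ S → 0) + b * x) * (2 * K * q)   ≡⟨ cong (λ z → (a * z + b * x) * (2 * K * q)) (∑-0 M) ⟩
  (a * 0 + b * x) * (2 * K * q)               ≡⟨ l₁ a b x K q ⟩
  2 * b * K * (x * q)                         ≤⟨ *-monoʳ-≤ (2 * b * K) (μ-size a b G 0) ⟩
  2 * b * K * (1 * K ^ n * r)                 ≤⟨ m≤n+m _ (a * K * (1 * K ^ n * r)) ⟩
  a * K * (1 * K ^ n * r) + 2 * b * K * (1 * K ^ n * r) ≡⟨ l₂ a b K (K ^ n) r ⟩
  1 * (K * K ^ n) * ((a + 2 * b) * r)         ∎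
  where
  open ≤-Reasoning
  M = μ a b n
  K = a + b
  x = ∑ M (λ S → ⟦ ∣ S ∩ G ∣ ≤ᵇ 0 ⟧)
  q = (2 * (a + b)) ^ ∣ G ∣
  r = (a + 2 * b) ^ ∣ G ∣
  l₁ : ∀ a b x K q → (a * 0 + b * x) * (2 * K * q) ≡ 2 * b * K * (x * q)
  l₁ = solve-∀
  l₂ : ∀ a b K p r → a * K * (1 * p * r) + 2 * b * K * (1 * p * r) ≡ 1 * (K * p) * ((a + 2 * b) * r)
  l₂ = solve-∀
μ-size a b {suc n} (true ∷ G) (suc c) = begin
  (a * ∑ M (λ S → ⟦ suc ∣ S ∩ G ∣ ≤ᵇ suc c ⟧) + b * y) * (2 * K * q)
    ≡⟨ cong (λ z → (a * z + b * y) * (2 * K * q)) (∑-cong M (λ S → cong ⟦_⟧ (lemma ∣ S ∩ G ∣ c))) ⟩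
  (a * x + b * y) * (2 * K * q)               ≡⟨ l₁ a b x y K q ⟩
  2 * K * (a * (x * q) + b * (y * q))         ≤⟨ *-monoʳ-≤ (2 * K) (+-mono-≤ (*-monoʳ-≤ a (μ-size a b G c)) (*-monoʳ-≤ b (μ-size a b G (suc c)))) ⟩
  2 * K * (a * (2 ^ c * K ^ n * r) + b * (2 * 2 ^ c * K ^ n * r)) ≡⟨ l₂ a b K (K ^ n) r (2 ^ c) ⟩
  2 * 2 ^ c * (K * K ^ n) * ((a + 2 * b) * r)  ∎
  where
  open ≤-Reasoning
  M = μ a b n
  K = a + b
  x = ∑ M (λ S → ⟦ ∣ S ∩ G ∣ ≤ᵇ c ⟧)
  y = ∑ M (λ S → ⟦ ∣ S ∩ G ∣ ≤ᵇ suc c ⟧)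
  q = (2 * (a + b)) ^ ∣ G ∣
  r = (a + 2 * b) ^ ∣ G ∣
  lemma : ∀ m k → (suc m ≤ᵇ suc k) ≡ (m ≤ᵇ k)
  lemma zero    k = refl
  lemma (suc m) k = refl
  l₁ : ∀ a b x y K q → (a * x + b * y) * (2 * K * q) ≡ 2 * K * (a * (x * q) + b * (y * q))
  l₁ = solve-∀
  l₂ : ∀ a b K p r s → 2 * K * (a * (s * p * r) + b * (2 * s * p * r)) ≡ 2 * s * (K * p) * ((a + 2 * b) * r)
  l₂ = solve-∀

-- Matroids

∈-remove : ∀ {n} {S : Subset n} {x f} → x ∈ S → f ≢ x → x ∈ S [ f ]≔ false
∈-remove here        f≢x = keep f≢x
  where
  keep : ∀ {n} {S : Subset n} {f} → f ≢ zero → zero ∈ (true ∷ S) [ f ]≔ false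
  keep {f = zero}  f≢0 = contradiction refl f≢0
  keep {f = suc f} _   = here
∈-remove {f = zero}  (there x∈S) f≢x = there x∈S
∈-remove {f = suc f} (there x∈S) f≢x = there (∈-remove x∈S (f≢x ∘ cong suc))

remove-⊆ : ∀ {n} {S : Subset n} f → S [ f ]≔ false ⊆ S
remove-⊆ {S = _ ∷ _} zero    (there x∈S) = there x∈S
remove-⊆ {S = _ ∷ _} (suc f) here        = here
remove-⊆ {S = _ ∷ _} (suc f) (there x∈S) = there (remove-⊆ f x∈S)

∉-remove : ∀ {n} {S : Subset n} f → f ∉ S [ f ]≔ false
∉-remove {S = _ ∷ _} zero    ()
∉-remove {S = _ ∷ S} (suc f) (there f∈) = ∉-remove {S = S} f f∈

∣∪⁅⁆∣ : ∀ {n} {S : Subset n} {x} → x ∉ S → ∣ S ∪ ⁅ x ⁆ ∣ ≡ suc ∣ S ∣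
∣∪⁅⁆∣ {S = true  ∷ S} {zero}  x∉ = contradiction here x∉
∣∪⁅⁆∣ {S = false ∷ S} {zero}  x∉ = cong (suc ∘ ∣_∣) (⊆-antisym (λ m → [ id , (λ x∈⊥ → contradiction x∈⊥ ∉⊥) ]′ (x∈p∪q⁻ S ⊥ m)) (p⊆p∪q ⊥))
∣∪⁅⁆∣ {S = true  ∷ S} {suc x} x∉ = cong suc (∣∪⁅⁆∣ (x∉ ∘ there))
∣∪⁅⁆∣ {S = false ∷ S} {suc x} x∉ = ∣∪⁅⁆∣ (x∉ ∘ there)

∈─⇒∉ : ∀ {n} {p q : Subset n} {x} → x ∈ p ─ q → x ∉ q
∈─⇒∉ {p = _ ∷ _} {_ ∷ _} (there m) (there m′) = ∈─⇒∉ m m′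

∪-⊆ : ∀ {n} {p q r : Subset n} → p ⊆ r → q ⊆ r → p ∪ q ⊆ r
∪-⊆ {p = p} {q} p⊆r q⊆r m = [ p⊆r , q⊆r ]′ (x∈p∪q⁻ p q m)

⁅⁆-⊆ : ∀ {n} {x : Fin n} {r} → x ∈ r → ⁅ x ⁆ ⊆ r
⁅⁆-⊆ {x = x} {r} x∈r y∈ = subst (_∈ r) (sym (x∈⁅y⁆⇒x≡y x y∈)) x∈r

∪-monoʳ : ∀ {n} (p : Subset n) {q r : Subset n} → q ⊆ r → p ∪ q ⊆ p ∪ r
∪-monoʳ p {q} {r} q⊆r = ∪-⊆ (p⊆p∪q r) (q⊆p∪q p r ∘ q⊆r)

∩-monoʳ : ∀ {n} (p : Subset n) {q r : Subset n} → q ⊆ r → p ∩ q ⊆ p ∩ r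
∩-monoʳ p {q} {r} q⊆r m = x∈p∩q⁺ (proj₁ (x∈p∩q⁻ p q m) , q⊆r (proj₂ (x∈p∩q⁻ p q m)))

-- A has full rank, expressed through sizes of independent sets so that no rank or closure operator
-- is needed.
Spans : ∀ {n} → (Subset n → Bool) → Subset n → Set
Spans ind A = ∀ T → ind T ≡ true → ∃[ R ] (R ⊆ A × ind R ≡ true × ∣ T ∣ ≤ ∣ R ∣)

module Matroid {n : ℕ} {ind : Subset n → Bool} (M : IsMatroid ind) where
  open IsMatroid M

  dependent-⊆ : ∀ {S T} → S ⊆ T → ind S ≡ false → ind T ≡ false
  dependent-⊆ {S} {T} S⊆T dep with ind T in eq
  ... | false = refl
  ... | true  = trans (sym (hereditary S⊆T eq)) dep

  extend : ∀ k {S T} → ind S ≡ true → ind T ≡ true → ∣ S ∣ + k ≡ ∣ T ∣ →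
           ∃[ R ] (S ⊆ R × R ⊆ S ∪ T × ind R ≡ true × ∣ R ∣ ≡ ∣ T ∣)
  extend zero    {S} {T} iS iT e = S , id , p⊆p∪q T , iS , trans (sym (+-identityʳ _)) e
  extend (suc k) {S} {T} iS iT e
    with augment iS iT (subst (∣ S ∣ <_) e (m<m+n _ z<s))
  ... | x , x∈T , x∉S , iSx with extend k iSx iT (trans (cong (_+ k) (∣∪⁅⁆∣ x∉S)) (trans (sym (+-suc _ k)) e))
  ... | R , Sx⊆R , R⊆ , iR , eR =
    R , Sx⊆R ∘ p⊆p∪q ⁅ x ⁆ , ∪-⊆ (∪-⊆ (p⊆p∪q T) (⁅⁆-⊆ (q⊆p∪q S T x∈T))) (q⊆p∪q S T) ∘ R⊆ , iR , eR

  extend-≤ : ∀ {S T} → ind S ≡ true → ind T ≡ true → ∣ S ∣ ≤ ∣ T ∣ →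
             ∃[ R ] (S ⊆ R × R ⊆ S ∪ T × ind R ≡ true × ∣ R ∣ ≡ ∣ T ∣)
  extend-≤ {S} {T} iS iT h = extend (∣ T ∣ ∸ ∣ S ∣) iS iT (m+[n∸m]≡n h)

  spans-⊆ : ∀ {A B} → A ⊆ B → Spans ind A → Spans ind B
  spans-⊆ A⊆B sp T iT with sp T iT
  ... | R , R⊆ , rest = R , A⊆B ∘ R⊆ , rest

  -- All elements of B outside A go at once, since each witness Q lies inside A. An independent R ⊆
  -- A is grown one element at a time. If augmentation offers x outside A, spanned by Q, then either
  -- Q is already larger than R, or Q extends within Q ∪ R ∪ {x} to size ∣ R ∣ + 1. The extension
  -- avoids x because Q ∪ {x} is dependent, so it lies in A.
  spans-delete : ∀ {A B} →
    (∀ f → f ∈ B → f ∈ A ⊎ ∃[ Q ] (Q ⊆ A × ind Q ≡ true × ind (Q ∪ ⁅ f ⁆) ≡ false)) →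
    Spans ind B → Spans ind A
  spans-delete {A} {B} red sp T iT with sp T iT
  ... | T′ , T′⊆B , iT′ , T≤T′ with grow ∣ T′ ∣ ≤-refl
    where
    grow : ∀ k → k ≤ ∣ T′ ∣ → ∃[ R ] (R ⊆ A × ind R ≡ true × k ≤ ∣ R ∣)
    grow zero    _ = ⊥ , (λ m → contradiction m ∉⊥) , empty-indep , z≤n
    grow (suc k) k<T′ with grow k (<⇒≤ k<T′)
    ... | R , R⊆A , iR , k≤R with suc k ≤? ∣ R ∣
    ... | yes k<R = R , R⊆A , iR , k<R
    ... | no  k≮R with augment iR iT′ (≤-<-trans (≤-pred (≰⇒> k≮R)) k<T′)
    ... | x , x∈T′ , x∉R , iRx with red x (T′⊆B x∈T′)
    ... | inj₁ x∈A = R ∪ ⁅ x ⁆ , ∪-⊆ R⊆A (⁅⁆-⊆ x∈A) , iRx , ≤-trans (s≤s k≤R) (≤-reflexive (sym (∣∪⁅⁆∣ x∉R)))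
    ... | inj₂ (Q , Q⊆A , iQ , dQx) with suc k ≤? ∣ Q ∣
    ... | yes k<Q = Q , Q⊆A , iQ , k<Q
    ... | no  k≮Q with extend-≤ iQ iRx (≤-trans (≤-pred (≰⇒> k≮Q)) (≤-trans k≤R (≤-trans (n≤1+n _) (≤-reflexive (sym (∣∪⁅⁆∣ x∉R))))))
    ... | P , Q⊆P , P⊆ , iP , eP = P , P⊆A , iP , ≤-trans (s≤s k≤R) (≤-reflexive (sym (trans eP (∣∪⁅⁆∣ x∉R))))
      where
      x∉P : x ∉ P
      x∉P x∈P with trans (sym (hereditary (∪-⊆ Q⊆P (⁅⁆-⊆ x∈P)) iP)) dQx
      ... | ()
      P⊆A : P ⊆ A
      P⊆A {y} y∈P with x∈p∪q⁻ Q (R ∪ ⁅ x ⁆) (P⊆ y∈P)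
      ... | inj₁ y∈Q = Q⊆A y∈Q
      ... | inj₂ y∈Rx with x∈p∪q⁻ R ⁅ x ⁆ y∈Rx
      ... | inj₁ y∈R = R⊆A y∈R
      ... | inj₂ y∈x = contradiction (subst (_∈ P) (x∈⁅y⁆⇒x≡y x y∈x) y∈P) x∉P
  ... | R , R⊆A , iR , T′≤R = R , R⊆A , iR , ≤-trans T≤T′ T′≤R

  spans⇒basis : ∀ {B} → ind B ≡ true → Spans ind B → IsBasis ind B
  spans⇒basis {B} iB sp = iB , λ S B⊆S iS → ⊆-antisym (S⊆B B⊆S iS) B⊆S
    where
    S⊆B : ∀ {S} → B ⊆ S → ind S ≡ true → S ⊆ B
    S⊆B {S} B⊆S iS {x} x∈S with x ∈? B
    ... | yes x∈B = x∈B
    ... | no  x∉B with sp S iS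
    ... | R , R⊆B , iR , S≤R =
      contradiction (<-≤-trans (p⊂q⇒∣p∣<∣q∣ (B⊆S , x , x∈S , x∉B)) (≤-trans S≤R (p⊆q⇒∣p∣≤∣q∣ R⊆B))) (<-irrefl refl)

  -- The elements f for which I ∪ (Q ∪ ⁅ g ⁆) − f is independent form the
  -- circuit closed by g, so any set H containing them is dependent on I.
  circuit-or-escape : ∀ I Q g H → ind (I ∪ Q) ≡ true → ind (I ∪ (Q ∪ ⁅ g ⁆)) ≡ false →
    ind (I ∪ ((Q ∪ ⁅ g ⁆) ∩ H)) ≡ false ⊎
    ∃[ f ] (f ∈ Q ∪ ⁅ g ⁆ × f ∉ H × ind (I ∪ ((Q ∪ ⁅ g ⁆) [ f ]≔ false)) ≡ true)
  circuit-or-escape I Q g H iIQ dg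
    with anyFin? (λ f → f ∈? (Q ∪ ⁅ g ⁆) ×-dec ¬? (f ∈? H) ×-dec (ind (I ∪ ((Q ∪ ⁅ g ⁆) [ f ]≔ false)) Bool.≟ true))
  ... | yes escape = inj₂ escape
  ... | no  none with ind (I ∪ ((Q ∪ ⁅ g ⁆) ∩ H)) in iU
  ... | false = inj₁ refl
  ... | true  = contradiction (trans (sym (hereditary all⊆ iU′)) dg) λ ()
    where
    Qg = Q ∪ ⁅ g ⁆
    U  = I ∪ (Qg ∩ H)
    ⇐H : ∀ f → f ∈ Qg → ind (I ∪ (Qg [ f ]≔ false)) ≡ true → f ∈ H
    ⇐H f f∈ i with f ∈? H
    ... | yes f∈H = f∈H
    ... | no  f∉H = contradiction (f , f∈ , f∉H , i) none
    split : ∀ {x} → x ∈ U → x ∈ I ∪ Q ⊎ x ≡ g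
    split x∈U with x∈p∪q⁻ I (Qg ∩ H) x∈U
    ... | inj₁ x∈I = inj₁ (p⊆p∪q Q x∈I)
    ... | inj₂ x∈ with x∈p∪q⁻ Q ⁅ g ⁆ (proj₁ (x∈p∩q⁻ Qg H x∈))
    ... | inj₁ x∈Q = inj₁ (q⊆p∪q I Q x∈Q)
    ... | inj₂ x∈g = inj₂ (x∈⁅y⁆⇒x≡y g x∈g)
    g∈H : g ∈ H
    g∈H = ⇐H g (q⊆p∪q Q ⁅ g ⁆ (x∈⁅x⁆ g)) (hereditary (∪-monoʳ I sub) iIQ)
      where
      sub : Qg [ g ]≔ false ⊆ Q
      sub {x} m with x∈p∪q⁻ Q ⁅ g ⁆ (remove-⊆ g m)
      ... | inj₁ x∈Q = x∈Q
      ... | inj₂ x∈g = contradiction (subst (_∈ Qg [ g ]≔ false) (x∈⁅y⁆⇒x≡y g x∈g) m) (∉-remove {S = Qg} g)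
    g∈U : g ∈ U
    g∈U = q⊆p∪q I (Qg ∩ H) (x∈p∩q⁺ (q⊆p∪q Q ⁅ g ⁆ (x∈⁅x⁆ g) , g∈H))
    U≤IQ : ∣ U ∣ ≤ ∣ I ∪ Q ∣
    U≤IQ with ∣ U ∣ ≤? ∣ I ∪ Q ∣
    ... | yes h = h
    ... | no  h with augment iIQ iU (≰⇒> h)
    ... | x , x∈U , x∉IQ , iIQx with split x∈U
    ... | inj₁ x∈IQ = contradiction x∈IQ x∉IQ
    ... | inj₂ refl = contradiction (trans (sym (hereditary (∪-⊆ (p⊆p∪q ⁅ g ⁆ ∘ p⊆p∪q Q) (∪-⊆ (p⊆p∪q ⁅ g ⁆ ∘ q⊆p∪q I Q) (q⊆p∪q (I ∪ Q) ⁅ g ⁆))) iIQx)) dg) λ ()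
    -- If U were independent, it would extend to an independent U′ of size ∣ I ∪ Q ∣ inside I ∪ Q ∪
    -- {g}. The aim is to show that U′ contains all of this dependent set.
    ext = extend-≤ iU iIQ U≤IQ
    U′  = proj₁ ext
    U⊆U′ : U ⊆ U′
    U⊆U′ = proj₁ (proj₂ ext)
    iU′ : ind U′ ≡ true
    iU′ = proj₁ (proj₂ (proj₂ (proj₂ ext)))
    split′ : ∀ {x} → x ∈ U′ → x ∈ I ∪ Q ⊎ x ≡ g
    split′ x∈U′ with x∈p∪q⁻ U (I ∪ Q) (proj₁ (proj₂ (proj₂ ext)) x∈U′)
    ... | inj₁ x∈U  = split x∈U
    ... | inj₂ x∈IQ = inj₁ x∈IQ
    -- If f ∈ Q were missing from U′, then augmenting (I ∪ Q) - f from the larger U′ could only add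
    -- g. So I ∪ (Qg - f) would be independent, which puts f into H and hence into U.
    IQ⊆U′ : I ∪ Q ⊆ U′
    IQ⊆U′ {f} f∈IQ with f ∈? U′
    ... | yes f∈U′ = f∈U′
    ... | no  f∉U′ with x∈p∪q⁻ I Q f∈IQ
    ... | inj₁ f∈I = contradiction (U⊆U′ (p⊆p∪q (Qg ∩ H) f∈I)) f∉U′
    ... | inj₂ f∈Q with augment (hereditary (p─q⊆p (I ∪ Q) ⁅ f ⁆) iIQ) iU′
                          (<-≤-trans (x∈p⇒∣p-x∣<∣p∣ f∈IQ) (≤-reflexive (sym (proj₂ (proj₂ (proj₂ (proj₂ ext)))))))
    ... | x , x∈U′ , x∉ , ix with split′ x∈U′
    ... | inj₁ x∈IQ = contradiction (x∈p∧x≢y⇒x∈p-y x∈IQ (λ { refl → f∉U′ x∈U′ })) x∉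
    ... | inj₂ refl = contradiction (U⊆U′ (q⊆p∪q I (Qg ∩ H) (x∈p∩q⁺ (p⊆p∪q ⁅ g ⁆ f∈Q , f∈H)))) f∉U′
      where
      W = (I ∪ Q) - f
      sub : I ∪ (Qg [ f ]≔ false) ⊆ W ∪ ⁅ g ⁆
      sub = ∪-⊆ inI inQ
        where
        inI : I ⊆ W ∪ ⁅ g ⁆
        inI m = p⊆p∪q ⁅ g ⁆ (x∈p∧x≢y⇒x∈p-y (p⊆p∪q Q m) (λ { refl → f∉U′ (U⊆U′ (p⊆p∪q (Qg ∩ H) m)) }))
        inQ : Qg [ f ]≔ false ⊆ W ∪ ⁅ g ⁆
        inQ {y} m with x∈p∪q⁻ Q ⁅ g ⁆ (remove-⊆ f m)
        ... | inj₂ y∈g = q⊆p∪q W ⁅ g ⁆ y∈g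
        ... | inj₁ y∈Q = p⊆p∪q ⁅ g ⁆ (x∈p∧x≢y⇒x∈p-y (q⊆p∪q I Q y∈Q) (λ { refl → ∉-remove {S = Qg} f m }))
      f∈H : f ∈ H
      f∈H = ⇐H f (p⊆p∪q ⁅ g ⁆ f∈Q) (hereditary sub ix)
    all⊆ : I ∪ Qg ⊆ U′
    all⊆ = ∪-⊆ (IQ⊆U′ ∘ p⊆p∪q Q) (∪-⊆ (IQ⊆U′ ∘ q⊆p∪q I Q) (⁅⁆-⊆ (U⊆U′ g∈U)))

-- Prefixes and the first circuit of a sample

prefix : ∀ {n} → ℕ → Subset n → Subset n
prefix zero    S       = ⊥
prefix (suc k) []      = []
prefix (suc k) (x ∷ S) = x ∷ prefix k S

∈-prefix⁻ : ∀ {n} k {S : Subset n} {x} → x ∈ prefix k S → x ∈ S × toℕ x < k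
∈-prefix⁻ zero    x∈ = contradiction x∈ ∉⊥
∈-prefix⁻ (suc k) {_ ∷ S} here       = here , z<s
∈-prefix⁻ (suc k) {_ ∷ S} (there x∈) = let x∈S , x<k = ∈-prefix⁻ k x∈ in there x∈S , s<s x<k

∈-prefix⁺ : ∀ {n k} {S : Subset n} {x} → x ∈ S → toℕ x < k → x ∈ prefix k S
∈-prefix⁺ {k = suc k} here        _         = here
∈-prefix⁺ {k = suc k} (there x∈S) (s<s x<k) = there (∈-prefix⁺ x∈S x<k)

prefix-suc : ∀ {n k} {S : Subset n} (k<n : k < n) → prefix (suc k) S ⊆ prefix k S ∪ ⁅ fromℕ< k<n ⁆
prefix-suc {k = k} k<n {x} m with ∈-prefix⁻ (suc k) m | toℕ x ≟ k
... | _   , _     | yes refl = q⊆p∪q _ _ (subst (λ z → x ∈ ⁅ z ⁆) (sym (fromℕ<-toℕ x k<n)) (x∈⁅x⁆ x))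
... | x∈S , x<1+k | no  x≢k  = p⊆p∪q _ (∈-prefix⁺ x∈S (≤∧≢⇒< (≤-pred x<1+k) x≢k))

prefix-stable : ∀ {n k} {S : Subset n} (k<n : k < n) → fromℕ< k<n ∉ S → prefix (suc k) S ⊆ prefix k S
prefix-stable {k = k} {S} k<n g∉S {x} m with ∈-prefix⁻ (suc k) m
... | x∈S , x<1+k = ∈-prefix⁺ x∈S (≤∧≢⇒< (≤-pred x<1+k)
  λ { refl → g∉S (subst (_∈ S) (sym (fromℕ<-toℕ x k<n)) x∈S) })

anyUpTo : ℕ → (ℕ → Bool) → Bool
anyUpTo zero    p = p 0
anyUpTo (suc k) p = p (suc k) ∨ anyUpTo k p

anyUpTo⁺ : ∀ m p {k} → k ≤ m → p k ≡ true → anyUpTo m p ≡ true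
anyUpTo⁺ zero    p z≤n pk = pk
anyUpTo⁺ (suc m) p {k} k≤ pk with k ≟ suc m
... | yes refl rewrite pk = refl
... | no  k≢   = trans (cong (p (suc m) ∨_) (anyUpTo⁺ m p (≤-pred (≤∧≢⇒< k≤ k≢)) pk)) (∨-zeroʳ _)

anyUpTo⁻ : ∀ m p → anyUpTo m p ≡ true → ∃[ k ] (k ≤ m × p k ≡ true)
anyUpTo⁻ zero    p e = 0 , z≤n , e
anyUpTo⁻ (suc m) p e with p (suc m) in eq
... | true  = suc m , ≤-refl , eq
... | false = let k , k≤m , pk = anyUpTo⁻ m p e in k , m≤n⇒m≤1+n k≤m , pk

-- Within the contraction by I, the sample S ∩ G has an independent prefix
-- spanning f, where f lies in G but was not sampled.
closed : ∀ {n} → (Subset n → Bool) → Subset n → Subset n → Subset n → Fin n → Bool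
closed {n} ind I G S f = lookup G f ∧ (not (lookup S f) ∧
  anyUpTo n (λ k → ind (I ∪ prefix k (S ∩ G)) ∧ not (ind (I ∪ (prefix k (S ∩ G) ∪ ⁅ f ⁆)))))

∧-true⁻ : ∀ {x y} → x ∧ y ≡ true → x ≡ true × y ≡ true
∧-true⁻ {true} {true} _ = refl , refl

∧-true⁺ : ∀ {x y} → x ≡ true → y ≡ true → x ∧ y ≡ true
∧-true⁺ refl refl = refl

not-true⁻ : ∀ {x} → not x ≡ true → x ≡ false
not-true⁻ {false} _ = refl

∉⇒lookup : ∀ {n} {S : Subset n} {x} → x ∉ S → lookup S x ≡ false
∉⇒lookup {S = S} {x} x∉S = ¬-not (x∉S ∘ lookup⇒[]= x S)

lookup⇒∉ : ∀ {n} {S : Subset n} {x} → lookup S x ≡ false → x ∉ S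
lookup⇒∉ e x∈S with trans (sym ([]=⇒lookup x∈S)) e
... | ()

closed⁻ : ∀ {n} (ind : Subset n → Bool) I G S f → closed ind I G S f ≡ true →
  f ∈ G × f ∉ S × ∃[ k ] (k ≤ n × ind (I ∪ prefix k (S ∩ G)) ≡ true × ind (I ∪ (prefix k (S ∩ G) ∪ ⁅ f ⁆)) ≡ false)
closed⁻ {n} ind I G S f e =
  let eG , e′ = ∧-true⁻ {lookup G f} e
      eS , e″ = ∧-true⁻ {not (lookup S f)} e′
      k , k≤n , ek = anyUpTo⁻ n _ e″
      e₁ , e₂ = ∧-true⁻ ek
  in lookup⇒[]= f G eG , lookup⇒∉ (not-true⁻ eS) , k , k≤n , e₁ , not-true⁻ e₂

module _ {n : ℕ} {ind : Subset n → Bool} (M : IsMatroid ind) where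
  open IsMatroid M
  open Matroid M

  -- An escaping element f of the first circuit C of S can be moved out of
  -- the sample: the prefix then still contains C − f, hence spans f.
  dependent-split : ∀ {I G H S} → ind I ≡ true → H ⊆ G → ind (I ∪ (S ∩ G)) ≡ false →
    ind (I ∪ (S ∩ H)) ≡ false ⊎
    ∃[ f ] (lookup H f ≡ false × lookup S f ≡ true × closed ind I G (S [ f ]≔ false) f ≡ true)
  dependent-split {I} {G} {H} {S} iI H⊆G dep = search n ≤-refl (dependent-⊆ (∪-monoʳ I (λ {x} m → ∈-prefix⁺ m (toℕ<n x))) dep)
    where
    R = S ∩ G
    -- Descends to the shortest dependent prefix; its last element g closes the first circuit.
    search : ∀ k → k ≤ n → ind (I ∪ prefix k R) ≡ false →
      ind (I ∪ (S ∩ H)) ≡ false ⊎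
      ∃[ f ] (lookup H f ≡ false × lookup S f ≡ true × closed ind I G (S [ f ]≔ false) f ≡ true)
    search zero    k≤n d = contradiction (trans (sym (hereditary (∪-⊆ id (λ m → contradiction m ∉⊥)) iI)) d) λ ()
    search (suc k) k<n d with ind (I ∪ prefix k R) in iQ
    ... | false = search k (<⇒≤ k<n) iQ
    ... | true  = conclude (circuit-or-escape I (prefix k R) g H iQ (dependent-⊆ (∪-monoʳ I (prefix-suc k<n)) d))
      where
      g = fromℕ< k<n
      Qg = prefix k R ∪ ⁅ g ⁆
      g∈R : g ∈ R
      g∈R with g ∈? R
      ... | yes h  = h
      ... | no g∉R = contradiction (trans (sym d) (hereditary (∪-monoʳ I (prefix-stable k<n g∉R)) iQ)) λ ()
      Qg⊆R : Qg ⊆ R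
      Qg⊆R = ∪-⊆ (proj₁ ∘ ∈-prefix⁻ k) (⁅⁆-⊆ g∈R)
      conclude : _ → _
      conclude (inj₁ dH) = inj₁ (dependent-⊆ (∪-monoʳ I λ m → let m′ , x∈H = x∈p∩q⁻ Qg H m in
        x∈p∩q⁺ (proj₁ (x∈p∩q⁻ S G (Qg⊆R m′)) , x∈H)) dH)
      conclude (inj₂ (f , f∈Qg , f∉H , if)) = inj₂ (f , ∉⇒lookup f∉H , []=⇒lookup f∈S ,
        ∧-true⁺ ([]=⇒lookup f∈G) (∧-true⁺ (cong not (lookup∘updateAt f S))
          -- The witness is the prefix length `suc k`, not k: the prefix of S - f must still contain
          -- g when f ≠ g, and adding f back then restores the dependent prefix.
          (anyUpTo⁺ n _ k<n (∧-true⁺ (hereditary (∪-monoʳ I without-f) if) (cong not (dependent-⊆ (∪-monoʳ I with-f) d))))))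
        where
        f∈S = proj₁ (x∈p∩q⁻ S G (Qg⊆R f∈Qg))
        f∈G = proj₂ (x∈p∩q⁻ S G (Qg⊆R f∈Qg))
        without-f : prefix (suc k) ((S [ f ]≔ false) ∩ G) ⊆ Qg [ f ]≔ false
        without-f {x} m with ∈-prefix⁻ (suc k) m
        ... | x∈ , x<1+k with x∈p∩q⁻ (S [ f ]≔ false) G x∈
        ... | x∈S′ , x∈G = ∈-remove (prefix-suc k<n (∈-prefix⁺ (x∈p∩q⁺ (remove-⊆ f x∈S′ , x∈G)) x<1+k))
                                    (λ { refl → ∉-remove {S = S} f x∈S′ })
        with-f : prefix (suc k) R ⊆ prefix (suc k) ((S [ f ]≔ false) ∩ G) ∪ ⁅ f ⁆
        with-f {x} m with x Fin.≟ f | ∈-prefix⁻ (suc k) m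
        ... | yes refl | _ = q⊆p∪q _ _ (x∈⁅x⁆ f)
        ... | no x≢f | x∈R , x<1+k with x∈p∩q⁻ S G x∈R
        ... | x∈S , x∈G = p⊆p∪q _ (∈-prefix⁺ (x∈p∩q⁺ (∈-remove x∈S (x≢f ∘ sym) , x∈G)) x<1+k)

  -- A union bound over the escaping elements of `dependent-split`. By `μ-flip`, the event that f is
  -- sampled and spanned by the rest has a/b times the weight of f being unsampled and spanned.
  dependent-bound : ∀ {I G H} → ind I ≡ true → H ⊆ G → ∀ a b →
    let m = μ a b n in
    b * ∑ m (λ S → ⟦ not (ind (I ∪ (S ∩ G))) ⟧) ≤
    b * ∑ m (λ S → ⟦ not (ind (I ∪ (S ∩ H))) ⟧) +
    a * ∑ (Finˢ n) (λ f → ⟦ not (lookup H f) ⟧ * ∑ m (λ S → ⟦ closed ind I G S f ⟧))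
  dependent-bound {I} {G} {H} iI H⊆G a b = begin
    b * ∑ m (λ S → ⟦ not (ind (I ∪ (S ∩ G))) ⟧)     ≤⟨ *-monoʳ-≤ b (∑-mono m pointwise) ⟩
    b * ∑ m (λ S → dH S + ∑ (Finˢ n) (e S))         ≡⟨ cong (b *_) (∑-+ m dH _) ⟩
    b * (∑ m dH + ∑ m (λ S → ∑ (Finˢ n) (e S)))     ≡⟨ cong (λ z → b * (∑ m dH + z)) (∑-swap m n e) ⟩
    b * (∑ m dH + ∑ (Finˢ n) (λ f → ∑ m (λ S → e S f))) ≡⟨ *-distribˡ-+ b _ _ ⟩
    b * ∑ m dH + b * ∑ (Finˢ n) (λ f → ∑ m (λ S → e S f)) ≡⟨ cong (b * ∑ m dH +_) (sym (∑-*ˡ (Finˢ n) b _)) ⟩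
    b * ∑ m dH + ∑ (Finˢ n) (λ f → b * ∑ m (λ S → e S f)) ≤⟨ +-monoʳ-≤ (b * ∑ m dH) (∑-mono (Finˢ n) flipped) ⟩
    b * ∑ m dH + ∑ (Finˢ n) (λ f → a * (h f * ∑ m (c f))) ≡⟨ cong (b * ∑ m dH +_) (∑-*ˡ (Finˢ n) a _) ⟩
    b * ∑ m dH + a * ∑ (Finˢ n) (λ f → h f * ∑ m (c f)) ∎
    where
    open ≤-Reasoning
    m = μ a b n
    dH = λ S → ⟦ not (ind (I ∪ (S ∩ H))) ⟧
    h = λ f → ⟦ not (lookup H f) ⟧
    c = λ f S → ⟦ closed ind I G S f ⟧
    e : Subset n → Fin n → ℕ
    e S f = h f * (⟦ lookup S f ⟧ * c f (S [ f ]≔ false))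
    pointwise : ∀ S → ⟦ not (ind (I ∪ (S ∩ G))) ⟧ ≤ dH S + ∑ (Finˢ n) (e S)
    pointwise S with ind (I ∪ (S ∩ G)) in eq
    ... | true  = z≤n
    ... | false with dependent-split {S = S} iI H⊆G eq
    ... | inj₁ d rewrite d = s≤s z≤n
    ... | inj₂ (f , fH , fS , fc) = ≤-trans (≤-reflexive one) (≤-trans (∈-∑ (e S) f) (m≤n+m _ (dH S)))
      where
      one : 1 ≡ e S f
      one rewrite fH | fS | fc = refl
    flipped : ∀ f → b * ∑ m (λ S → e S f) ≤ a * (h f * ∑ m (c f))
    flipped f = begin
      b * ∑ m (λ S → e S f)                      ≡⟨ cong (b *_) (∑-*ˡ m (h f) _) ⟩
      b * (h f * ∑ m (λ S → ⟦ lookup S f ⟧ * c f (S [ f ]≔ false))) ≡⟨ lemma b (h f) _ ⟩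
      h f * (b * ∑ m (λ S → ⟦ lookup S f ⟧ * c f (S [ f ]≔ false))) ≡⟨ cong (h f *_) (μ-flip a b f (c f)) ⟩
      h f * (a * ∑ m (λ S → ⟦ not (lookup S f) ⟧ * c f S)) ≤⟨ *-monoʳ-≤ (h f) (*-monoʳ-≤ a (∑-mono m (λ S → drop (lookup S f) _))) ⟩
      h f * (a * ∑ m (c f))                      ≡⟨ lemma (h f) a _ ⟩
      a * (h f * ∑ m (c f))                      ∎
      where
      lemma : ∀ x y z → x * (y * z) ≡ y * (x * z)
      lemma = solve-∀
      drop : ∀ x y → ⟦ not x ⟧ * y ≤ y
      drop true  y = z≤n
      drop false y = ≤-reflexive (+-identityʳ y)

-- Random bits

Bits : ∀ k → Summation (Vec Bool k)
Bits = Vecˢ (Boolˢ 1 1)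

cut : ∀ {A : Set} m {n} → Vec A (m + n) → Vec A m × Vec A n
cut zero    v       = [] , v
cut (suc m) (x ∷ v) = let u , w = cut m v in x ∷ u , w

cut-++ : ∀ {A : Set} {m n} (u : Vec A m) (w : Vec A n) → cut m (u V.++ w) ≡ (u , w)
cut-++ []      w = refl
cut-++ (x ∷ u) w rewrite cut-++ u w = refl

record Sampler (A : Set) : Set where
  no-eta-equality
  field
    bits    : ℕ
    decode  : Vec Bool bits → A
    measure : Summation A
    correct : Image decode (Bits bits) measure

open Sampler

bitsSampler : ∀ k → Sampler (Vec Bool k)
bitsSampler k = record { bits = k ; decode = id ; measure = Bits k ; correct = λ f → refl }

vecSampler : ∀ {A} → Sampler A → ∀ m → Sampler (Vec A m)
vecSampler {A} S m = record
  { bits = m * bits S ; decode = dec m ; measure = Vecˢ (measure S) m ; correct = cor m }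
  where
  dec : ∀ m → Vec Bool (m * bits S) → Vec A m
  dec zero    _ = []
  dec (suc m) v = let u , w = cut (bits S) v in decode S u ∷ dec m w
  cor : ∀ m → Image (dec m) (Bits (m * bits S)) (Vecˢ (measure S) m)
  cor zero    f = refl
  cor (suc m) f = begin
    ∑ (Bits (bits S + m * bits S)) (λ v → f (dec (suc m) v))
      ≡⟨ Vecˢ-++ (Boolˢ 1 1) (bits S) _ ⟩
    ∑ (Bits (bits S)) (λ u → ∑ (Bits (m * bits S)) (λ w → f (dec (suc m) (u V.++ w))))
      ≡⟨ ∑-cong (Bits (bits S)) (λ u → ∑-cong (Bits (m * bits S)) (λ w →
           cong (λ p → f (decode S (proj₁ p) ∷ dec m (proj₂ p))) (cut-++ u w))) ⟩
    ∑ (Bits (bits S)) (λ u → ∑ (Bits (m * bits S)) (λ w → f (decode S u ∷ dec m w)))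
      ≡⟨ ∑-cong (Bits (bits S)) (λ u → cor m (λ ws → f (decode S u ∷ ws))) ⟩
    ∑ (Bits (bits S)) (λ u → ∑ (Vecˢ (measure S) m) (λ ws → f (decode S u ∷ ws)))
      ≡⟨ correct S _ ⟩
    ∑ (Vecˢ (measure S) (suc m)) f ∎
    where open ≡-Reasoning

Bits-total : ∀ k → total (Bits k) ≡ 2 ^ k
Bits-total = Vecˢ-total (Boolˢ 1 1)

sampler-total : ∀ {A} (S : Sampler A) → total (measure S) ≡ 2 ^ bits S
sampler-total S = trans (sym (correct S (λ _ → 1))) (Bits-total (bits S))

-- below k θ u compares the k-bit number u with θ.
below : ∀ k → ℕ → Vec Bool k → Bool
below zero    θ []          = 1 ≤ᵇ θ
below (suc k) θ (false ∷ u) = below k θ u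
below (suc k) θ (true ∷ u)  = below k (θ ∸ 2 ^ k) u

-- The first bit is the most significant. The lower half of the strings contributes min(θ, N) values
-- below θ and the upper half min(θ ∸ N, N), with N = 2^k.
below-image : ∀ k θ → Image (below k θ) (Bits k) (Boolˢ (θ ⊓ 2 ^ k) (2 ^ k ∸ θ))
below-image zero    zero    f = sym (+-identityʳ _)
below-image zero    (suc θ) f = sym (trans (cong₂ (λ x y → x * f true + y * f false) (cong suc (⊓-zeroʳ θ)) (0∸n≡0 θ)) (trans (+-identityʳ _) (+-identityʳ _)))
below-image (suc k) θ f = begin
  1 * ∑ (Bits k) (λ u → f (below k (θ ∸ N) u)) + 1 * ∑ (Bits k) (λ u → f (below k θ u))
    ≡⟨ cong₂ (λ x y → 1 * x + 1 * y) (below-image k (θ ∸ N) f) (below-image k θ f) ⟩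
  1 * (((θ ∸ N) ⊓ N) * t + (N ∸ (θ ∸ N)) * s) + 1 * ((θ ⊓ N) * t + (N ∸ θ) * s)
    ≡⟨ lemma ((θ ∸ N) ⊓ N) (θ ⊓ N) (N ∸ (θ ∸ N)) (N ∸ θ) t s ⟩
  ((θ ∸ N) ⊓ N + θ ⊓ N) * t + (N ∸ (θ ∸ N) + (N ∸ θ)) * s
    ≡⟨ cong₂ (λ x y → x * t + y * s) (proj₁ (halves (≤-total θ N))) (proj₂ (halves (≤-total θ N))) ⟩
  (θ ⊓ (2 * N)) * t + (2 * N ∸ θ) * s ∎
  where
  open ≡-Reasoning
  N = 2 ^ k
  t = f true
  s = f false
  lemma : ∀ a b c d t s → 1 * (a * t + c * s) + 1 * (b * t + d * s) ≡ (a + b) * t + (c + d) * s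
  lemma = solve-∀
  halves : θ ≤ N ⊎ N ≤ θ → ((θ ∸ N) ⊓ N + θ ⊓ N ≡ θ ⊓ (2 * N)) × (N ∸ (θ ∸ N) + (N ∸ θ) ≡ 2 * N ∸ θ)
  halves (inj₁ h) rewrite m≤n⇒m∸n≡0 h | m≤n⇒m⊓n≡m h | m≤n⇒m⊓n≡m (≤-trans h (m≤m+n N (N + 0))) =
    refl , sym (trans (cong (_∸ θ) (cong (N +_) (+-identityʳ N))) (+-∸-assoc N h))
  halves (inj₂ h) rewrite m≤n⇒m∸n≡0 h | m≥n⇒m⊓n≡n h | +-identityʳ N = p , q
    where
    p : (θ ∸ N) ⊓ N + N ≡ θ ⊓ (N + N)
    p = trans (+-distribʳ-⊓ N (θ ∸ N) N) (cong (_⊓ (N + N)) (m∸n+n≡m h))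
    q : N ∸ (θ ∸ N) + 0 ≡ N + N ∸ θ
    q = trans (+-identityʳ _) (trans (sym ([m+n]∸[m+o]≡n∸o N N (θ ∸ N))) (cong (N + N ∸_) (m+[n∸m]≡n h)))

-- `SucceedsWHP` asks for an explicit list of bad strings; this enumerates an event with length
-- exactly its measure.
support : ∀ k → (Vec Bool k → Bool) → List (Vec Bool k)
support zero    p = if p [] then [] ∷ [] else []
support (suc k) p = L.map (true ∷_) (support k (p ∘ (true ∷_))) ++ L.map (false ∷_) (support k (p ∘ (false ∷_)))

length-support : ∀ k p → length (support k p) ≡ ∑ (Bits k) (λ r → ⟦ p r ⟧)
length-support zero    p with p []
... | true  = refl
... | false = refl
length-support (suc k) p = begin
  length (support (suc k) p)  ≡⟨ length-++ (L.map (true ∷_) (support k (p ∘ (true ∷_)))) ⟩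
  _                           ≡⟨ cong₂ _+_ (length-map (true ∷_) (support k (p ∘ (true ∷_)))) (length-map (false ∷_) (support k (p ∘ (false ∷_)))) ⟩
  _                           ≡⟨ cong₂ _+_ (length-support k _) (length-support k _) ⟩
  _                           ≡⟨ cong₂ _+_ (*-identityˡ (∑ (Bits k) (λ r → ⟦ p (true ∷ r) ⟧))) (*-identityˡ (∑ (Bits k) (λ r → ⟦ p (false ∷ r) ⟧))) ⟨
  ∑ (Bits (suc k)) (λ r → ⟦ p r ⟧) ∎
  where open ≡-Reasoning

∈-support : ∀ k p r → p r ≡ true → r ∈ˡ support k p
∈-support zero    p [] e rewrite e = here refl
∈-support (suc k) p (true ∷ r)  e = ∈-++⁺ˡ (∈-map⁺ (true ∷_) (∈-support k _ r e))
∈-support (suc k) p (false ∷ r) e = ∈-++⁺ʳ (L.map (true ∷_) (support k (p ∘ (true ∷_)))) (∈-map⁺ (false ∷_) (∈-support k _ r e))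

-- Round-based algorithms as transition systems

-- Rebuilds an oracle from the recorded answers of a round, so that a transition can be written
-- against an arbitrary oracle. Its default `false` cannot influence a transition satisfying
-- `step-local`.
answer : ∀ {n} → List (Subset n) → List Bool → Subset n → Bool
answer (Q ∷ Qs) (x ∷ xs) T with ≡-dec Bool._≟_ Q T
... | yes _ = x
... | no  _ = answer Qs xs T
answer _ _ T = false

answer-correct : ∀ {n} (φ : Subset n → Bool) {Qs T} → T ∈ˡ Qs → answer Qs (L.map φ Qs) T ≡ φ T
answer-correct φ {Q ∷ Qs} {T} T∈ with ≡-dec Bool._≟_ Q T
answer-correct φ {Q ∷ Qs} {T} T∈         | yes Q≡T = cong φ Q≡T
answer-correct φ {Q ∷ Qs} {T} (here T≡Q) | no  Q≢T = contradiction (sym T≡Q) Q≢T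
answer-correct φ {Q ∷ Qs} {T} (there T∈) | no  Q≢T = answer-correct φ T∈

-- A round consumes one fresh w. States are not stored but recomputed from the history by `replay`;
-- `step-local` makes this agree with running on the true oracle.
module Protocol {n : ℕ} {W St : Set} (sampler : Sampler W)
  (queries : W → St → List (Subset n))
  (step : (Subset n → Bool) → W → St → St)
  (step-local : ∀ φ ψ s w → (∀ T → T ∈ˡ queries w s → φ T ≡ ψ T) → step φ w s ≡ step ψ w s)
  (s₀ : St) (out : St → Subset n) (T : ℕ) where

  replay : ∀ {t} → Vec W t → List (List Bool) → St → St
  replay (w ∷ ws) (xs ∷ h) s = replay ws h (step (answer (queries w s) xs) w s)
  replay _        _        s = s

  next : ∀ {t} → Vec W t → List (List Bool) → St → List (Subset n)
  next []       _        s = []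
  next (w ∷ ws) []       s = queries w s
  next (w ∷ ws) (xs ∷ h) s = next ws h (step (answer (queries w s) xs) w s)

  algorithm : Alg n
  algorithm = record
    { rbits  = bits (vecSampler sampler T)
    ; rounds = T
    ; query  = λ r h → next (decode (vecSampler sampler T) r) h s₀
    ; output = λ r h → out (replay (decode (vecSampler sampler T) r) h s₀) }

  query-length : ∀ c → (∀ w s → length (queries w s) ≤ c) → ∀ r h → length (query algorithm r h) ≤ c
  query-length c len r h = go (decode (vecSampler sampler T) r) h s₀
    where
    go : ∀ {t} (ws : Vec W t) h s → length (next ws h s) ≤ c
    go []       h        s = z≤n
    go (w ∷ ws) []       s = len w s
    go (w ∷ ws) (xs ∷ h) s = go ws h _

  module Run (ind : Subset n → Bool) where

    run : ∀ {t} → Vec W t → St → St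
    run []       s = s
    run (w ∷ ws) s = run ws (step ind w s)

    private
      trace : ∀ {t} → Vec W t → St → ℕ → List (List Bool)
      trace ws       s zero    = []
      trace []       s (suc k) = []
      trace (w ∷ ws) s (suc k) = L.map ind (queries w s) ∷ trace ws (step ind w s) k

      answered : ∀ w s → step (answer (queries w s) (L.map ind (queries w s))) w s ≡ step ind w s
      answered w s = step-local _ _ s w (λ _ → answer-correct ind)

      trace-suc : ∀ {t} (ws : Vec W t) s k → k < t →
        trace ws s (suc k) ≡ trace ws s k ++ L.map ind (next ws (trace ws s k) s) ∷ []
      trace-suc (w ∷ ws) s zero    _         = refl
      trace-suc (w ∷ ws) s (suc k) (s<s k<t) rewrite answered w s =
        cong (L.map ind (queries w s) ∷_) (trace-suc ws (step ind w s) k k<t)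

      history-trace : ∀ r k → k ≤ T → history algorithm ind r k ≡ trace (decode (vecSampler sampler T) r) s₀ k
      history-trace r zero    _   = refl
      history-trace r (suc k) k<T rewrite history-trace r k (<⇒≤ k<T) =
        sym (trace-suc (decode (vecSampler sampler T) r) s₀ k k<T)

      replay-trace : ∀ {t} (ws : Vec W t) s → replay ws (trace ws s t) s ≡ run ws s
      replay-trace []       s = refl
      replay-trace (w ∷ ws) s rewrite answered w s = replay-trace ws (step ind w s)

    result-run : ∀ r → result algorithm ind r ≡ out (run (decode (vecSampler sampler T) r) s₀)
    result-run r = cong out (trans (cong (λ h → replay ws h s₀) (history-trace r T ≤-refl)) (replay-trace ws s₀))
      where ws = decode (vecSampler sampler T) r

    -- A round is bad with probability at most 1/q given its state. If no round is bad, Φ ≤ T falls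
    -- to 0 within T rounds; `pred` lets it stay there.
    module Drift (Inv : St → Set) (Φ : St → ℕ) (bad : St → W → Bool) (q : ℕ)
      (rare : ∀ s → Inv s → ∑ (measure sampler) (λ w → ⟦ bad s w ⟧) * q ≤ total (measure sampler))
      (drift : ∀ s w → Inv s → bad s w ≡ false → Inv (step ind w s) × Φ (step ind w s) ≤ pred (Φ s)) where

      private
        S  = measure sampler
        To = total S

        badRun : ∀ {t} → St → Vec W t → Bool
        badRun s []       = false
        badRun s (w ∷ ws) = bad s w ∨ badRun (step ind w s) ws

        run-good : ∀ {t} s (ws : Vec W t) → Inv s → badRun s ws ≡ false → Inv (run ws s) × Φ (run ws s) ≤ Φ s ∸ t
        run-good         s []       inv e = inv , ≤-refl
        run-good {suc t} s (w ∷ ws) inv e with bad s w in eq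
        ... | false = let inv′ , d = drift s w inv eq
                          inv″ , d′ = run-good (step ind w s) ws inv′ e
                      in inv″ , ≤-trans d′ (≤-trans (∸-monoˡ-≤ t d) (≤-reflexive (trans (cong (_∸ t) (pred-∸ (Φ s))) (∸-+-assoc (Φ s) 1 t))))
          where
          pred-∸ : ∀ x → pred x ≡ x ∸ 1
          pred-∸ zero    = refl
          pred-∸ (suc x) = refl

        bad-bound : ∀ t s → Inv s → ∑ (Vecˢ S t) (λ ws → ⟦ badRun s ws ⟧) * q ≤ t * To ^ t
        bad-bound zero    s inv = z≤n
        bad-bound (suc t) s inv = begin
          ∑ S (λ w → ∑ V (λ ws → ⟦ bad s w ∨ badRun (step ind w s) ws ⟧)) * q
            ≡⟨ ∑-*ʳ S _ q ⟨
          ∑ S (λ w → ∑ V (λ ws → ⟦ bad s w ∨ badRun (step ind w s) ws ⟧) * q)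
            ≤⟨ ∑-mono S each ⟩
          -- A bad w is charged with all continuations, any other w with the inductive bound at its
          -- successor state.
          ∑ S (λ w → ⟦ bad s w ⟧ * (To ^ t * q) + t * To ^ t)
            ≡⟨ ∑-+ S _ _ ⟩
          ∑ S (λ w → ⟦ bad s w ⟧ * (To ^ t * q)) + ∑ S (λ w → t * To ^ t)
            ≡⟨ cong₂ _+_ (∑-*ʳ S _ _) (∑-const S _) ⟩
          ∑ S (λ w → ⟦ bad s w ⟧) * (To ^ t * q) + t * To ^ t * To
            ≡⟨ cong (_+ t * To ^ t * To) (lemma (∑ S (λ w → ⟦ bad s w ⟧)) (To ^ t) q) ⟩
          To ^ t * (∑ S (λ w → ⟦ bad s w ⟧) * q) + t * To ^ t * To
            ≤⟨ +-monoˡ-≤ _ (*-monoʳ-≤ (To ^ t) (rare s inv)) ⟩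
          To ^ t * To + t * To ^ t * To
            ≡⟨ lemma′ (To ^ t) To t ⟩
          suc t * To ^ suc t ∎
          where
          open ≤-Reasoning
          V = Vecˢ S t
          lemma : ∀ x y z → x * (y * z) ≡ y * (x * z)
          lemma = solve-∀
          lemma′ : ∀ p x t → p * x + t * p * x ≡ suc t * (x * p)
          lemma′ = solve-∀
          each : ∀ w → ∑ V (λ ws → ⟦ bad s w ∨ badRun (step ind w s) ws ⟧) * q ≤ ⟦ bad s w ⟧ * (To ^ t * q) + t * To ^ t
          each w with bad s w in eq
          ... | true  = ≤-trans (≤-reflexive (trans (cong (_* q) (Vecˢ-total S t)) (sym (+-identityʳ _)))) (m≤m+n _ _)
          ... | false = bad-bound t (step ind w s) (proj₁ (drift s w inv eq))

      whp : Inv s₀ → Φ s₀ ≤ T → ∀ {m} → T * m ≤ q → .{{_ : NonZero T}} →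
        (∀ s → Inv s → Φ s ≡ 0 → IsBasis ind (out s)) →
        ∃[ b ] (length b * m ≤ 2 ^ rbits algorithm × (∀ r → ¬ (r ∈ˡ b) → IsBasis ind (result algorithm ind r)))
      whp inv Φ≤T {m} Tm≤q fin = support _ p , *-cancelˡ-≤ T size , basis
        where
        open ≤-Reasoning
        D = vecSampler sampler T
        p = λ r → badRun s₀ (decode D r)
        size : T * (length (support _ p) * m) ≤ T * 2 ^ rbits algorithm
        size = begin
          T * (length (support _ p) * m)   ≡⟨ lemma T (length (support _ p)) m ⟩
          length (support _ p) * (T * m)   ≤⟨ *-monoʳ-≤ (length (support _ p)) Tm≤q ⟩
          length (support _ p) * q         ≡⟨ cong (_* q) (length-support _ p) ⟩
          ∑ (Bits (bits D)) (λ r → ⟦ p r ⟧) * q ≡⟨ cong (_* q) (correct D (λ ws → ⟦ badRun s₀ ws ⟧)) ⟩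
          ∑ (Vecˢ S T) (λ ws → ⟦ badRun s₀ ws ⟧) * q ≤⟨ bad-bound T s₀ inv ⟩
          T * To ^ T                       ≡⟨ cong (T *_) (Vecˢ-total S T) ⟨
          T * total (Vecˢ S T)             ≡⟨ cong (T *_) (sampler-total D) ⟩
          T * 2 ^ rbits algorithm          ∎
          where
          lemma : ∀ x y z → x * (y * z) ≡ y * (x * z)
          lemma = solve-∀
        basis : ∀ r → ¬ (r ∈ˡ support _ p) → IsBasis ind (result algorithm ind r)
        basis r r∉ with p r in eq
        ... | true  = contradiction (∈-support _ p r eq) r∉
        ... | false = let inv′ , d = run-good s₀ (decode D r) inv eq in
          subst (IsBasis ind) (sym (result-run r)) (fin _ inv′ (n≤0⇒n≡0 (≤-trans d (≤-reflexive (m≤n⇒m∸n≡0 Φ≤T)))))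

-- The algorithm

gather : ∀ {A B : Set} {m} → (A → List B) → Vec A m → List B
gather g []      = []
gather g (x ∷ v) = g x ++ gather g v

gather-All : ∀ {A B : Set} {m} (g : A → List B) {P : B → Set} (v : Vec A m) →
  (∀ T → T ∈ˡ gather g v → P T) → All (λ x → ∀ T → T ∈ˡ g x → P T) v
gather-All g []      h = []
gather-All g (x ∷ v) h = (λ T T∈ → h T (∈-++⁺ˡ T∈)) ∷ gather-All g v (λ T T∈ → h T (∈-++⁺ʳ (g x) T∈))

length-gather : ∀ {A B : Set} {m} (g : A → List B) (v : Vec A m) c →
  (∀ x → length (g x) ≤ c) → length (gather g v) ≤ m * c
length-gather g []      c h = z≤n
length-gather g (x ∷ v) c h = ≤-trans (≤-reflexive (length-++ (g x))) (+-mono-≤ (h x) (length-gather g v c h))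

any-cong : ∀ {A : Set} {p q : A → Bool} {m} {v : Vec A m} → All (λ x → p x ≡ q x) v → any p v ≡ any q v
any-cong []       = refl
any-cong (e ∷ es) = cong₂ _∨_ e (any-cong es)

map-cong-All : ∀ {A B : Set} {f g : A → B} {m} {v : Vec A m} → All (λ x → f x ≡ g x) v → V.map f v ≡ V.map g v
map-cong-All []       = refl
map-cong-All (e ∷ es) = cong₂ _∷_ e (map-cong-All es)

first : ∀ {A : Set} {m} → (A → Bool) → A → Vec A m → A
first p d []      = d
first p d (x ∷ v) = if p x then x else first p d v

first-cong : ∀ {A : Set} {p q : A → Bool} {m} {v : Vec A m} d → All (λ x → p x ≡ q x) v → first p d v ≡ first q d v
first-cong d []       = refl
first-cong {v = x ∷ v} d (e ∷ es) = cong₂ (λ b y → if b then x else y) e (first-cong d es)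

first-any : ∀ {A : Set} {m} (p : A → Bool) d (v : Vec A m) → any p v ≡ true → p (first p d v) ≡ true
first-any p d (x ∷ v) e with p x in eq
... | true  = eq
... | false = first-any p d v e

upTo-cong : ∀ m {p q : ℕ → Bool} → (∀ k → k ≤ m → p k ≡ q k) → anyUpTo m p ≡ anyUpTo m q
upTo-cong zero    h = h 0 z≤n
upTo-cong (suc m) h = cong₂ _∨_ (h (suc m) ≤-refl) (upTo-cong m (λ k k≤m → h k (m≤n⇒m≤1+n k≤m)))

-- I is contracted, E is what remains to be decided, and G ⊆ E is what has
-- not been set aside in the current epoch. The stage keeps ∣ E ∣ ≤ 2^(stage + σ₀).
record State (n : ℕ) : Set where
  no-eta-equality
  pattern
  constructor state
  field
    stage phase trial : ℕ
    I E G             : Subset n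

module _ {n : ℕ} where

  probe : Subset n → Subset n → List (Subset n)
  probe I Q = (I ∪ Q) ∷ L.map (λ f → I ∪ (Q ∪ ⁅ f ⁆)) (L.allFin n)

  prefixes : Subset n → Vec (Subset n) (suc n)
  prefixes R = tabulate (λ k → prefix (toℕ k) R)

  probes : Subset n → Subset n → List (Subset n)
  probes I R = (I ∪ R) ∷ gather (probe I) (prefixes R)

  length-probes : ∀ I R → length (probes I R) ≤ suc (suc n * suc n)
  length-probes I R = s≤s (length-gather (probe I) (prefixes R) (suc n) (λ Q →
    s≤s (≤-reflexive (trans (length-map (λ f → I ∪ (Q ∪ ⁅ f ⁆)) (L.allFin n)) (length-tabulate id)))))

  ∈-gather-tabulate : ∀ {A B : Set} {m} (g : A → List B) (h : Fin m → A) i {T} → T ∈ˡ g (h i) → T ∈ˡ gather g (tabulate h)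
  ∈-gather-tabulate g h zero    T∈ = ∈-++⁺ˡ T∈
  ∈-gather-tabulate g h (suc i) T∈ = ∈-++⁺ʳ (g (h zero)) (∈-gather-tabulate g (h ∘ suc) i T∈)

  probe-⊆ : ∀ {I R} k → k ≤ n → ∀ {T} → T ∈ˡ probe I (prefix k R) → T ∈ˡ probes I R
  probe-⊆ {I} {R} k k≤n {T} T∈ = there (∈-gather-tabulate (probe I) (λ k → prefix (toℕ k) R) (fromℕ< (s≤s k≤n))
    (subst (λ j → T ∈ˡ probe I (prefix j R)) (sym (toℕ-fromℕ< (s≤s k≤n))) T∈))

  -- The elements of the samples themselves are kept, so all the elements
  -- they span can be deleted at once.
  redundant : (Subset n → Bool) → Subset n → Subset n → ∀ {J} → Vec (Subset n) J → Subset n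
  redundant φ I G v = tabulate (λ f → all (λ S → not (lookup S f)) v ∧ any (λ S → closed φ I G S f) v)

union : ∀ {n m} → Vec (Subset n) m → Subset n
union = V.foldr′ _∪_ ⊥

-- States, queries and transitions

module Algorithm (n κ J m₁ m₂ : ℕ) (θ : ℕ → ℕ) (imax R σ₀ : ℕ) where

  open State

  Batches : Set
  Batches = Vec (Vec (Vec (Vec Bool κ) n) J) (m₁ + m₂)

  sampler : Sampler Batches
  sampler = vecSampler (vecSampler (vecSampler (bitsSampler κ) n) J) (m₁ + m₂)

  -- The samples use the rate of the next phase, while `likely` starts from independence at the
  -- current one: the trials of a phase prepare the step to the next rate.
  samples : State n → Batches → Vec (Vec (Subset n) J) (m₁ + m₂)
  samples s = V.map (V.map (V.map (below κ (θ (suc (phase s))))))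

  queries : Batches → State n → List (Subset n)
  queries w s = L.map (λ f → I s ∪ ⁅ f ⁆) (L.allFin n) ++
                gather (gather (λ S → probes (I s) (S ∩ G s))) (samples s w)

  useful : (Subset n → Bool) → State n → Subset n → Bool
  useful φ s S = φ (I s ∪ (S ∩ G s)) ∧ (2 ^ stage s ≤ᵇ ∣ S ∩ G s ∣)

  plenty : State n → Subset n → Bool
  plenty s Y = 2 ^ (stage s + σ₀) ≤ᵇ ∣ Y ∣ * R

  contract : State n → Subset n → State n
  contract s T = state (stage s) 0 0 (I s ∪ T) (E s ─ T) (E s ─ T)

  delete : State n → Subset n → State n
  delete s Y = record s { E = E s ─ Y ; G = G s ─ Y }

  -- Trials 0 to 31 make 32 sets per phase, enough since (31/32)^32 < 1/2.
  setAside : State n → Subset n → State n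
  setAside s H with trial s ≟ 31
  ... | yes _ = record s { phase = suc (phase s) ; trial = 0 ; G = G s ─ H }
  ... | no  _ = record s { trial = suc (trial s) ; G = G s ─ H }

  lower : State n → State n
  lower s = state (pred (stage s)) 0 0 (I s) (E s) (E s)

  -- At stage 0 at most 2^σ₀ elements remain, few enough for the greedy algorithm with one element
  -- per round.
  decide : (Subset n → Bool) → State n → State n
  decide φ s with nonempty? (E s)
  ... | no  _       = s
  ... | yes (f , _) = record s { I = if φ (I s ∪ ⁅ f ⁆) then I s ∪ ⁅ f ⁆ else I s ; E = E s - f }

  chosen : (Subset n → Bool) → State n → ∀ {m} → Vec (Vec (Subset n) J) m → Subset n
  chosen φ s D = first (useful φ s) ⊥ (V.concat D) ∩ G s

  -- A deletion worth 1/R of the volume succeeds in a round only with probability about 1/R, so it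
  -- is sought among all batches. H takes just the first m₁ batches: they catch every frequently
  -- redundant element and keep H small.
  prune : State n → Vec (Subset n) (m₁ + m₂) → State n
  prune s Ys with any (plenty s) Ys
  ... | true  = delete s (first (plenty s) ⊥ Ys)
  ... | false = setAside s (union (V.take m₁ Ys))

  step : (Subset n → Bool) → Batches → State n → State n
  step φ w s with stage s
  ... | zero  = decide φ s
  ... | suc σ with ∣ E s ∣ ≤? 2 ^ (σ + σ₀)
  ...   | yes _ = lower s
  ...   | no  _ with phase s ≟ imax
  ...     | yes _ = contract s (chosen φ s (samples s w))
  ...     | no  _ = prune s (V.map (redundant φ (I s) (G s)) (samples s w))

  module _ (φ ψ : Subset n → Bool) (s : State n) where

    private
      Agree : Subset n → Set
      Agree S = ∀ T → T ∈ˡ probes (I s) (S ∩ G s) → φ T ≡ ψ T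

      useful-local : ∀ {S} → Agree S → useful φ s S ≡ useful ψ s S
      useful-local {S} h = cong (_∧ (2 ^ stage s ≤ᵇ ∣ S ∩ G s ∣)) (h _ (here refl))

      closed-local : ∀ {S} → Agree S → ∀ f → closed φ (I s) (G s) S f ≡ closed ψ (I s) (G s) S f
      closed-local {S} h f = cong (λ b → lookup (G s) f ∧ (not (lookup S f) ∧ b)) (upTo-cong n (λ k k≤n →
        cong₂ (λ x y → x ∧ not y) (h _ (probe-⊆ k k≤n (here refl)))
          (h _ (probe-⊆ {I = I s} {R = S ∩ G s} k k≤n (there (∈-map⁺ (λ f → I s ∪ (prefix k (S ∩ G s) ∪ ⁅ f ⁆)) (∈-allFin f)))))))

      redundant-local : ∀ {m} {v : Vec (Subset n) m} → All Agree v → redundant φ (I s) (G s) v ≡ redundant ψ (I s) (G s) v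
      redundant-local {v = v} h = tabulate-cong (λ f →
        cong (all (λ S → not (lookup S f)) v ∧_) (any-cong (All.map (λ {S} a → closed-local {S} a f) h)))

    step-local : ∀ w → (∀ T → T ∈ˡ queries w s → φ T ≡ ψ T) → step φ w s ≡ step ψ w s
    step-local w agree with stage s
    ... | zero  with nonempty? (E s)
    ...   | no  _       = refl
    ...   | yes (f , _) = cong (λ b → record s { I = if b then I s ∪ ⁅ f ⁆ else I s ; E = E s - f })
                            (agree (I s ∪ ⁅ f ⁆) (∈-++⁺ˡ (∈-map⁺ (λ f → I s ∪ ⁅ f ⁆) (∈-allFin f))))
    step-local w agree | suc σ with ∣ E s ∣ ≤? 2 ^ (σ + σ₀)
    ...   | yes _ = refl
    ...   | no  _ with phase s ≟ imax
    ...     | yes _ = cong (λ S → contract s (S ∩ G s)) (first-cong ⊥ (All.map (λ {S} → useful-local {S}) (concat⁺ agrees)))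
      where
      agrees : All (All Agree) (samples s w)
      agrees = All.map (λ {v} → gather-All (λ S → probes (I s) (S ∩ G s)) v) (gather-All _ (samples s w) (λ T T∈ → agree T (∈-++⁺ʳ (L.map (λ f → I s ∪ ⁅ f ⁆) (L.allFin n)) T∈)))
    ...     | no  _ = cong (prune s) redundants
      where
      D = samples s w
      agrees : All (All Agree) D
      agrees = All.map (λ {v} → gather-All (λ S → probes (I s) (S ∩ G s)) v) (gather-All _ D (λ T T∈ → agree T (∈-++⁺ʳ (L.map (λ f → I s ∪ ⁅ f ⁆) (L.allFin n)) T∈)))
      redundants : V.map (redundant φ (I s) (G s)) D ≡ V.map (redundant ψ (I s) (G s)) D
      redundants = map-cong-All (All.map redundant-local agrees)

  length-queries : ∀ w s → length (queries w s) ≤ n + (m₁ + m₂) * (J * suc (suc n * suc n))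
  length-queries w s = ≤-trans (≤-reflexive (length-++ (L.map (λ f → I s ∪ ⁅ f ⁆) (L.allFin n)))) (+-mono-≤
    (≤-reflexive (trans (length-map (λ f → I s ∪ ⁅ f ⁆) (L.allFin n)) (length-tabulate id)))
    (length-gather (gather (λ S → probes (I s) (S ∩ G s))) (samples s w) _ (λ v →
      length-gather (λ S → probes (I s) (S ∩ G s)) v _ (λ S → length-probes (I s) (S ∩ G s)))))

-- Probability estimates

-- The origin of 1/32: Cauchy-Schwarz squares the probability 1/4, and the second moment of the
-- likelihood ratio costs a factor of at most 2.
persist : ∀ x y t p {q} .{{_ : NonZero t}} .{{_ : NonZero p}} →
  x * x * p ≤ y * t * q → q ≤ 2 * p → t ≤ 4 * x → t ≤ 32 * y
persist x y t p {q} moment ratio big = *-cancelʳ-≤ t (32 * y) (t * p) {{m*n≢0 t p}} (begin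
  t * (t * p)                ≡⟨ *-assoc t t p ⟨
  t * t * p                  ≤⟨ *-monoˡ-≤ p (*-mono-≤ big big) ⟩
  4 * x * (4 * x) * p        ≡⟨ l₁ x p ⟩
  16 * (x * x * p)           ≤⟨ *-monoʳ-≤ 16 (≤-trans moment (*-monoʳ-≤ (y * t) ratio)) ⟩
  16 * (y * t * (2 * p))     ≡⟨ l₂ y t p ⟩
  32 * y * (t * p)           ∎)
  where
  open ≤-Reasoning
  l₁ : ∀ x p → 4 * x * (4 * x) * p ≡ 16 * (x * x * p)
  l₁ = solve-∀
  l₂ : ∀ y t p → 16 * (y * t * (2 * p)) ≡ 32 * y * (t * p)
  l₂ = solve-∀

dispersion : ∀ h k e m → 2 * (h * e) ≤ m → 2 * (h * (k * e)) ≤ k * m + k * e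
dispersion h k e m le = begin
  2 * (h * (k * e))  ≡⟨ l h k e ⟩
  k * (2 * (h * e))  ≤⟨ *-monoʳ-≤ k le ⟩
  k * m              ≤⟨ m≤m+n (k * m) (k * e) ⟩
  k * m + k * e      ∎
  where
  open ≤-Reasoning
  l : ∀ h k e → 2 * (h * (k * e)) ≡ k * (2 * (h * e))
  l = solve-∀

module Estimates {n : ℕ} {ind : Subset n → Bool} (M : IsMatroid ind) (I : Subset n) (iI : ind I ≡ true) where
  open IsMatroid M
  open Matroid M

  indep dep : ℕ → ℕ → Subset n → ℕ
  indep a b A = ∑ (μ a b n) (λ S → ⟦ ind (I ∪ (S ∩ A)) ⟧)
  dep a b A   = ∑ (μ a b n) (λ S → ⟦ not (ind (I ∪ (S ∩ A))) ⟧)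

  indep+dep : ∀ a b A → indep a b A + dep a b A ≡ total (μ a b n)
  indep+dep a b A = trans (sym (∑-+ (μ a b n) _ _)) (∑-cong (μ a b n) (λ S → ⟦⟧-not (ind (I ∪ (S ∩ A)))))

  indep-antitone : ∀ a b {A B} → A ⊆ B → indep a b B ≤ indep a b A
  indep-antitone a b {A} {B} A⊆B = ∑-mono (μ a b n) mono
    where
    mono : ∀ S → ⟦ ind (I ∪ (S ∩ B)) ⟧ ≤ ⟦ ind (I ∪ (S ∩ A)) ⟧
    mono S with ind (I ∪ (S ∩ B)) in eq
    ... | false = z≤n
    ... | true rewrite hereditary (∪-monoʳ I (∩-monoʳ S A⊆B)) eq = ≤-refl

  -- Independence of the sample in G implies it in H and in G ─ H, and these two events concern
  -- disjoint coordinates.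
  indep-product : ∀ a b {G} H → H ⊆ G →
    indep a b G * total (μ a b n) ≤ indep a b H * indep a b (G ─ H)
  indep-product a b {G} H H⊆G = begin
    indep a b G * total m      ≤⟨ *-monoˡ-≤ (total m) (∑-mono m both) ⟩
    ∑ m (λ S → F (S ∩ H) * F ((S ─ H) ∩ G)) * total m
                               ≡⟨ μ-independent a b H F (λ T → F (T ∩ G)) ⟩
    indep a b H * ∑ m (λ S → F ((S ─ H) ∩ G))
                               ≤⟨ *-monoʳ-≤ (indep a b H) (∑-mono m rest) ⟩
    indep a b H * indep a b (G ─ H) ∎
    where
    open ≤-Reasoning
    m = μ a b n
    F : Subset n → ℕ
    F T = ⟦ ind (I ∪ T) ⟧
    F-mono : ∀ {A B} → A ⊆ B → F B ≤ F A
    F-mono {A} {B} A⊆B with ind (I ∪ B) in eq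
    ... | false = z≤n
    ... | true rewrite hereditary (∪-monoʳ I A⊆B) eq = ≤-refl
    both : ∀ S → F (S ∩ G) ≤ F (S ∩ H) * F ((S ─ H) ∩ G)
    both S with ind (I ∪ (S ∩ G)) in eq
    ... | false = z≤n
    ... | true rewrite hereditary (∪-monoʳ I (∩-monoʳ S H⊆G)) eq
                     | hereditary {T = I ∪ ((S ─ H) ∩ G)} (∪-monoʳ I (λ m → x∈p∩q⁺ (p─q⊆p S H (proj₁ (x∈p∩q⁻ (S ─ H) G m)) , proj₂ (x∈p∩q⁻ (S ─ H) G m)))) eq = ≤-refl
    rest : ∀ S → F ((S ─ H) ∩ G) ≤ F (S ∩ (G ─ H))
    rest S = F-mono λ {x} m → let x∈S , x∈G─H = x∈p∩q⁻ S (G ─ H) m in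
      x∈p∩q⁺ (x∈p∧x∉q⇒x∈p─q x∈S (∈─⇒∉ x∈G─H) , p─q⊆p G H x∈G─H)

  -- A batch of J samples makes f redundant with probability at least
  -- ¼ min (1 , J · Pr[closed]).
  redundant-prob : ∀ a b J G f .{{_ : NonZero (total (μ a b n))}} → 2 * (J * a) ≤ a + b →
    let m = μ a b n ; T = total m
        P = ∑ (Vecˢ m J) (λ v → ⟦ lookup (redundant ind I G v) f ⟧)
        B = ∑ m (λ S → ⟦ closed ind I G S f ⟧) in
    T ^ J * (J * B) ≤ 4 * P * T ⊎ T ^ J ≤ 4 * P
  redundant-prob a b J G f small = [ (λ h → inj₁ (light h)) , (λ h → inj₂ (heavy h)) ]′ (≤-total (J * B) T)
    where
    open ≤-Reasoning
    m = μ a b n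
    T = total m
    out cl : Subset n → Bool
    out S = not (lookup S f)
    cl S = closed ind I G S f
    P = ∑ (Vecˢ m J) (λ v → ⟦ lookup (redundant ind I G v) f ⟧)
    A = ∑ m (λ S → ⟦ lookup S f ⟧)
    B = ∑ m (λ S → ⟦ cl S ⟧)
    x = ∑ m (λ S → ⟦ out S ⟧)
    y = ∑ m (λ S → ⟦ out S ∧ not (cl S) ⟧)
    x+A : x + A ≡ T
    x+A = trans (sym (∑-+ m _ _)) (∑-cong m (λ S → trans (+-comm ⟦ out S ⟧ _) (⟦⟧-not (lookup S f))))
    y+B : y + B ≡ x
    y+B = trans (sym (∑-+ m _ _)) (∑-cong m (λ S → e (lookup G f) (lookup S f) _))
      where
      e : ∀ g s c → ⟦ not s ∧ not (g ∧ (not s ∧ c)) ⟧ + ⟦ g ∧ (not s ∧ c) ⟧ ≡ ⟦ not s ⟧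
      e true  true  c     = refl
      e false true  c     = refl
      e true  false true  = refl
      e true  false false = refl
      e false false c     = refl
    -- All J samples miss f in x^J ways; in y^J of these none of them spans f.
    P+y^J : P + y ^ J ≡ x ^ J
    P+y^J = trans (cong₂ _+_ refl (sym (Vecˢ-all m J (λ S → out S ∧ not (cl S)))))
      (trans (sym (∑-+ (Vecˢ m J) _ _)) (trans (∑-cong (Vecˢ m J) split) (Vecˢ-all m J out)))
      where
      split₂ : ∀ {k} (v : Vec (Subset n) k) → ⟦ all out v ∧ any cl v ⟧ + ⟦ all (λ S → out S ∧ not (cl S)) v ⟧ ≡ ⟦ all out v ⟧
      split₂ []      = refl
      split₂ (S ∷ v) with out S | cl S
      ... | false | _     = refl
      ... | true  | true  = trans (+-identityʳ _) (∧-true (all out v))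
        where
        ∧-true : ∀ z → ⟦ z ∧ true ⟧ ≡ ⟦ z ⟧
        ∧-true true  = refl
        ∧-true false = refl
      ... | true  | false = split₂ v
      split : ∀ v → ⟦ lookup (redundant ind I G v) f ⟧ + ⟦ all (λ S → out S ∧ not (cl S)) v ⟧ ≡ ⟦ all out v ⟧
      split v = trans (cong (λ z → ⟦ z ⟧ + ⟦ all (λ S → out S ∧ not (cl S)) v ⟧) (lookup∘tabulate _ f)) (split₂ v)
    2JA≤T : 2 * (J * A) ≤ x + A
    2JA≤T = ≤-trans (*-cancelˡ-≤ (a + b) {{nz}} (begin
      (a + b) * (2 * (J * A))  ≡⟨ l₁ (a + b) J A ⟩
      2 * J * ((a + b) * A)    ≡⟨ cong (2 * J *_) (μ-∈ a b f) ⟩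
      2 * J * (a * T)          ≡⟨ l₂ J a T ⟩
      2 * (J * a) * T          ≤⟨ *-monoˡ-≤ T small ⟩
      (a + b) * T              ∎)) (≤-reflexive (sym x+A))
      where
      l₁ : ∀ k j a → k * (2 * (j * a)) ≡ 2 * j * (k * a)
      l₁ = solve-∀
      l₂ : ∀ j a t → 2 * j * (a * t) ≡ 2 * (j * a) * t
      l₂ = solve-∀
      nz : NonZero (a + b)
      nz = ≢-nonZero λ e → ≢-nonZero⁻¹ T (trans (μ-total a b n) (trans (cong (_^ n) e) (0^ f)))
        where
        0^ : ∀ {k} → Fin k → 0 ^ k ≡ 0
        0^ zero    = refl
        0^ (suc i) = refl
    -- The rate is at most 1/(2J), so all J samples miss f with probability at least 1/2.
    TJ≤2x^J : T ^ J ≤ 2 * x ^ J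
    TJ≤2x^J = subst (λ t → t ^ J ≤ 2 * x ^ J) x+A (^-double x A J 2JA≤T)
    -- Given that all samples miss f, Bernoulli bounds (y/x)^J by x/(x + JB), so f is redundant with
    -- conditional probability at least JB/(x + JB).
    key : x ^ J * (J * B) ≤ P * (x + J * B)
    key = +-cancelˡ-≤ (x ^ J * x) _ _ (begin
      x ^ J * x + x ^ J * (J * B)            ≡⟨ *-distribˡ-+ (x ^ J) x (J * B) ⟨
      x ^ J * (x + J * B)                    ≡⟨ cong (_* (x + J * B)) P+y^J ⟨
      (P + y ^ J) * (x + J * B)              ≡⟨ *-distribʳ-+ (x + J * B) P (y ^ J) ⟩
      P * (x + J * B) + y ^ J * (x + J * B)  ≤⟨ +-monoʳ-≤ (P * (x + J * B)) bern ⟩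
      P * (x + J * B) + x ^ J * x            ≡⟨ +-comm _ (x ^ J * x) ⟩
      x ^ J * x + P * (x + J * B)            ∎)
      where
      bern : y ^ J * (x + J * B) ≤ x ^ J * x
      bern = subst (λ z → y ^ J * (z + J * B) ≤ z ^ J * z) y+B (≤-trans (bernoulli y B J) (≤-reflexive (*-comm (y + B) _)))
    x≤T : x ≤ T
    x≤T = ≤-trans (m≤m+n x A) (≤-reflexive x+A)
    light : J * B ≤ T → T ^ J * (J * B) ≤ 4 * P * T
    light h = begin
      T ^ J * (J * B)          ≤⟨ *-monoˡ-≤ (J * B) TJ≤2x^J ⟩
      2 * x ^ J * (J * B)      ≡⟨ *-assoc 2 (x ^ J) (J * B) ⟩
      2 * (x ^ J * (J * B))    ≤⟨ *-monoʳ-≤ 2 key ⟩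
      2 * (P * (x + J * B))    ≤⟨ *-monoʳ-≤ 2 (*-monoʳ-≤ P (+-mono-≤ x≤T h)) ⟩
      2 * (P * (T + T))        ≡⟨ l P T ⟩
      4 * P * T                ∎
      where
      l : ∀ p t → 2 * (p * (t + t)) ≡ 4 * p * t
      l = solve-∀
    heavy : T ≤ J * B → T ^ J ≤ 4 * P
    heavy h = begin
      T ^ J            ≤⟨ TJ≤2x^J ⟩
      2 * x ^ J        ≤⟨ *-monoʳ-≤ 2 (*-cancelʳ-≤ (x ^ J) (2 * P) (J * B) {{>-nonZero (<-≤-trans (>-nonZero⁻¹ T) h)}} (begin
        x ^ J * (J * B)      ≤⟨ key ⟩
        P * (x + J * B)      ≤⟨ *-monoʳ-≤ P (+-monoˡ-≤ (J * B) (≤-trans x≤T h)) ⟩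
        P * (J * B + J * B)  ≡⟨ l P (J * B) ⟩
        2 * P * (J * B)      ∎)) ⟩
      2 * (2 * P)      ≡⟨ *-assoc 2 2 P ⟨
      4 * P            ∎
      where
      l : ∀ p t → p * (t + t) ≡ 2 * p * t
      l = solve-∀

  module _ (a b J R v : ℕ) (G H : Subset n) .{{_ : NonZero a}} .{{_ : NonZero b}} .{{_ : NonZero J}} .{{_ : NonZero R}}
    (small : 2 * (J * a) ≤ a + b) (32v≤J²R : 32 * v ≤ J * J * R) where
    private
      m = μ a b n
      T = total m
      TJ = T ^ J
      P = λ f → ∑ (Vecˢ m J) (λ v → ⟦ lookup (redundant ind I G v) f ⟧)
      B = λ f → ∑ m (λ S → ⟦ closed ind I G S f ⟧)
      h = λ f → ⟦ not (lookup H f) ⟧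
      instance
        T≢0 : NonZero T
        T≢0 = subst NonZero (sym (μ-total a b n)) (m^n≢0 (a + b) n {{>-nonZero (<-≤-trans (>-nonZero⁻¹ a) (m≤m+n a b))}})
        TJ≢0 : NonZero TJ
        TJ≢0 = m^n≢0 T J
      ΣB = ∑ (Finˢ n) (λ f → h f * B f)

    -- Outside H only the first alternative of `redundant-prob` remains, so there the closure
    -- probability of f is at most 4/J times its redundancy probability. Summing these bounds the
    -- expected number of closed elements outside H.
    closure-small : (∀ f → TJ ≤ 4 * P f → f ∈ H) → ∑ (Finˢ n) P * R ≤ 2 * v * TJ →
      J * R * ΣB ≤ 8 * v * T
    closure-small heavy⊆H few = *-cancelʳ-≤ _ _ TJ (begin
      J * R * ΣB * TJ                   ≡⟨ l₁ J R ΣB TJ ⟩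
      R * (J * TJ * ΣB)                 ≡⟨ cong (R *_) (∑-*ˡ (Finˢ n) (J * TJ) _) ⟨
      R * ∑ (Finˢ n) (λ f → J * TJ * (h f * B f)) ≤⟨ *-monoʳ-≤ R (∑-mono (Finˢ n) each) ⟩
      R * ∑ (Finˢ n) (λ f → 4 * T * P f) ≡⟨ cong (R *_) (∑-*ˡ (Finˢ n) (4 * T) P) ⟩
      R * (4 * T * ∑ (Finˢ n) P)        ≡⟨ l₂ R T (∑ (Finˢ n) P) ⟩
      4 * T * (∑ (Finˢ n) P * R)        ≤⟨ *-monoʳ-≤ (4 * T) few ⟩
      4 * T * (2 * v * TJ)              ≡⟨ l₃ T v TJ ⟩
      8 * v * T * TJ                    ∎)
      where
      open ≤-Reasoning
      l₁ : ∀ j r s t → j * r * s * t ≡ r * (j * t * s)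
      l₁ = solve-∀
      l₂ : ∀ r t p → r * (4 * t * p) ≡ 4 * t * (p * r)
      l₂ = solve-∀
      l₃ : ∀ t v u → 4 * t * (2 * v * u) ≡ 8 * v * t * u
      l₃ = solve-∀
      l₄ : ∀ j t c b → j * t * (c * b) ≡ c * (t * (j * b))
      l₄ = solve-∀
      l₅ : ∀ p t → 4 * p * t ≡ 4 * t * p
      l₅ = solve-∀
      outside-only : ∀ c {x y} → (c ≡ false → x ≤ y) → ⟦ not c ⟧ * x ≤ y
      outside-only true  _ = z≤n
      outside-only false h = ≤-trans (≤-reflexive (+-identityʳ _)) (h refl)
      each : ∀ f → J * TJ * (h f * B f) ≤ 4 * T * P f
      each f = ≤-trans (≤-reflexive (l₄ J TJ (h f) (B f))) (outside-only (lookup H f) (λ out →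
        [ (λ light → ≤-trans light (≤-reflexive (l₅ (P f) T)))
        , (λ heavy → contradiction (heavy⊆H f heavy) (lookup⇒∉ {S = H} out)) ]′
        (redundant-prob a b J G f small)))

    -- The error term of `dependent-bound` carries the odds a/b ≤ 1/J, so it is at most 8v/(J²R) ≤
    -- 1/4.
    dep-close : H ⊆ G → J * R * ΣB ≤ 8 * v * T → 4 * dep a b G ≤ 4 * dep a b H + T
    dep-close H⊆G few = *-cancelˡ-≤ b (begin
      b * (4 * dep a b G)              ≡⟨ l₁ b (dep a b G) ⟩
      4 * (b * dep a b G)              ≤⟨ *-monoʳ-≤ 4 (dependent-bound M iI H⊆G a b) ⟩
      4 * (b * dep a b H + a * ΣB)     ≡⟨ l₂ b (dep a b H) a ΣB ⟩
      b * (4 * dep a b H) + 4 * (a * ΣB) ≤⟨ +-monoʳ-≤ (b * (4 * dep a b H)) tail ⟩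
      b * (4 * dep a b H) + b * T      ≡⟨ *-distribˡ-+ b (4 * dep a b H) T ⟨
      b * (4 * dep a b H + T)          ∎)
      where
      open ≤-Reasoning
      l₁ : ∀ b d → b * (4 * d) ≡ 4 * (b * d)
      l₁ = solve-∀
      l₂ : ∀ b d a s → 4 * (b * d + a * s) ≡ b * (4 * d) + 4 * (a * s)
      l₂ = solve-∀
      Ja≤b : J * a ≤ b
      Ja≤b = +-cancelˡ-≤ a _ _ (≤-trans (+-monoˡ-≤ (J * a) (m≤n*m a J)) (≤-trans (≤-reflexive (cong (J * a +_) (sym (+-identityʳ _)))) small))
      tail : 4 * (a * ΣB) ≤ b * T
      tail = *-cancelˡ-≤ (J * (J * R)) {{m*n≢0 J (J * R) {{it}} {{m*n≢0 J R}}}} (begin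
        J * (J * R) * (4 * (a * ΣB))   ≡⟨ e₁ J R a ΣB ⟩
        J * a * 4 * (J * R * ΣB)       ≤⟨ *-mono-≤ (*-monoˡ-≤ 4 Ja≤b) few ⟩
        b * 4 * (8 * v * T)            ≡⟨ e₂ b v T ⟩
        32 * v * (b * T)               ≤⟨ *-monoˡ-≤ (b * T) 32v≤J²R ⟩
        J * J * R * (b * T)            ≡⟨ cong (_* (b * T)) (*-assoc J J R) ⟩
        J * (J * R) * (b * T)          ∎)
        where
        e₁ : ∀ j r a s → j * (j * r) * (4 * (a * s)) ≡ j * a * 4 * (j * r * s)
        e₁ = solve-∀
        e₂ : ∀ b v t → b * 4 * (8 * v * t) ≡ 32 * v * (b * t)
        e₂ = solve-∀

  -- At the slightly smaller rate a′ the set H still absorbs a circuit with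
  -- probability at least 1/32: the change of the rate is no larger than the
  -- standard deviation of ∣ S ∩ H ∣.
  dep-persists : ∀ a′ d b H .{{_ : NonZero a′}} .{{_ : NonZero (d + b)}} →
    2 * (∣ H ∣ * (d * d)) ≤ a′ * (d + b) → (a′ + d + b) ^ n ≤ 4 * dep (a′ + d) b H →
    (a′ + d + b) ^ n ≤ 32 * dep a′ (d + b) H
  dep-persists a′ d b H fluct big =
    persist (dep (a′ + d) b H) (dep a′ (d + b) H) (K ^ n) (A ^ ∣ H ∣) {{Kⁿ≢0}} {{Aʰ≢0}} moment (ratio ∣ H ∣ fluct) big
    where
    K = a′ + d + b
    A = K * (a′ * (d + b))
    moment : dep (a′ + d) b H * dep (a′ + d) b H * A ^ ∣ H ∣ ≤ dep a′ (d + b) H * K ^ n * (A + K * (d * d)) ^ ∣ H ∣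
    moment = μ-rate a′ d b H (λ S → not (ind (I ∪ S)))
    ratio : ∀ h → 2 * (h * (d * d)) ≤ a′ * (d + b) → (A + K * (d * d)) ^ h ≤ 2 * A ^ h
    ratio h le = ^-double A (K * (d * d)) h (dispersion h K (d * d) (a′ * (d + b)) le)
    K≢0 : NonZero K
    K≢0 = >-nonZero (<-≤-trans (>-nonZero⁻¹ a′) (≤-trans (m≤m+n a′ d) (m≤m+n (a′ + d) b)))
    A≢0 : NonZero A
    A≢0 = m*n≢0 K (a′ * (d + b)) {{K≢0}} {{m*n≢0 a′ (d + b)}}
    Kⁿ≢0 : NonZero (K ^ n)
    Kⁿ≢0 = m^n≢0 K n {{K≢0}}
    Aʰ≢0 : NonZero (A ^ ∣ H ∣)
    Aʰ≢0 = m^n≢0 A ∣ H ∣ {{A≢0}}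

-- Repeated trials

⟦≤ᵇ⟧ : ∀ x → ⟦ 1 ≤ᵇ x ⟧ ≤ x
⟦≤ᵇ⟧ zero    = z≤n
⟦≤ᵇ⟧ (suc x) = s≤s z≤n

⟦∨⟧ : ∀ x y → ⟦ x ∨ y ⟧ ≤ ⟦ x ⟧ + ⟦ y ⟧
⟦∨⟧ true  y = s≤s z≤n
⟦∨⟧ false y = ≤-refl

take-++ : ∀ {A : Set} {m l} (u : Vec A m) (v : Vec A l) → V.take m (u V.++ v) ≡ u
take-++ []      v = refl
take-++ (x ∷ u) v = cong (x ∷_) (take-++ u v)

module _ {A : Set} (S : Summation A) (p : A → Bool) (R k : ℕ) .{{_ : NonZero R}}
  (often : total S ≤ ∑ S (λ x → ⟦ p x ⟧) * R) where
  private
    T = total S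
    z = ∑ S (λ x → ⟦ p x ⟧)
    x = ∑ S (λ x → ⟦ not (p x) ⟧)
    z+x : z + x ≡ T
    z+x = trans (sym (∑-+ S _ _)) (∑-cong S (λ a → ⟦⟧-not (p a)))
    x≤T : x ≤ T
    x≤T = ≤-trans (m≤n+m x z) (≤-reflexive z+x)
    seldom : x * R ≤ pred R * T
    seldom = +-cancelˡ-≤ T _ _ (begin
      T + x * R          ≤⟨ +-monoˡ-≤ (x * R) often ⟩
      z * R + x * R      ≡⟨ *-distribʳ-+ R z x ⟨
      (z + x) * R        ≡⟨ cong (_* R) z+x ⟩
      T * R              ≡⟨ *-comm T R ⟩
      R * T              ≡⟨ cong (_* T) (suc-pred R) ⟨
      T + pred R * T     ∎)
      where open ≤-Reasoning
    amp : x ^ (R * k) * 2 ^ k ≤ T ^ (R * k)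
    amp = amplify R k seldom

  all-fail-head : ∀ {m l} → m ≡ R * k →
    ∑ (Vecˢ S (m + l)) (λ v → ⟦ all (λ a → not (p a)) (V.take m v) ⟧) * 2 ^ k ≤ total (Vecˢ S (m + l))
  all-fail-head {m} {l} refl = begin
    ∑ (Vecˢ S (m + l)) (λ v → ⟦ all (λ a → not (p a)) (V.take m v) ⟧) * 2 ^ k
      ≡⟨ cong (_* 2 ^ k) (Vecˢ-++ S m _) ⟩
    ∑ (Vecˢ S m) (λ u → ∑ (Vecˢ S l) (λ v → ⟦ all (λ a → not (p a)) (V.take m (u V.++ v)) ⟧)) * 2 ^ k
      ≡⟨ cong (_* 2 ^ k) (∑-cong (Vecˢ S m) (λ u → trans (∑-cong (Vecˢ S l) (λ v → cong (λ t → ⟦ all (λ a → not (p a)) t ⟧) (take-++ u v))) (∑-const (Vecˢ S l) _))) ⟩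
    ∑ (Vecˢ S m) (λ u → ⟦ all (λ a → not (p a)) u ⟧ * total (Vecˢ S l)) * 2 ^ k
      ≡⟨ cong (_* 2 ^ k) (∑-*ʳ (Vecˢ S m) _ _) ⟩
    ∑ (Vecˢ S m) (λ u → ⟦ all (λ a → not (p a)) u ⟧) * total (Vecˢ S l) * 2 ^ k
      ≡⟨ cong (λ y → y * total (Vecˢ S l) * 2 ^ k) (Vecˢ-all S m _) ⟩
    x ^ m * total (Vecˢ S l) * 2 ^ k   ≡⟨ lemma (x ^ m) _ (2 ^ k) ⟩
    x ^ m * 2 ^ k * total (Vecˢ S l)   ≤⟨ *-monoˡ-≤ (total (Vecˢ S l)) amp ⟩
    T ^ m * total (Vecˢ S l)           ≡⟨ cong (T ^ m *_) (Vecˢ-total S l) ⟩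
    T ^ m * T ^ l                      ≡⟨ ^-distribˡ-+-* T m l ⟨
    T ^ (m + l)                        ≡⟨ Vecˢ-total S (m + l) ⟨
    total (Vecˢ S (m + l))             ∎
    where
    open ≤-Reasoning
    lemma : ∀ x y z → x * y * z ≡ x * z * y
    lemma = solve-∀

  all-fail : ∀ {m l} → m ≡ R * k → ∑ (Vecˢ S (m + l)) (λ v → ⟦ all (λ a → not (p a)) v ⟧) * 2 ^ k ≤ total (Vecˢ S (m + l))
  all-fail {m} {l} e = ≤-trans (*-monoˡ-≤ (2 ^ k) (∑-mono (Vecˢ S (m + l)) (λ v → weaken m v))) (all-fail-head e)
    where
    weaken : ∀ m {l} (v : Vec A (m + l)) → ⟦ all (λ a → not (p a)) v ⟧ ≤ ⟦ all (λ a → not (p a)) (V.take m v) ⟧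
    weaken zero    v       = ⟦⟧≤1 (all (λ a → not (p a)) v)
    weaken (suc m) (a ∷ v) with not (p a)
    ... | true  = weaken m v
    ... | false = z≤n

-- The event concerns the whole vector, so it is enough to exchange the two summands of its length.
all-fail-tail : ∀ {A : Set} (S : Summation A) (p : A → Bool) R k .{{_ : NonZero R}} →
  total S ≤ ∑ S (λ x → ⟦ p x ⟧) * R → ∀ {m l} → l ≡ R * k →
  ∑ (Vecˢ S (m + l)) (λ v → ⟦ all (λ a → not (p a)) v ⟧) * 2 ^ k ≤ total (Vecˢ S (m + l))
all-fail-tail S p R k often {m} {l} e = subst
  (λ j → ∑ (Vecˢ S j) (λ v → ⟦ all (λ a → not (p a)) v ⟧) * 2 ^ k ≤ total (Vecˢ S j)) (+-comm l m) (all-fail S p R k often e)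

-- Cardinalities

∣─∣ : ∀ {n} {p q : Subset n} → q ⊆ p → ∣ p ─ q ∣ + ∣ q ∣ ≡ ∣ p ∣
∣─∣ {p = []}        {[]}        h = refl
∣─∣ {p = true  ∷ p} {true  ∷ q} h = trans (+-suc _ _) (cong suc (∣─∣ (drop-∷-⊆ h)))
∣─∣ {p = true  ∷ p} {false ∷ q} h = cong suc (∣─∣ (drop-∷-⊆ h))
∣─∣ {p = false ∷ p} {false ∷ q} h = ∣─∣ (drop-∷-⊆ h)
∣─∣ {p = false ∷ p} {true  ∷ q} h = contradiction (h V.here) λ ()

∣∪∣ : ∀ {n} (p q : Subset n) → ∣ p ∪ q ∣ ≤ ∣ p ∣ + ∣ q ∣
∣∪∣ []          []          = z≤n
∣∪∣ (true  ∷ p) (true  ∷ q) = s≤s (≤-trans (∣∪∣ p q) (+-monoʳ-≤ ∣ p ∣ (n≤1+n _)))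
∣∪∣ (true  ∷ p) (false ∷ q) = s≤s (∣∪∣ p q)
∣∪∣ (false ∷ p) (true  ∷ q) = ≤-trans (s≤s (∣∪∣ p q)) (≤-reflexive (sym (+-suc _ _)))
∣∪∣ (false ∷ p) (false ∷ q) = ∣∪∣ p q

∣∣-sum : ∀ {n} (p : Subset n) → ∣ p ∣ ≡ ∑ (Finˢ n) (λ f → ⟦ lookup p f ⟧)
∣∣-sum []          = refl
∣∣-sum (true  ∷ p) = cong suc (∣∣-sum p)
∣∣-sum (false ∷ p) = ∣∣-sum p

─-mono : ∀ {n} {p q} (r : Subset n) → p ⊆ q → p ─ r ⊆ q ─ r
─-mono {p = p} r p⊆q x∈ = x∈p∧x∉q⇒x∈p─q (p⊆q (p─q⊆p p r x∈)) (∈─⇒∉ x∈)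

-- The empty sample alone has weight b^n.
μ-⊥ : ∀ a b {n} (F : Subset n → ℕ) → b ^ n * F ⊥ ≤ ∑ (μ a b n) F
μ-⊥ a b {zero}  F = ≤-reflexive (+-identityʳ _)
μ-⊥ a b {suc n} F = begin
  b * b ^ n * F ⊥                    ≡⟨ *-assoc b (b ^ n) (F ⊥) ⟩
  b * (b ^ n * F ⊥)                  ≤⟨ *-monoʳ-≤ b (μ-⊥ a b (F ∘ (false ∷_))) ⟩
  b * ∑ (μ a b n) (F ∘ (false ∷_))   ≤⟨ m≤n+m _ _ ⟩
  ∑ (μ a b (suc n)) F                ∎
  where open ≤-Reasoning

-- The first sample alone already succeeds often enough.
any-often : ∀ {A : Set} (S : Summation A) (p : A → Bool) R → total S ≤ ∑ S (λ x → ⟦ p x ⟧) * R →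
  ∀ j → 1 ≤ j → total (Vecˢ S j) ≤ ∑ (Vecˢ S j) (λ v → ⟦ any p v ⟧) * R
any-often S p R often (suc j) _ = begin
  ∑ S (λ _ → t)                   ≡⟨ ∑-const S t ⟩
  t * total S                     ≤⟨ *-monoʳ-≤ t often ⟩
  t * (∑ S (λ x → ⟦ p x ⟧) * R)   ≡⟨ lemma t (∑ S (λ x → ⟦ p x ⟧)) R ⟩
  ∑ S (λ x → ⟦ p x ⟧) * t * R     ≡⟨ cong (_* R) (∑-*ʳ S _ t) ⟨
  ∑ S (λ x → ⟦ p x ⟧ * t) * R     ≤⟨ *-monoˡ-≤ R (∑-mono S (λ x → ≤-trans (≤-reflexive (sym (∑-const (Vecˢ S j) ⟦ p x ⟧))) (∑-mono (Vecˢ S j) (λ v → ∨-≥ (p x) (any p v))))) ⟩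
  ∑ S (λ x → ∑ (Vecˢ S j) (λ v → ⟦ p x ∨ any p v ⟧)) * R ∎
  where
  open ≤-Reasoning
  t = total (Vecˢ S j)
  lemma : ∀ t z r → t * (z * r) ≡ z * t * r
  lemma = solve-∀
  ∨-≥ : ∀ x y → ⟦ x ⟧ ≤ ⟦ x ∨ y ⟧
  ∨-≥ true  y = ≤-refl
  ∨-≥ false y = z≤n

-- A sample from a set of N elements, each kept with probability 2/M, has at
-- most c elements with probability at most 1/4 once N ≥ M C and C ≥ c + 2.
tail-small : ∀ F N M C c z t s .{{_ : NonZero M}} .{{_ : NonZero t}} → z * M ≤ pred M * t → z ≤ t →
  M * C ≤ N → 2 + c ≤ C → F * t ^ N ≤ 2 ^ c * s * z ^ N → 4 * F ≤ s
tail-small F N M C c z t s zM≤ z≤t MC≤N c+2≤C moment =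
  *-cancelʳ-≤ (4 * F) s (2 ^ c * t ^ N) {{m*n≢0 (2 ^ c) (t ^ N) {{m^n≢0 2 c}} {{m^n≢0 t N}}}} (begin
  4 * F * (2 ^ c * t ^ N)         ≡⟨ l₁ F (2 ^ c) (t ^ N) ⟩
  2 ^ (2 + c) * (F * t ^ N)       ≤⟨ *-mono-≤ (^-monoʳ-≤ 2 c+2≤C) moment ⟩
  2 ^ C * (2 ^ c * s * z ^ N)     ≡⟨ l₂ (2 ^ C) (2 ^ c) s (z ^ N) ⟩
  s * 2 ^ c * (z ^ N * 2 ^ C)     ≤⟨ *-monoʳ-≤ (s * 2 ^ c) shrink ⟩
  s * 2 ^ c * t ^ N               ≡⟨ *-assoc s (2 ^ c) (t ^ N) ⟩
  s * (2 ^ c * t ^ N)             ∎)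
  where
  open ≤-Reasoning
  l₁ : ∀ f x y → 4 * f * (x * y) ≡ 2 * (2 * x) * (f * y)
  l₁ = solve-∀
  l₂ : ∀ p x s y → p * (x * s * y) ≡ s * x * (y * p)
  l₂ = solve-∀
  l₃ : ∀ x y p → x * y * p ≡ x * p * y
  l₃ = solve-∀
  rest = N ∸ M * C
  N≡ : M * C + rest ≡ N
  N≡ = m+[n∸m]≡n MC≤N
  shrink : z ^ N * 2 ^ C ≤ t ^ N
  shrink = begin
    z ^ N * 2 ^ C                        ≡⟨ cong (λ m → z ^ m * 2 ^ C) N≡ ⟨
    z ^ (M * C + rest) * 2 ^ C           ≡⟨ cong (_* 2 ^ C) (^-distribˡ-+-* z (M * C) rest) ⟩
    z ^ (M * C) * z ^ rest * 2 ^ C       ≡⟨ l₃ (z ^ (M * C)) (z ^ rest) (2 ^ C) ⟩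
    z ^ (M * C) * 2 ^ C * z ^ rest       ≤⟨ *-mono-≤ (amplify M C zM≤) (^-monoˡ-≤ rest z≤t) ⟩
    t ^ (M * C) * t ^ rest               ≡⟨ ^-distribˡ-+-* t (M * C) rest ⟨
    t ^ (M * C + rest)                   ≡⟨ cong (t ^_) N≡ ⟩
    t ^ N                                ∎

Finˢ-total : ∀ n → total (Finˢ n) ≡ n
Finˢ-total zero    = refl
Finˢ-total (suc n) = cong suc (Finˢ-total n)

guarded : ∀ {A : Set} (S : Summation A) c (p : A → Bool) x →
  (c ≡ true → ∑ S (λ a → ⟦ p a ⟧) * x ≤ total S) → ∑ S (λ a → ⟦ c ∧ p a ⟧) * x ≤ total S
guarded S true  p x h = h refl
guarded S false p x h = ≤-trans (≤-reflexive (cong (_* x) (∑-0 S))) z≤n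

-- The guards c and d are not random: a bound on p or r f is required only when its guard holds. The
-- test 1 ≤ ∑ encodes that some f fails.
union-bound : ∀ {A : Set} (S : Summation A) {n} c (p : A → Bool) (d : Fin n → Bool) (r : Fin n → A → Bool) x →
  (c ≡ true → ∑ S (λ a → ⟦ p a ⟧) * x ≤ total S) →
  (∀ f → d f ≡ true → ∑ S (λ a → ⟦ r f a ⟧) * x ≤ total S) →
  ∑ S (λ a → ⟦ (c ∧ p a) ∨ (1 ≤ᵇ ∑ (Finˢ n) (λ f → ⟦ d f ∧ r f a ⟧)) ⟧) * x ≤ suc n * total S
union-bound S {n} c p d r x hp hr = begin
  ∑ S (λ a → ⟦ (c ∧ p a) ∨ (1 ≤ᵇ e a) ⟧) * x
    ≤⟨ *-monoˡ-≤ x (∑-mono S (λ a → ≤-trans (⟦∨⟧ (c ∧ p a) (1 ≤ᵇ e a)) (+-monoʳ-≤ ⟦ c ∧ p a ⟧ (⟦≤ᵇ⟧ (e a))))) ⟩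
  ∑ S (λ a → ⟦ c ∧ p a ⟧ + e a) * x
    ≡⟨ cong (_* x) (trans (∑-+ S _ e) (cong (∑ S (λ a → ⟦ c ∧ p a ⟧) +_) (∑-swap S n _))) ⟩
  (∑ S (λ a → ⟦ c ∧ p a ⟧) + ∑ (Finˢ n) (λ f → ∑ S (λ a → ⟦ d f ∧ r f a ⟧))) * x
    ≡⟨ *-distribʳ-+ x (∑ S (λ a → ⟦ c ∧ p a ⟧)) _ ⟩
  ∑ S (λ a → ⟦ c ∧ p a ⟧) * x + ∑ (Finˢ n) (λ f → ∑ S (λ a → ⟦ d f ∧ r f a ⟧)) * x
    ≡⟨ cong (∑ S (λ a → ⟦ c ∧ p a ⟧) * x +_) (∑-*ʳ (Finˢ n) _ x) ⟨
  ∑ S (λ a → ⟦ c ∧ p a ⟧) * x + ∑ (Finˢ n) (λ f → ∑ S (λ a → ⟦ d f ∧ r f a ⟧) * x)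
    ≤⟨ +-mono-≤ (guarded S c p x hp) (∑-mono (Finˢ n) (λ f → guarded S (d f) (r f) x (hr f))) ⟩
  total S + ∑ (Finˢ n) (λ f → total S)
    ≡⟨ cong (total S +_) (trans (∑-const (Finˢ n) (total S)) (trans (cong (total S *_) (Finˢ-total n)) (*-comm (total S) n))) ⟩
  suc n * total S ∎
  where
  open ≤-Reasoning
  e : _ → ℕ
  e a = ∑ (Finˢ n) (λ f → ⟦ d f ∧ r f a ⟧)

<ᵇ-true : ∀ {x y} → (x <ᵇ y) ≡ true → x < y
<ᵇ-true {x} {y} e = <ᵇ⇒< x y (subst Bool.T (sym e) _)

≤ᵇ-true : ∀ {x y} → (x ≤ᵇ y) ≡ true → x ≤ y
≤ᵇ-true {x} {y} e = ≤ᵇ⇒≤ x y (subst Bool.T (sym e) _)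

capped : ∀ v y z → y ≤ z → y ≤ v + ⟦ v ≤ᵇ y ⟧ * z
capped v y z y≤z with v ≤ᵇ y in eq
... | true  = ≤-trans y≤z (≤-trans (≤-reflexive (sym (+-identityʳ z))) (m≤n+m _ v))
... | false = ≤-trans (<⇒≤ (≰⇒> (λ h → subst Bool.T eq (≤⇒≤ᵇ h)))) (m≤m+n v 0)

-- Batches a are drawn independently from S, and each suggests deleting Y a.

module Pruning {n : ℕ} {A : Set} (S : Summation A) (Y : A → Subset n) (R k v : ℕ) .{{_ : NonZero R}} where

  hits : Fin n → ℕ
  hits f = ∑ S (λ a → ⟦ lookup (Y a) f ⟧)

  big : A → Bool
  big a = v ≤ᵇ ∣ Y a ∣ * R

  avoids : Fin n → A → Bool
  avoids f a = not (lookup (Y a) f)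

  -- The guards depend on the distribution, not on D. So if D is not misled, the absence of a big
  -- batch certifies a small expected size of Y, and the first `4 * k` batches cover all elements
  -- hit with probability 1/4.
  misled : Vec A (4 * k + R * k) → Bool
  misled D = ((2 * v * total S <ᵇ ∑ (Finˢ n) hits * R) ∧ all (λ a → not (big a)) D) ∨
    (1 ≤ᵇ ∑ (Finˢ n) (λ f → ⟦ (total S ≤ᵇ 4 * hits f) ∧ all (avoids f) (V.take (4 * k) D) ⟧))

  -- A reverse Markov inequality: the mean exceeds 2v/R, batches that are not big contribute at most
  -- v/R to it, and a big one contributes at most v.
  big-often : (∀ a → ∣ Y a ∣ ≤ v) → 2 * v * total S < ∑ (Finˢ n) hits * R → total S ≤ ∑ S (λ a → ⟦ big a ⟧) * R
  big-often Y≤v large = <⇒≤ (*-cancelˡ-< v _ _ (+-cancelˡ-< (v * total S) _ _ (begin-strict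
    v * total S + v * total S        ≡⟨ l₁ v (total S) ⟩
    2 * v * total S                  <⟨ large ⟩
    ∑ (Finˢ n) hits * R              ≡⟨ cong (_* R) (∑-swap S n _) ⟨
    ∑ S (λ a → ∑ (Finˢ n) (λ f → ⟦ lookup (Y a) f ⟧)) * R ≡⟨ cong (_* R) (∑-cong S (λ a → sym (∣∣-sum (Y a)))) ⟩
    ∑ S (λ a → ∣ Y a ∣) * R          ≡⟨ ∑-*ʳ S _ R ⟨
    ∑ S (λ a → ∣ Y a ∣ * R)          ≤⟨ ∑-mono S (λ a → capped v (∣ Y a ∣ * R) (v * R) (*-monoˡ-≤ R (Y≤v a))) ⟩
    ∑ S (λ a → v + ⟦ big a ⟧ * (v * R)) ≡⟨ ∑-+ S _ _ ⟩
    ∑ S (λ a → v) + ∑ S (λ a → ⟦ big a ⟧ * (v * R)) ≡⟨ cong₂ _+_ (∑-const S v) (∑-*ʳ S _ (v * R)) ⟩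
    v * total S + z * (v * R)        ≡⟨ cong (v * total S +_) (l₂ z v R) ⟩
    v * total S + v * (z * R)        ∎)))
    where
    open ≤-Reasoning
    z = ∑ S (λ a → ⟦ big a ⟧)
    l₁ : ∀ v t → v * t + v * t ≡ 2 * v * t
    l₁ = solve-∀
    l₂ : ∀ z v r → z * (v * r) ≡ v * (z * r)
    l₂ = solve-∀

  misled-rare : (∀ a → ∣ Y a ∣ ≤ v) →
    ∑ (Vecˢ S (4 * k + R * k)) (λ D → ⟦ misled D ⟧) * 2 ^ k ≤ suc n * total (Vecˢ S (4 * k + R * k))
  misled-rare Y≤v = union-bound (Vecˢ S (4 * k + R * k)) (2 * v * total S <ᵇ ∑ (Finˢ n) hits * R) (all (λ a → not (big a)))
    (λ f → total S ≤ᵇ 4 * hits f) (λ f D → all (avoids f) (V.take (4 * k) D)) (2 ^ k)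
    (λ e → all-fail-tail S big R k (big-often Y≤v (<ᵇ-true e)) {4 * k} {R * k} refl)
    (λ f e → all-fail-head S (λ a → lookup (Y a) f) 4 k (≤-trans (≤ᵇ-true e) (≤-reflexive (*-comm 4 (hits f)))) {4 * k} {R * k} refl)

-- θ i / 2^κ is the sampling rate of phase i.
record Parameters (n : ℕ) : Set where
  no-eta-equality
  field
    κ J R k σ₀ σmax imax q : ℕ
    θ         : ℕ → ℕ
    J>0       : 1 ≤ J
    R≥4       : 4 ≤ R
    θ>0       : ∀ i → 1 ≤ θ i
    -- The rate grows by a factor of at most 1 + 1/q.
    θ-step    : ∀ i → ∃[ d ] (θ (suc i) ≡ θ i + d × q * d ≤ θ i)
    θ-rate    : ∀ i → 2 * (J * θ i) ≤ 2 ^ κ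
    θ-final   : 2 * (J * θ imax) ≡ 2 ^ κ
    θ-capped  : θ (suc imax) ≡ θ imax
    -- At the first rate the sample is empty, hence independent, with probability at least 1/2.
    θ-start   : 2 * (n * θ 0) ≤ 2 ^ κ
    -- At the final rate 1/(2J), a quarter of the volume 2^(stage + σ₀) yields samples of mean size
    -- 4 · 2^stage; a useful sample needs 2^stage.
    σ₀-J      : 2 ^ σ₀ ≡ 32 * J
    n-bound   : n ≤ 2 ^ (σmax + σ₀)
    -- Keeps the error from circuits leaving H below 1/4 in `dep-close`.
    J²R-bound : 32 * 2 ^ (σmax + σ₀) ≤ J * J * R
    -- Keeps the expected size of a sample of H of order q², so that a rate step is within its
    -- fluctuation.
    heavy-bound : ∀ h → h * R ≤ 4 * k * 2 ^ (σmax + σ₀) → 2 * h ≤ q * q * J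
    -- At most a quarter of the volume is set aside in one epoch.
    aside-bound : 4 * (32 * suc imax * (4 * k)) ≤ R

-- The invariant and the bad events

module Analysis {n : ℕ} (Par : Parameters n) {ind : Subset n → Bool} (M : IsMatroid ind) where
  open Parameters Par
  open State
  open IsMatroid M
  open Matroid M
  open Algorithm n κ J (4 * k) (R * k) θ imax R σ₀
  open Sampler

  private
    instance
      J≢0 : NonZero J
      J≢0 = >-nonZero J>0
      R≢0 : NonZero R
      R≢0 = >-nonZero (≤-trans (s≤s z≤n) R≥4)
      K≢0 : NonZero (2 ^ κ)
      K≢0 = m^n≢0 2 κ

  K T : ℕ
  K = 2 ^ κ
  T = K ^ n

  volume : State n → ℕ
  volume s = 2 ^ (stage s + σ₀)

  spent : State n → ℕ
  spent s = 32 * phase s + trial s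

  ν : ℕ → Summation (Subset n)
  ν i = μ (θ i) (K ∸ θ i) n

  batch : ℕ → Summation (Vec (Subset n) J)
  batch i = Vecˢ (ν i) J

  θ≤K : ∀ i → θ i ≤ K
  θ≤K i = ≤-trans (m≤n*m (θ i) J) (≤-trans (m≤n*m (J * θ i) 2) (θ-rate i))

  θ+ : ∀ i → θ i + (K ∸ θ i) ≡ K
  θ+ i = m+[n∸m]≡n (θ≤K i)

  ν-total : ∀ i → total (ν i) ≡ T
  ν-total i = trans (μ-total (θ i) (K ∸ θ i) n) (cong (_^ n) (θ+ i))

  samples-image : ∀ s → Image (samples s) (measure sampler) (Vecˢ (batch (suc (phase s))) (4 * k + R * k))
  samples-image s = Vecˢ-image (Vecˢ-image (Vecˢ-image below-θ n) J) (4 * k + R * k)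
    where
    i = suc (phase s)
    below-θ : Image (below κ (θ i)) (Bits κ) (Boolˢ (θ i) (K ∸ θ i))
    below-θ = subst (λ a → Image (below κ (θ i)) (Bits κ) (Boolˢ a (K ∸ θ i))) (m≤n⇒m⊓n≡m (θ≤K i)) (below-image κ (θ i))

  independent : State n → ℕ → Subset n → ℕ
  independent s i A = ∑ (ν i) (λ S → ⟦ ind (I s ∪ (S ∩ A)) ⟧)

  record Staged (s : State n) : Set where
    field
      G⊆E     : G s ⊆ E s
      phase≤  : phase s ≤ imax
      trial<  : trial s < 32
      -- Each of the `spent s` sets removed from G in this epoch has size at most 4k · volume/R.
      aside   : ∣ E s ∣ * R ≤ ∣ G s ∣ * R + spent s * (4 * k * volume s)
      -- Each trial in which the samples of the next phase stay dependent
      -- splits off a set costing a factor 31/32 of independence.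
      likely  : 32 ^ trial s * T ≤ 2 * 31 ^ trial s * independent s (phase s) (G s) ⊎
                T ≤ 2 * independent s (suc (phase s)) (G s)

  record Invariant (s : State n) : Set where
    field
      indI   : ind (I s) ≡ true
      spans  : Spans ind (I s ∪ E s)
      small  : ∣ E s ∣ ≤ volume s
      stage≤ : stage s ≤ σmax
      staged : stage s ≡ 0 ⊎ Staged s

  -- Bad events

  module Prune (s : State n) = Pruning (batch (suc (phase s))) (redundant ind (I s) (G s)) R k (volume s)

  badContract : State n → Vec (Vec (Subset n) J) (4 * k + R * k) → Bool
  badContract s = all (λ v → not (any (useful ind s) v))

  bad : State n → Batches → Bool
  bad s w with stage s
  ... | zero  = false
  ... | suc σ with ∣ E s ∣ ≤? 2 ^ (σ + σ₀)
  ...   | yes _ = false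
  ...   | no  _ with phase s ≟ imax
  ...     | yes _ = badContract s (samples s w)
  ...     | no  _ = Prune.misled s (samples s w)

-- Samples are independent with probability at least 1/2 and too small with probability at most 1/4.
useful-often : ∀ a b {n} (G : Subset n) (F : Subset n → Bool) s J .{{_ : NonZero a}} .{{_ : NonZero J}} →
  2 * (J * a) ≡ a + b → 4 * J * 2 ^ suc s ≤ ∣ G ∣ →
  let m = μ a b n in
  total m ≤ 2 * ∑ m (λ S → ⟦ F S ⟧) → total m ≤ ∑ m (λ S → ⟦ F S ∧ (2 ^ s ≤ᵇ ∣ S ∩ G ∣) ⟧) * 4
useful-often a b {n} G F s J rate G-large likely = +-cancelʳ-≤ t t (u * 4) (begin
  t + t                                 ≡⟨ cong (t +_) (+-identityʳ t) ⟨
  2 * t                                 ≤⟨ *-monoʳ-≤ 2 likely ⟩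
  2 * (2 * x)                           ≤⟨ *-monoʳ-≤ 2 (*-monoʳ-≤ 2 x≤u+f) ⟩
  2 * (2 * (u + f))                     ≡⟨ l₁ u f ⟩
  u * 4 + 4 * f                         ≤⟨ +-monoʳ-≤ (u * 4) few ⟩
  u * 4 + t                             ∎)
  where
  open ≤-Reasoning
  m = μ a b n
  t = total m
  c = pred (2 ^ s)
  x = ∑ m (λ S → ⟦ F S ⟧)
  u = ∑ m (λ S → ⟦ F S ∧ (2 ^ s ≤ᵇ ∣ S ∩ G ∣) ⟧)
  f = ∑ m (λ S → ⟦ ∣ S ∩ G ∣ ≤ᵇ c ⟧)
  l₁ : ∀ u f → 2 * (2 * (u + f)) ≡ u * 4 + 4 * f
  l₁ = solve-∀
  split-size : ∀ b p y .{{_ : NonZero p}} → ⟦ b ⟧ ≤ ⟦ b ∧ (p ≤ᵇ y) ⟧ + ⟦ y ≤ᵇ pred p ⟧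
  split-size false p y = z≤n
  split-size true  p y with p ≤ᵇ y in e₁ | y ≤ᵇ pred p in e₂
  ... | true  | _     = s≤s z≤n
  ... | false | true  = s≤s z≤n
  ... | false | false = contradiction (≰⇒> (λ h → subst Bool.T e₂ (≤⇒≤ᵇ h)))
                          (λ h → subst Bool.T e₁ (≤⇒≤ᵇ (≤-trans (≤-reflexive (sym (suc-pred p))) h)))
  x≤u+f : x ≤ u + f
  x≤u+f = ≤-trans (∑-mono m (λ S → split-size (F S) (2 ^ s) ∣ S ∩ G ∣ {{m^n≢0 2 s}})) (≤-reflexive (∑-+ m _ _))
  T′ = 2 * (a + b)
  z = a + 2 * b
  few : 4 * f ≤ t
  few = ≤-trans (tail-small f ∣ G ∣ (4 * J) (2 ^ suc s) c z T′ ((a + b) ^ n) {{m*n≢0 4 J}} {{T′≢0}}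
    zM≤ z≤T′ G-large c+2≤C (μ-size a b G c)) (≤-reflexive (sym (μ-total a b n)))
    where
    T′≢0 : NonZero T′
    T′≢0 = m*n≢0 2 (a + b) {{it}} {{>-nonZero (<-≤-trans (>-nonZero⁻¹ a) (m≤m+n a b))}}
    z≤T′ : z ≤ T′
    z≤T′ = ≤-trans (m≤n+m z a) (≤-reflexive (e a b))
      where
      e : ∀ a b → a + (a + 2 * b) ≡ 2 * (a + b)
      e = solve-∀
    c+2≤C : 2 + c ≤ 2 ^ suc s
    c+2≤C = begin
      suc (suc c)        ≡⟨ cong suc (suc-pred (2 ^ s) {{m^n≢0 2 s}}) ⟩
      suc (2 ^ s)        ≤⟨ +-monoˡ-≤ (2 ^ s) (m^n>0 2 s) ⟩
      2 ^ s + 2 ^ s      ≡⟨ cong (2 ^ s +_) (+-identityʳ (2 ^ s)) ⟨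
      2 ^ suc s          ∎
    -- At rate a/(a+b) = 1/(2J), the ratio z/T′ = 1 - a/(2(a+b)) is exactly 1 - 1/(4J).
    zM≤ : z * (4 * J) ≤ pred (4 * J) * T′
    zM≤ = +-cancelˡ-≤ T′ _ _ (≤-reflexive (begin-equality
      T′ + z * (4 * J)               ≡⟨ cong (λ r → 2 * r + z * (4 * J)) rate ⟨
      2 * (2 * (J * a)) + z * (4 * J) ≡⟨ e J a b ⟩
      4 * J * T′                     ≡⟨ cong (_* T′) (suc-pred (4 * J) {{m*n≢0 4 J}}) ⟨
      T′ + pred (4 * J) * T′         ∎))
      where
      e : ∀ j a b → 2 * (2 * (j * a)) + (a + 2 * b) * (4 * j) ≡ 4 * j * (2 * (a + b))
      e = solve-∀

any-map : ∀ {A B : Set} (p : B → Bool) (f : A → B) {m} (v : Vec A m) → any p (V.map f v) ≡ any (p ∘ f) v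
any-map p f []      = refl
any-map p f (x ∷ v) = cong (p (f x) ∨_) (any-map p f v)

not-any : ∀ {A : Set} (p : A → Bool) {m} (v : Vec A m) → any p v ≡ not (all (λ a → not (p a)) v)
not-any p []      = refl
not-any p (x ∷ v) with p x
... | true  = refl
... | false = not-any p v

any-++ : ∀ {A : Set} (p : A → Bool) {m l} (u : Vec A m) (v : Vec A l) → any p (u V.++ v) ≡ any p u ∨ any p v
any-++ p []      v = refl
any-++ p (x ∷ u) v with p x
... | true  = refl
... | false = any-++ p u v

any-concat : ∀ {A : Set} (p : A → Bool) {m j} (D : Vec (Vec A j) m) → any p (V.concat D) ≡ any (any p) D
any-concat p []      = refl
any-concat p (v ∷ D) = trans (any-++ p v (V.concat D)) (cong (any p v ∨_) (any-concat p D))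

∨-false⁻ : ∀ {x y} → x ∨ y ≡ false → x ≡ false × y ≡ false
∨-false⁻ {false} {false} _ = refl , refl

module _ {n : ℕ} {A : Set} (S : Summation A) (Y : A → Subset n) (R k v : ℕ) .{{_ : NonZero R}} where
  open Pruning S Y R k v

  few-hits : ∀ D → misled D ≡ false → any big D ≡ false → ∑ (Finˢ n) hits * R ≤ 2 * v * total S
  few-hits D good none = ≮⇒≥ λ large → contradiction (trans (sym (∧-true⁺ (<⇒<ᵇ-true large) all-not))
      (proj₁ (∨-false⁻ {(2 * v * total S <ᵇ ∑ (Finˢ n) hits * R) ∧ all (λ a → not (big a)) D} good))) λ ()
    where
    <⇒<ᵇ-true : ∀ {x y} → x < y → (x <ᵇ y) ≡ true
    <⇒<ᵇ-true {x} {y} x<y with x <ᵇ y | <⇒<ᵇ x<y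
    ... | true | _ = refl
    all-not : all (λ a → not (big a)) D ≡ true
    all-not with all (λ a → not (big a)) D | not-any big D
    ... | true  | _ = refl
    ... | false | e = trans (sym none) e

  hits-found : ∀ D → misled D ≡ false → ∀ f → total S ≤ 4 * hits f → any (λ a → lookup (Y a) f) (V.take (4 * k) D) ≡ true
  hits-found D good f heavy = trans (not-any (λ a → lookup (Y a) f) (V.take (4 * k) D))
    (cong not (absurd (≤⇒≤ᵇ heavy) zero-term))
    where
    e : Fin n → ℕ
    e f = ⟦ (total S ≤ᵇ 4 * hits f) ∧ all (avoids f) (V.take (4 * k) D) ⟧
    1≰ : ∀ x → (1 ≤ᵇ x) ≡ false → x ≡ 0
    1≰ zero    _ = refl
    zero-term : e f ≡ 0
    zero-term = n≤0⇒n≡0 (≤-trans (∈-∑ e f) (≤-reflexive (1≰ (∑ (Finˢ n) e)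
      (proj₂ (∨-false⁻ {(2 * v * total S <ᵇ ∑ (Finˢ n) hits * R) ∧ all (λ a → not (big a)) D} good)))))
    absurd : ∀ {c d} → Bool.T c → ⟦ c ∧ d ⟧ ≡ 0 → d ≡ false
    absurd {true} {false} _ _ = refl

-- The potential

module Potential (σ₀ R J cmax : ℕ) (σ₀-J : 2 ^ σ₀ ≡ 32 * J) where

  width : ℕ
  width = suc (R + 32 * J * suc cmax + cmax)

  -- x in units of the volume 2^(stage + σ₀) of the stage 1 + σ.
  units : ℕ → ℕ → ℕ
  units σ x = _/_ x (2 ^ (suc σ + σ₀)) {{m^n≢0 2 (suc σ + σ₀)}}

  units-mono : ∀ σ {x y} → x ≤ y → units σ x ≤ units σ y
  units-mono σ = /-monoˡ-≤ (2 ^ (suc σ + σ₀)) {{m^n≢0 2 (suc σ + σ₀)}}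

  units-bound : ∀ σ {x} y → x ≤ y * 2 ^ (suc σ + σ₀) → units σ x ≤ y
  units-bound σ y h = ≤-trans (units-mono σ h) (≤-reflexive (m*n/n≡m y (2 ^ (suc σ + σ₀)) {{m^n≢0 2 (suc σ + σ₀)}}))

  units-drop : ∀ σ {x y} → x + 2 ^ (suc σ + σ₀) ≤ y → suc (units σ x) ≤ units σ y
  units-drop σ {x} {y} h = ≤-trans (s≤s (units-mono σ (m+n≤o⇒m≤o∸n x h)))
    (≤-reflexive (sym (m/n≡1+[m∸n]/n {{m^n≢0 2 (suc σ + σ₀)}} (≤-trans (m≤n+m _ x) h))))

  -- Within a stage, a deletion uses up a unit of `e * R`, and setting a set aside raises c. A
  -- contraction uses up a unit of `32 * J * e`, worth `suc cmax` because it resets c to 0. The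
  -- extra `suc` pays for leaving the stage.
  potential : ℕ → ℕ → ℕ → ℕ
  potential zero    e c = e
  potential (suc σ) e c = 2 ^ σ₀ + σ * width +
    suc (units σ (e * R) + units σ (32 * J * e) * suc cmax + (cmax ∸ c))

  potential-bound : ∀ σ {e} c → e ≤ 2 ^ (σ + σ₀) → potential σ e c ≤ 2 ^ σ₀ + σ * width
  potential-bound zero    c h = ≤-trans h (m≤m+n _ 0)
  potential-bound (suc σ) {e} c h = begin
    potential (suc σ) e c
      ≤⟨ +-monoʳ-≤ (2 ^ σ₀ + σ * width) (s≤s (+-mono-≤ (+-mono-≤
           (units-bound σ R (≤-trans (*-monoˡ-≤ R h) (≤-reflexive (*-comm (2 ^ (suc σ + σ₀)) R))))
           (*-monoˡ-≤ (suc cmax) (units-bound σ (32 * J) (*-monoʳ-≤ (32 * J) h)))) (m∸n≤m cmax c))) ⟩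
    2 ^ σ₀ + σ * width + width        ≡⟨ +-assoc (2 ^ σ₀) _ _ ⟩
    2 ^ σ₀ + (σ * width + width)      ≡⟨ cong (2 ^ σ₀ +_) (+-comm (σ * width) width) ⟩
    2 ^ σ₀ + suc σ * width            ∎
    where open ≤-Reasoning

  potential-lower : ∀ σ {e} c c′ e′ → e ≤ 2 ^ (σ + σ₀) → potential σ e c < potential (suc σ) e′ c′
  potential-lower σ c c′ e′ h = ≤-<-trans (potential-bound σ c h) (m<m+n _ z<s)

  potential-delete : ∀ σ {e e′ y} c → e′ + y ≡ e → 2 ^ (suc σ + σ₀) ≤ y * R → potential (suc σ) e′ c < potential (suc σ) e c
  potential-delete σ {e} {e′} {y} c refl h = +-monoʳ-< (2 ^ σ₀ + σ * width) (s<s (+-monoˡ-< (cmax ∸ c) (+-mono-<-≤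
    (units-drop σ (≤-trans (+-monoʳ-≤ (e′ * R) h) (≤-reflexive (sym (*-distribʳ-+ R e′ y)))))
    (*-monoˡ-≤ (suc cmax) (units-mono σ (*-monoʳ-≤ (32 * J) (m≤m+n e′ y)))))))

  potential-contract : ∀ σ {e e′ y} c → e′ + y ≡ e → 2 ^ suc σ ≤ y → potential (suc σ) e′ 0 < potential (suc σ) e c
  potential-contract σ {e} {e′} {y} c refl h = +-monoʳ-< (2 ^ σ₀ + σ * width) (s<s (begin-strict
    units σ (e′ * R) + z′ * suc cmax + cmax           ≡⟨ +-assoc (units σ (e′ * R)) _ cmax ⟩
    units σ (e′ * R) + (z′ * suc cmax + cmax)         <⟨ +-monoʳ-< (units σ (e′ * R)) (+-monoʳ-< (z′ * suc cmax) (n<1+n cmax)) ⟩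
    units σ (e′ * R) + (z′ * suc cmax + suc cmax)     ≡⟨ cong (units σ (e′ * R) +_) (+-comm (z′ * suc cmax) (suc cmax)) ⟩
    units σ (e′ * R) + suc z′ * suc cmax              ≤⟨ +-mono-≤ (units-mono σ (*-monoˡ-≤ R (m≤m+n e′ y))) (*-monoˡ-≤ (suc cmax) z′<z) ⟩
    units σ (e * R) + z * suc cmax                    ≤⟨ m≤m+n _ (cmax ∸ c) ⟩
    units σ (e * R) + z * suc cmax + (cmax ∸ c)       ∎))
    where
    open ≤-Reasoning
    z′ = units σ (32 * J * e′)
    z = units σ (32 * J * e)
    z′<z : suc z′ ≤ z
    z′<z = units-drop σ (begin
      32 * J * e′ + 2 ^ (suc σ + σ₀)  ≡⟨ cong (32 * J * e′ +_) (trans (^-distribˡ-+-* 2 (suc σ) σ₀) (cong (2 ^ suc σ *_) σ₀-J)) ⟩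
      32 * J * e′ + 2 ^ suc σ * (32 * J) ≤⟨ +-monoʳ-≤ (32 * J * e′) (*-monoˡ-≤ (32 * J) h) ⟩
      32 * J * e′ + y * (32 * J)      ≡⟨ cong (32 * J * e′ +_) (*-comm y (32 * J)) ⟩
      32 * J * e′ + 32 * J * y        ≡⟨ *-distribˡ-+ (32 * J) e′ y ⟨
      32 * J * (e′ + y)               ∎)

  potential-aside : ∀ σ e {c} → c < cmax → potential (suc σ) e (suc c) < potential (suc σ) e c
  potential-aside σ e h = +-monoʳ-< (2 ^ σ₀ + σ * width) (s<s (+-monoʳ-< (units σ (e * R) + units σ (32 * J * e) * suc cmax) (∸-monoʳ-< (n<1+n _) h)))

-- Raising the rate

rate-odds : ∀ J a b → 1 ≤ J → 2 * (J * a) ≤ a + b → J * a ≤ b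
rate-odds J a b J>0 h = +-cancelˡ-≤ a _ _ (≤-trans
  (+-mono-≤ (m≤n*m a J {{>-nonZero J>0}}) (≤-reflexive (sym (+-identityʳ (J * a))))) h)

-- With variance about h·a/b and mean shift h·d/(a+b), this is the condition that the shift stays
-- within the standard deviation; it bounds the second moment in `dep-persists`.
rate-fluctuation : ∀ h d q J a b → q * d ≤ a → 2 * h ≤ q * q * J → J * a ≤ b → 2 * (h * (d * d)) ≤ a * b
rate-fluctuation h d q J a b qd≤a 2h≤ Ja≤b = begin
  2 * (h * (d * d))         ≡⟨ *-assoc 2 h (d * d) ⟨
  2 * h * (d * d)           ≤⟨ *-monoˡ-≤ (d * d) 2h≤ ⟩
  q * q * J * (d * d)       ≡⟨ l q J d ⟩
  q * d * (J * (q * d))     ≤⟨ *-mono-≤ qd≤a (≤-trans (*-monoʳ-≤ J qd≤a) Ja≤b) ⟩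
  a * b                     ∎
  where
  open ≤-Reasoning
  l : ∀ q j d → q * q * j * (d * d) ≡ q * d * (j * (q * d))
  l = solve-∀

-- If x is not the majority, then 2y ≥ t, and closeness leaves 4z ≥ 2t - t.
majority : ∀ t x y z → x + y ≡ t → 4 * y ≤ 4 * z + t → t ≤ 2 * x ⊎ t ≤ 4 * z
majority t x y z refl close with x + y ≤? 2 * x
... | yes p = inj₁ p
... | no  p = inj₂ (+-cancelʳ-≤ t t _ (begin
  t + t                   ≡⟨ l₁ x y ⟩
  2 * x + 2 * y           ≤⟨ +-monoˡ-≤ (2 * y) (*-monoʳ-≤ 2 x≤y) ⟩
  2 * y + 2 * y           ≡⟨ l₂ y ⟩
  4 * y                   ≤⟨ close ⟩
  4 * z + t               ∎))
  where
  open ≤-Reasoning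
  l₁ : ∀ x y → x + y + (x + y) ≡ 2 * x + 2 * y
  l₁ = solve-∀
  l₂ : ∀ y → 2 * y + 2 * y ≡ 4 * y
  l₂ = solve-∀
  x≤y : x ≤ y
  x≤y = +-cancelˡ-≤ x x y (≤-trans (≤-reflexive (cong (x +_) (sym (+-identityʳ x)))) (<⇒≤ (≰⇒> p)))

complement-≤ : ∀ t x y → x + y ≡ t → t ≤ 32 * y → 32 * x ≤ 31 * t
complement-≤ t x y e h = +-cancelʳ-≤ t _ _ (begin
  32 * x + t       ≤⟨ +-monoʳ-≤ (32 * x) h ⟩
  32 * x + 32 * y  ≡⟨ *-distribˡ-+ 32 x y ⟨
  32 * (x + y)     ≡⟨ cong (32 *_) e ⟩
  32 * t           ≡⟨ +-comm t (31 * t) ⟩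
  31 * t + t       ∎)
  where open ≤-Reasoning

module _ {n : ℕ} {ind : Subset n → Bool} (M : IsMatroid ind) (I : Subset n) (iI : ind I ≡ true) where
  open Estimates M I iI

  closure-dichotomy : ∀ a b J R v (G H : Subset n) .{{_ : NonZero a}} .{{_ : NonZero b}} .{{_ : NonZero J}} .{{_ : NonZero R}} →
    2 * (J * a) ≤ a + b → 32 * v ≤ J * J * R → H ⊆ G →
    let S = Vecˢ (μ a b n) J ; P = λ f → ∑ S (λ v → ⟦ lookup (redundant ind I G v) f ⟧) in
    (∀ f → total S ≤ 4 * P f → f ∈ H) → ∑ (Finˢ n) P * R ≤ 2 * v * total S →
    total (μ a b n) ≤ 2 * indep a b G ⊎ total (μ a b n) ≤ 4 * dep a b H
  closure-dichotomy a b J R v G H small vR H⊆G heavy few =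
    majority (total (μ a b n)) (indep a b G) (dep a b G) (dep a b H) (indep+dep a b G) close
    where
    S-total : total (Vecˢ (μ a b n) J) ≡ total (μ a b n) ^ J
    S-total = Vecˢ-total (μ a b n) J
    few′ : J * R * ∑ (Finˢ n) (λ f → ⟦ not (lookup H f) ⟧ * ∑ (μ a b n) (λ S → ⟦ closed ind I G S f ⟧)) ≤ 8 * v * total (μ a b n)
    few′ = closure-small a b J R v G H small vR
        (λ f h → heavy f (≤-trans (≤-reflexive S-total) h)) (≤-trans few (≤-reflexive (cong (2 * v *_) S-total)))
    close : 4 * dep a b G ≤ 4 * dep a b H + total (μ a b n)
    close = dep-close a b J R v G H small vR H⊆G few′

  -- The dichotomy is obtained at the sampled rate a, but dependence of H is moved back to the old
  -- rate a′, where the independence of G is being tracked.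
  absorb : ∀ a b a′ b′ d J R v q (G H : Subset n) .{{_ : NonZero a′}} .{{_ : NonZero J}} .{{_ : NonZero R}} →
    a ≡ a′ + d → b′ ≡ d + b → 2 * (J * a) ≤ a + b → 32 * v ≤ J * J * R →
    q * d ≤ a′ → 2 * ∣ H ∣ ≤ q * q * J → H ⊆ G →
    let S = Vecˢ (μ a b n) J ; P = λ f → ∑ S (λ v → ⟦ lookup (redundant ind I G v) f ⟧) in
    (∀ f → total S ≤ 4 * P f → f ∈ H) → ∑ (Finˢ n) P * R ≤ 2 * v * total S →
    total (μ a b n) ≤ 2 * indep a b G ⊎ 32 * indep a′ b′ H ≤ 31 * total (μ a′ b′ n)
  absorb _ b a′ _ d J R v q G H refl refl small vR qd≤a h≤ H⊆G heavy few =
    [ inj₁ , (λ h → inj₂ (complement-≤ (total (μ a′ (d + b) n)) (indep a′ (d + b) H) (dep a′ (d + b) H) (indep+dep a′ (d + b) H) (persists h))) ]′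
    (closure-dichotomy (a′ + d) b J R v G H {{a≢0}} {{b≢0}} small vR H⊆G heavy few)
    where
    J>0 : 1 ≤ J
    J>0 = >-nonZero⁻¹ J
    Ja≤b : J * (a′ + d) ≤ b
    Ja≤b = rate-odds J (a′ + d) b J>0 small
    a≢0 : NonZero (a′ + d)
    a≢0 = >-nonZero (<-≤-trans (>-nonZero⁻¹ a′) (m≤m+n a′ d))
    b≢0 : NonZero b
    b≢0 = >-nonZero (≤-trans (*-mono-≤ J>0 (>-nonZero⁻¹ (a′ + d) {{a≢0}})) Ja≤b)
    b′≢0 : NonZero (d + b)
    b′≢0 = >-nonZero (<-≤-trans (>-nonZero⁻¹ b {{b≢0}}) (m≤n+m b d))
    rate′ : J * a′ ≤ d + b
    rate′ = ≤-trans (*-monoʳ-≤ J (m≤m+n a′ d)) (≤-trans Ja≤b (m≤n+m b d))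
    fluct : 2 * (∣ H ∣ * (d * d)) ≤ a′ * (d + b)
    fluct = rate-fluctuation ∣ H ∣ d q J a′ (d + b) qd≤a h≤ rate′
    T′ : total (μ a′ (d + b) n) ≡ (a′ + d + b) ^ n
    T′ = trans (μ-total a′ (d + b) n) (cong (_^ n) (sym (+-assoc a′ d b)))
    persists : total (μ (a′ + d) b n) ≤ 4 * dep (a′ + d) b H → total (μ a′ (d + b) n) ≤ 32 * dep a′ (d + b) H
    persists h = ≤-trans (≤-reflexive T′)
      (dep-persists a′ d b H {{it}} {{b′≢0}} fluct (≤-trans (≤-reflexive (sym (μ-total (a′ + d) b n))) h))

-- The probability of independence in G is at most the product of those in H and in G ─ H. As the
-- former is at most 31/32, the guaranteed lower bound grows by the factor 32/31.
likely-step : ∀ t g h x j .{{_ : NonZero t}} → 32 ^ j * t ≤ 2 * 31 ^ j * g → g * t ≤ h * x → 32 * h ≤ 31 * t →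
  32 ^ suc j * t ≤ 2 * 31 ^ suc j * x
likely-step t g h x j likely split few = begin
  32 * 32 ^ j * t          ≡⟨ *-assoc 32 (32 ^ j) t ⟩
  32 * (32 ^ j * t)        ≤⟨ *-monoʳ-≤ 32 likely ⟩
  32 * (2 * 31 ^ j * g)    ≡⟨ l (2 * 31 ^ j) g ⟩
  2 * 31 ^ j * (32 * g)    ≤⟨ *-monoʳ-≤ (2 * 31 ^ j) 32g≤31x ⟩
  2 * 31 ^ j * (31 * x)    ≡⟨ l′ (31 ^ j) 31 x ⟩
  2 * (31 * 31 ^ j) * x    ∎
  where
  open ≤-Reasoning
  l : ∀ p g → 32 * (p * g) ≡ p * (32 * g)
  l = solve-∀
  l′ : ∀ p c x → 2 * p * (c * x) ≡ 2 * (c * p) * x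
  l′ = solve-∀
  l″ : ∀ c h x → c * (h * x) ≡ c * h * x
  l″ = solve-∀
  32g≤31x : 32 * g ≤ 31 * x
  32g≤31x = *-cancelʳ-≤ (32 * g) (31 * x) t (begin
    32 * g * t       ≡⟨ *-assoc 32 g t ⟩
    32 * (g * t)     ≤⟨ *-monoʳ-≤ 32 split ⟩
    32 * (h * x)     ≡⟨ l″ 32 h x ⟩
    32 * h * x       ≤⟨ *-monoˡ-≤ x few ⟩
    31 * t * x       ≡⟨ *-assoc 31 t x ⟩
    31 * (t * x)     ≡⟨ cong (31 *_) (*-comm t x) ⟩
    31 * (x * t)     ≡⟨ *-assoc 31 x t ⟨
    31 * x * t       ∎)

-- After 32 losses the guaranteed probability (1/2)(32/31)^32 would exceed 1.
likely-exhausted : ∀ j t x .{{_ : NonZero t}} → j ≡ 31 → x ≤ t → ¬ (32 ^ suc j * t ≤ 2 * 31 ^ suc j * x)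
likely-exhausted j t x j≡31 x≤t h = <-irrefl refl
  (<-≤-trans (*-monoˡ-< t (gap j j≡31)) (≤-trans h (*-monoʳ-≤ (2 * 31 ^ suc j) x≤t)))
  where
  gap : ∀ j → j ≡ 31 → 2 * 31 ^ suc j < 32 ^ suc j
  gap j refl = <ᵇ⇒< (2 * 31 ^ 32) (32 ^ 32) _

likely-weaken : ∀ t x j → 32 ^ j * t ≤ 2 * 31 ^ j * x → t ≤ 2 * x
likely-weaken t x j h = *-cancelˡ-≤ (32 ^ j) {{m^n≢0 32 j}} (begin
  32 ^ j * t         ≤⟨ h ⟩
  2 * 31 ^ j * x     ≡⟨ l (31 ^ j) x ⟩
  31 ^ j * (2 * x)   ≤⟨ *-monoˡ-≤ (2 * x) (^-monoˡ-≤ j (n≤1+n 31)) ⟩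
  32 ^ j * (2 * x)   ∎)
  where
  open ≤-Reasoning
  l : ∀ p x → 2 * p * x ≡ p * (2 * x)
  l = solve-∀

-- Passes from decoded samples back to random bits and absorbs the factor `suc N` of the union
-- bound.
rare-image : ∀ {A B : Set} (S : Summation A) (S′ : Summation B) (g : A → B) → Image g S S′ → ∀ (p : B → Bool) N Q x →
  ∑ S′ (λ b → ⟦ p b ⟧) * x ≤ suc N * total S′ → suc N * Q ≤ x → ∑ S (λ a → ⟦ p (g a) ⟧) * Q ≤ total S
rare-image S S′ g im p N Q x bound h = *-cancelˡ-≤ (suc N) (begin
  suc N * (∑ S (λ a → ⟦ p (g a) ⟧) * Q)  ≡⟨ cong (λ y → suc N * (y * Q)) (im (λ b → ⟦ p b ⟧)) ⟩
  suc N * (z * Q)                        ≡⟨ l (suc N) z Q ⟩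
  z * (suc N * Q)                        ≤⟨ *-monoʳ-≤ z h ⟩
  z * x                                  ≤⟨ bound ⟩
  suc N * total S′                       ≡⟨ cong (suc N *_) (im (λ _ → 1)) ⟨
  suc N * total S                        ∎)
  where
  open ≤-Reasoning
  z = ∑ S′ (λ b → ⟦ p b ⟧)
  l : ∀ n z q → n * (z * q) ≡ z * (n * q)
  l = solve-∀

any-false : ∀ {A : Set} (p : A → Bool) {m} (v : Vec A m) → any p v ≡ false → All (λ x → p x ≡ false) v
any-false p []      e = []
any-false p (x ∷ v) e = let e₁ , e₂ = ∨-false⁻ {p x} e in e₁ ∷ any-false p v e₂

first-All : ∀ {A : Set} {P : A → Set} (p : A → Bool) d {m} {v : Vec A m} → All P v → any p v ≡ true → P (first p d v)
first-All p d {v = x ∷ v} (Px ∷ Pv) e with p x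
... | true  = Px
... | false = first-All p d Pv e

all⇒All : ∀ {A : Set} (p : A → Bool) {m} (v : Vec A m) → all p v ≡ true → All (λ x → p x ≡ true) v
all⇒All p []      e = []
all⇒All p (x ∷ v) e = let e₁ , e₂ = ∧-true⁻ {p x} e in e₁ ∷ all⇒All p v e₂

-- A batch v certifies every f ∈ redundant v by an independent prefix of one
-- of its samples, all of which avoid redundant v.
redundant-sound : ∀ {n} (ind : Subset n → Bool) I G {j} (v : Vec (Subset n) j) → redundant ind I G v ⊆ G ×
  (∀ f → f ∈ redundant ind I G v → ∃[ Q ] (Q ⊆ I ∪ (G ─ redundant ind I G v) × ind Q ≡ true × ind (Q ∪ ⁅ f ⁆) ≡ false))
redundant-sound {n} ind I G v = (λ f∈ → proj₁ (sound f∈)) , (λ f f∈ → proj₂ (sound f∈))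
  where
  Y = redundant ind I G v
  outs closes : Fin n → Bool
  outs f = all (λ S → not (lookup S f)) v
  closes f = any (λ S → closed ind I G S f) v
  unfold : ∀ {f} → f ∈ Y → outs f ≡ true × closes f ≡ true
  unfold {f} f∈ = ∧-true⁻ (trans (sym (lookup∘tabulate _ f)) ([]=⇒lookup f∈))
  find : ∀ {f j} (w : Vec (Subset n) j) → any (λ S → closed ind I G S f) w ≡ true →
    (∀ {x} → x ∈ Y → All (λ S → x ∉ S) w) → ∃[ S ] (closed ind I G S f ≡ true × (∀ {x} → x ∈ Y → x ∉ S))
  find {f} (S ∷ w) e avoid with closed ind I G S f in eq
  ... | true  = S , eq , (λ x∈ → All.head (avoid x∈))
  ... | false = find w e (λ x∈ → All.tail (avoid x∈))
  avoids : ∀ {x} → x ∈ Y → All (λ S → x ∉ S) v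
  avoids x∈ = All.map (λ e → lookup⇒∉ (not-true⁻ e)) (all⇒All _ v (proj₁ (unfold x∈)))
  sound : ∀ {f} → f ∈ Y → f ∈ G × ∃[ Q ] (Q ⊆ I ∪ (G ─ Y) × ind Q ≡ true × ind (Q ∪ ⁅ f ⁆) ≡ false)
  sound {f} f∈ with find v (proj₂ (unfold f∈)) avoids
  ... | S , cl , avoid with closed⁻ ind I G S f cl
  ... | f∈G , _ , k , _ , iQ , dQ = f∈G , I ∪ Q , ∪-monoʳ I Q⊆ , iQ , trans (cong ind (∪-assoc I Q ⁅ f ⁆)) dQ
    where
    Q = prefix k (S ∩ G)
    Q⊆ : Q ⊆ G ─ Y
    Q⊆ x∈ with x∈p∩q⁻ S G (proj₁ (∈-prefix⁻ k x∈))
    ... | x∈S , x∈G = x∈p∧x∉q⇒x∈p─q x∈G (λ x∈Y → avoid x∈Y x∈S)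

-- Bad rounds are rare

module Correctness {n : ℕ} (Par : Parameters n) {ind : Subset n → Bool} (M : IsMatroid ind) where
  open Parameters Par
  open State
  open IsMatroid M
  open Matroid M
  open Algorithm n κ J (4 * k) (R * k) θ imax R σ₀
  open Sampler
  open Analysis Par M
  open Potential σ₀ R J (32 * imax) σ₀-J

  private
    instance
      J≢0 : NonZero J
      J≢0 = >-nonZero J>0
      R≢0 : NonZero R
      R≢0 = >-nonZero (≤-trans (s≤s z≤n) R≥4)
    θ≢0 : ∀ i → NonZero (θ i)
    θ≢0 i = >-nonZero (θ>0 i)
    T≢0 : NonZero T
    T≢0 = m^n≢0 K n {{m^n≢0 2 κ}}

  ν-cong : ∀ {i j} → θ i ≡ θ j → ν i ≡ ν j
  ν-cong = cong (λ a → μ a (K ∸ a) n)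

  G-size : ∀ e g c v → e * R ≤ g * R + c * (4 * k * v) → c ≤ 32 * suc imax → 4 * e ≤ 4 * g + v
  G-size e g c v h c≤ = *-cancelʳ-≤ (4 * e) (4 * g + v) R (begin
    4 * e * R                                     ≡⟨ *-assoc 4 e R ⟩
    4 * (e * R)                                   ≤⟨ *-monoʳ-≤ 4 (≤-trans h (+-monoʳ-≤ (g * R) (*-monoˡ-≤ (4 * k * v) c≤))) ⟩
    4 * (g * R + 32 * suc imax * (4 * k * v))     ≡⟨ l g R (32 * suc imax) (4 * k) v ⟩
    4 * g * R + 4 * (32 * suc imax * (4 * k)) * v ≤⟨ +-monoʳ-≤ (4 * g * R) (*-monoˡ-≤ v aside-bound) ⟩
    4 * g * R + R * v                             ≡⟨ l′ g R v ⟩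
    (4 * g + v) * R                               ∎)
    where
    open ≤-Reasoning
    l : ∀ g r x y v → 4 * (g * r + x * (y * v)) ≡ 4 * g * r + 4 * (x * y) * v
    l = solve-∀
    l′ : ∀ g r v → 4 * g * r + r * v ≡ (4 * g + v) * r
    l′ = solve-∀

  θ-last : ∀ i → i ≡ imax → θ i ≡ θ (suc i)
  θ-last i refl = sym θ-capped

  -- The rate no longer changes after phase `imax`, so the two alternatives of `likely` speak of the
  -- same distribution.
  likely-final : ∀ s → Staged s → phase s ≡ imax → total (ν (suc (phase s))) ≤ 2 * independent s (suc (phase s)) (G s)
  likely-final s st last = ≤-trans (≤-reflexive (ν-total (suc (phase s)))) ([ early , id ]′ likely)
    where
    open Staged st
    early : 32 ^ trial s * T ≤ 2 * 31 ^ trial s * independent s (phase s) (G s) → T ≤ 2 * independent s (suc (phase s)) (G s)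
    early h = subst (λ S → T ≤ 2 * ∑ S (λ S → ⟦ ind (I s ∪ (S ∩ G s)) ⟧)) (ν-cong {phase s} {suc (phase s)} (θ-last (phase s) last))
      (likely-weaken T (independent s (phase s) (G s)) (trial s) h)

  spent≤ : ∀ s → Staged s → spent s ≤ 32 * suc imax
  spent≤ s st = begin
    32 * phase s + trial s   ≤⟨ +-mono-≤ (*-monoʳ-≤ 32 phase≤) (<⇒≤ trial<) ⟩
    32 * imax + 32           ≡⟨ +-comm (32 * imax) 32 ⟩
    32 + 32 * imax           ≡⟨ *-suc 32 imax ⟨
    32 * suc imax            ∎
    where
    open ≤-Reasoning
    open Staged st

  contract-often : ∀ {σ i j I E G} → let s = state (suc σ) i j I E G in Staged s → i ≡ imax → ¬ (∣ E ∣ ≤ 2 ^ (σ + σ₀)) →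
    total (ν (suc i)) ≤ ∑ (ν (suc i)) (λ S → ⟦ useful ind s S ⟧) * 4
  contract-often {σ} {i₀} {j} {I₀} {E₀} {G₀} st ph E> = useful-often (θ i) (K ∸ θ i) G₀ (λ S → ind (I₀ ∪ (S ∩ G₀))) (suc σ) J {{θ≢0 i}}
    (trans (cong (λ z → 2 * (J * z)) (sym (θ-last i₀ ph))) (trans (cong (λ z → 2 * (J * θ z)) ph) (trans θ-final (sym (θ+ i))))) size (likely-final s st ph)
    where
    open Staged st
    open ≤-Reasoning
    s = state (suc σ) i₀ j I₀ E₀ G₀
    i = suc i₀
    v = volume s
    e = ∣ E s ∣
    g = ∣ G s ∣
    l₁ : ∀ j p → 4 * (4 * j * (2 * p)) ≡ 32 * j * p
    l₁ = solve-∀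
    v≡ : 4 * (4 * J * 2 ^ suc (suc σ)) ≡ v
    v≡ = trans (l₁ J (2 ^ suc σ)) (trans (cong (_* 2 ^ suc σ) (sym σ₀-J)) (trans (sym (^-distribˡ-+-* 2 σ₀ (suc σ))) (cong (2 ^_) (+-comm σ₀ (suc σ)))))
    v≤2e : v ≤ 2 * e
    v≤2e = *-monoʳ-≤ 2 (<⇒≤ (≰⇒> E>))
    l₂ : ∀ x → 2 * (2 * x) ≡ 4 * x
    l₂ = solve-∀
    -- More than v/2 elements are left, as otherwise the stage would be lowered, and at most v/4 of
    -- them are set aside.
    v≤4g : v ≤ 4 * g
    v≤4g = +-cancelʳ-≤ v v (4 * g) (begin
      v + v            ≤⟨ +-mono-≤ v≤2e v≤2e ⟩
      2 * e + 2 * e    ≡⟨ cong (2 * e +_) (+-identityʳ (2 * e)) ⟨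
      2 * (2 * e)      ≡⟨ l₂ e ⟩
      4 * e            ≤⟨ G-size e g (spent s) v aside (spent≤ s st) ⟩
      4 * g + v        ∎)
    size : 4 * J * 2 ^ suc (suc σ) ≤ g
    size = *-cancelˡ-≤ 4 (≤-trans (≤-reflexive v≡) v≤4g)

  contract-rare : ∀ {σ i j I E G} → let s = state (suc σ) i j I E G in Staged s → i ≡ imax → ¬ (∣ E ∣ ≤ 2 ^ (σ + σ₀)) →
    let S = Vecˢ (batch (suc i)) (4 * k + R * k) in
    ∑ S (λ D → ⟦ badContract s D ⟧) * 2 ^ k ≤ suc n * total S
  contract-rare {σ} {i} {j} {I} {E} {G} st ph E> = ≤-trans
    (all-fail (batch (suc i)) (any (useful ind s)) 4 k (any-often (ν (suc i)) (useful ind s) 4 (contract-often st ph E>) J J>0) {4 * k} {R * k} refl)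
    (m≤n*m _ (suc n))
    where s = state (suc σ) i j I E G

  stagedOf : ∀ {σ i j I E G} → Invariant (state (suc σ) i j I E G) → Staged (state (suc σ) i j I E G)
  stagedOf inv with Invariant.staged inv
  ... | inj₂ st = st

  redundant-small : ∀ s → Invariant s → Staged s → ∀ b → ∣ redundant ind (I s) (G s) {J} b ∣ ≤ volume s
  redundant-small s inv st b = ≤-trans (p⊆q⇒∣p∣≤∣q∣ (Staged.G⊆E st ∘ proj₁ (redundant-sound ind (I s) (G s) b))) (Invariant.small inv)

  module _ (Q : ℕ) (Q-bound : suc n * Q ≤ 2 ^ k) where

    rare : ∀ s → Invariant s → ∑ (measure sampler) (λ w → ⟦ bad s w ⟧) * Q ≤ total (measure sampler)
    rare (state zero    i j I E G) inv = ≤-trans (≤-reflexive (cong (_* Q) (∑-0 (measure sampler)))) z≤n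
    rare (state (suc σ) i j I E G) inv with ∣ E ∣ ≤? 2 ^ (σ + σ₀)
    ... | yes _ = ≤-trans (≤-reflexive (cong (_* Q) (∑-0 (measure sampler)))) z≤n
    ... | no E> with i ≟ imax
    ...   | yes ph = rare-image (measure sampler) (Vecˢ (batch (suc i)) (4 * k + R * k)) (samples s) (samples-image s) (badContract s) n Q (2 ^ k)
                       (contract-rare (stagedOf inv) ph E>) Q-bound
      where s = state (suc σ) i j I E G
    ...   | no  _  = rare-image (measure sampler) (Vecˢ (batch (suc i)) (4 * k + R * k)) (samples s) (samples-image s) (Prune.misled s) n Q (2 ^ k)
                       (Prune.misled-rare s (redundant-small s inv (stagedOf inv))) Q-bound
      where s = state (suc σ) i j I E G

-- Good rounds preserve the invariant and lower the potential

∣-∣ : ∀ {n} {p : Subset n} {x} → x ∈ p → ∣ p - x ∣ ≤ pred ∣ p ∣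
∣-∣ x∈p = <⇒≤pred (x∈p⇒∣p-x∣<∣p∣ x∈p)

union-⊆ : ∀ {n m} {G : Subset n} {Ys : Vec (Subset n) m} → All (_⊆ G) Ys → union Ys ⊆ G
union-⊆ []       m = contradiction m ∉⊥
union-⊆ (h ∷ hs) m = ∪-⊆ h (union-⊆ hs) m

union-size : ∀ {n m R v} {Ys : Vec (Subset n) m} → All (λ Y → ∣ Y ∣ * R ≤ v) Ys → ∣ union Ys ∣ * R ≤ m * v
union-size {n} []  = ≤-reflexive (cong (_* _) (∣⊥∣≡0 n))
union-size {R = R} {Ys = Y ∷ Ys} (h ∷ hs) = ≤-trans (*-monoˡ-≤ R (∣∪∣ Y (union Ys)))
  (≤-trans (≤-reflexive (*-distribʳ-+ R ∣ Y ∣ ∣ union Ys ∣)) (+-mono-≤ h (union-size hs)))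

∈-union : ∀ {n m} {A : Set} (Y : A → Subset n) f (v : Vec A m) → any (λ a → lookup (Y a) f) v ≡ true → f ∈ union (V.map Y v)
∈-union Y f (a ∷ v) e with lookup (Y a) f in eq
... | true  = p⊆p∪q _ (lookup⇒[]= f (Y a) eq)
... | false = q⊆p∪q (Y a) _ (∈-union Y f v e)

aside-step : ∀ e g h R c x c′ → e * R ≤ (g + h) * R + c * x → h * R ≤ x → suc c ≤ c′ → e * R ≤ g * R + c′ * x
aside-step e g h R c x c′ le h≤ c< = begin
  e * R                       ≤⟨ le ⟩
  (g + h) * R + c * x         ≡⟨ cong (_+ c * x) (*-distribʳ-+ R g h) ⟩
  g * R + h * R + c * x       ≡⟨ +-assoc (g * R) (h * R) (c * x) ⟩
  g * R + (h * R + c * x)     ≤⟨ +-monoʳ-≤ (g * R) (≤-trans (+-monoˡ-≤ (c * x) h≤) (*-monoˡ-≤ x c<)) ⟩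
  g * R + c′ * x              ∎
  where open ≤-Reasoning

module Drift {n : ℕ} (Par : Parameters n) {ind : Subset n → Bool} (M : IsMatroid ind) where
  open Parameters Par
  open State
  open IsMatroid M
  open Matroid M
  open Algorithm n κ J (4 * k) (R * k) θ imax R σ₀
  open Sampler
  open Analysis Par M
  open Potential σ₀ R J (32 * imax) σ₀-J
  open Correctness Par M

  private
    instance
      R≢0 : NonZero R
      R≢0 = >-nonZero (≤-trans (s≤s z≤n) R≥4)
    T≢0 : NonZero T
    T≢0 = m^n≢0 K n {{m^n≢0 2 κ}}

  Φ : State n → ℕ
  Φ s = potential (stage s) ∣ E s ∣ (spent s)

  -- The empty sample alone has probability (1 - p)^n ≥ 1/2 at the first rate, whatever I and E are.
  likely-fresh : ∀ I E → ind I ≡ true → T ≤ 2 * ∑ (ν 0) (λ S → ⟦ ind (I ∪ (S ∩ E)) ⟧)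
  likely-fresh I E iI = begin
    T                    ≡⟨ cong (_^ n) (trans (sym (θ+ 0)) (+-comm a b)) ⟩
    (b + a) ^ n          ≤⟨ ^-double b a n (≤-trans θ-start (≤-reflexive (trans (sym (θ+ 0)) (+-comm a b)))) ⟩
    2 * b ^ n            ≡⟨ cong (2 *_) (*-identityʳ (b ^ n)) ⟨
    2 * (b ^ n * 1)      ≡⟨ cong (λ x → 2 * (b ^ n * ⟦ x ⟧)) (hereditary (∪-⊆ id (λ m → contradiction (p∩q⊆p ⊥ E m) ∉⊥)) iI) ⟨
    2 * (b ^ n * ⟦ ind (I ∪ (⊥ ∩ E)) ⟧) ≤⟨ *-monoʳ-≤ 2 (μ-⊥ a b (λ S → ⟦ ind (I ∪ (S ∩ E)) ⟧)) ⟩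
    2 * ∑ (ν 0) (λ S → ⟦ ind (I ∪ (S ∩ E)) ⟧) ∎
    where
    open ≤-Reasoning
    a = θ 0
    b = K ∸ θ 0

  fresh : ∀ {σ I E} → ind I ≡ true → Spans ind (I ∪ E) → ∣ E ∣ ≤ 2 ^ (σ + σ₀) → σ ≤ σmax → Invariant (state σ 0 0 I E E)
  fresh {σ} {I} {E} iI sp small st = record
    { indI = iI ; spans = sp ; small = small ; stage≤ = st
    ; staged = inj₂ record
      { G⊆E = id ; phase≤ = z≤n ; trial< = s≤s z≤n ; aside = m≤m+n _ _
      ; likely = inj₁ (≤-trans (≤-reflexive (+-identityʳ T)) (likely-fresh I E iI)) } }

  decide-drift : ∀ {i j I E G} → Invariant (state 0 i j I E G) →
    let s′ = decide ind (state 0 i j I E G) in Invariant s′ × Φ s′ ≤ pred ∣ E ∣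
  decide-drift {i} {j} {I} {E} {G} inv with nonempty? E
  ... | no  empty = inv , ≤-reflexive (trans E≡0 (cong pred (sym E≡0)))
    where
    E≡0 : ∣ E ∣ ≡ 0
    E≡0 = trans (cong ∣_∣ (Empty-unique empty)) (∣⊥∣≡0 n)
  ... | yes (f , f∈E) with ind (I ∪ ⁅ f ⁆) in eq
  ...   | true  = record { indI = eq ; spans = spans-⊆ keep spans ; small = ≤-trans (≤-trans (∣-∣ f∈E) pred[n]≤n) small
                         ; stage≤ = stage≤ ; staged = inj₁ refl } , ∣-∣ f∈E
    where
    open Invariant inv
    keep : I ∪ E ⊆ (I ∪ ⁅ f ⁆) ∪ (E - f)
    keep {x} m with x∈p∪q⁻ I E m | x Fin.≟ f
    ... | inj₁ x∈I | _        = p⊆p∪q _ (p⊆p∪q _ x∈I)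
    ... | inj₂ _   | yes refl = p⊆p∪q _ (q⊆p∪q I ⁅ f ⁆ (x∈⁅x⁆ f))
    ... | inj₂ x∈E | no  x≢f  = q⊆p∪q (I ∪ ⁅ f ⁆) _ (x∈p∧x≢y⇒x∈p-y x∈E x≢f)
  ...   | false = record { indI = indI ; spans = spans-delete redundant-f spans ; small = ≤-trans (≤-trans (∣-∣ f∈E) pred[n]≤n) small
                         ; stage≤ = stage≤ ; staged = inj₁ refl } , ∣-∣ f∈E
    where
    open Invariant inv
    redundant-f : ∀ x → x ∈ I ∪ E → x ∈ I ∪ (E - f) ⊎ ∃[ Q ] (Q ⊆ I ∪ (E - f) × ind Q ≡ true × ind (Q ∪ ⁅ x ⁆) ≡ false)
    redundant-f x m with x∈p∪q⁻ I E m | x Fin.≟ f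
    ... | inj₁ x∈I | _        = inj₁ (p⊆p∪q _ x∈I)
    ... | inj₂ _   | yes refl = inj₂ (I , p⊆p∪q _ , indI , eq)
    ... | inj₂ x∈E | no  x≢f  = inj₁ (q⊆p∪q I _ (x∈p∧x≢y⇒x∈p-y x∈E x≢f))

  lower-drift : ∀ {σ i j I E G} → Invariant (state (suc σ) i j I E G) → ∣ E ∣ ≤ 2 ^ (σ + σ₀) →
    let s = state (suc σ) i j I E G in Invariant (lower s) × Φ (lower s) ≤ pred (Φ s)
  lower-drift {σ} {i} {j} {E = E} inv h = fresh indI spans h (≤-trans (n≤1+n σ) stage≤) , <⇒≤pred (potential-lower σ (32 * 0 + 0) (32 * i + j) ∣ E ∣ h)
    where open Invariant inv

  contract-drift : ∀ {σ i j I E G} → let s = state (suc σ) i j I E G in Invariant s → ∀ D → badContract s D ≡ false →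
    let s′ = contract s (chosen ind s D) in Invariant s′ × Φ s′ ≤ pred (Φ s)
  contract-drift {σ} {i} {j} {I} {E} {G} inv D good =
    fresh indep (spans-⊆ keep spans) (≤-trans (∣p─q∣≤∣p∣ E C) small) stage≤ ,
    <⇒≤pred (potential-contract σ (32 * i + j) (∣─∣ C⊆E) large)
    where
    open Invariant inv
    s = state (suc σ) i j I E G
    open Staged (stagedOf inv)
    C = chosen ind s D
    C⊆E : C ⊆ E
    C⊆E = G⊆E ∘ p∩q⊆q _ G
    found : useful ind s (first (useful ind s) ⊥ (V.concat D)) ≡ true
    found = first-any (useful ind s) ⊥ (V.concat D) (trans (any-concat (useful ind s) D)
      (trans (not-any (any (useful ind s)) D) (cong not good)))
    indep : ind (I ∪ C) ≡ true
    indep = proj₁ (∧-true⁻ found)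
    large : 2 ^ suc σ ≤ ∣ C ∣
    large = ≤ᵇ-true (proj₂ (∧-true⁻ {ind (I ∪ C)} found))
    keep : I ∪ E ⊆ (I ∪ C) ∪ (E ─ C)
    keep {x} m with x∈p∪q⁻ I E m | x ∈? C
    ... | inj₁ x∈I | _       = p⊆p∪q _ (p⊆p∪q _ x∈I)
    ... | inj₂ _   | yes x∈C = p⊆p∪q _ (q⊆p∪q I C x∈C)
    ... | inj₂ x∈E | no  x∉C = q⊆p∪q (I ∪ C) _ (x∈p∧x∉q⇒x∈p─q x∈E x∉C)

  module _ {σ i j : ℕ} {I E G : Subset n} (inv : Invariant (state (suc σ) i j I E G)) where
    private
      s = state (suc σ) i j I E G
      Y = redundant ind I G {J}
    open Invariant inv
    open Staged (stagedOf inv)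

    Sound : Subset n → Set
    Sound Y = Y ⊆ G × (∀ f → f ∈ Y → ∃[ Q ] (Q ⊆ I ∪ (G ─ Y) × ind Q ≡ true × ind (Q ∪ ⁅ f ⁆) ≡ false))

    independent-mono : ∀ i {A B} → A ⊆ B → independent s i B ≤ independent s i A
    independent-mono i = Estimates.indep-antitone M I indI (θ i) (K ∸ θ i)

    -- As Y ⊆ G, both E and G lose the same elements, so the count of elements set aside is
    -- unaffected; shrinking G only makes independence likelier.
    delete-drift : ∀ {Y} → Sound Y → plenty s Y ≡ true → Invariant (delete s Y) × Φ (delete s Y) ≤ pred (Φ s)
    delete-drift {Y} (Y⊆G , sound) big = record
      { indI = indI ; spans = spans-delete removed spans ; small = ≤-trans (∣p─q∣≤∣p∣ E Y) small ; stage≤ = stage≤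
      ; staged = inj₂ record
        { G⊆E = ─-mono Y G⊆E ; phase≤ = phase≤ ; trial< = trial< ; aside = aside′
        ; likely = [ (λ h → inj₁ (≤-trans h (*-monoʳ-≤ (2 * 31 ^ j) (independent-mono i (p─q⊆p G Y)))))
                   , (λ h → inj₂ (≤-trans h (*-monoʳ-≤ 2 (independent-mono (suc i) (p─q⊆p G Y))))) ]′ likely } }
      , <⇒≤pred (potential-delete σ (32 * i + j) (∣─∣ (G⊆E ∘ Y⊆G)) (≤ᵇ-true big))
      where
      open ≤-Reasoning
      removed : ∀ x → x ∈ I ∪ E → x ∈ I ∪ (E ─ Y) ⊎ ∃[ Q ] (Q ⊆ I ∪ (E ─ Y) × ind Q ≡ true × ind (Q ∪ ⁅ x ⁆) ≡ false)
      removed x m with x∈p∪q⁻ I E m | x ∈? Y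
      ... | inj₁ x∈I | _       = inj₁ (p⊆p∪q _ x∈I)
      ... | inj₂ x∈E | no x∉Y  = inj₁ (q⊆p∪q I _ (x∈p∧x∉q⇒x∈p─q x∈E x∉Y))
      ... | inj₂ _   | yes x∈Y = let Q , Q⊆ , iQ , dQ = sound x x∈Y in inj₂ (Q , ∪-monoʳ I (─-mono Y G⊆E) ∘ Q⊆ , iQ , dQ)
      y = ∣ Y ∣
      c = spent s * (4 * k * volume s)
      aside′ : ∣ E ─ Y ∣ * R ≤ ∣ G ─ Y ∣ * R + c
      aside′ = +-cancelʳ-≤ (y * R) _ _ (begin
        ∣ E ─ Y ∣ * R + y * R        ≡⟨ *-distribʳ-+ R ∣ E ─ Y ∣ y ⟨
        (∣ E ─ Y ∣ + y) * R          ≡⟨ cong (_* R) (∣─∣ (G⊆E ∘ Y⊆G)) ⟩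
        ∣ E ∣ * R                    ≤⟨ aside ⟩
        ∣ G ∣ * R + c                ≡⟨ cong (λ g → g * R + c) (∣─∣ Y⊆G) ⟨
        (∣ G ─ Y ∣ + y) * R + c      ≡⟨ l ∣ G ─ Y ∣ y R c ⟩
        ∣ G ─ Y ∣ * R + c + y * R    ∎)
        where
        l : ∀ g y r c → (g + y) * r + c ≡ g * r + c + y * r
        l = solve-∀

    -- The field `likely` after H is set aside, before it is known whether the trial counter wraps
    -- around.
    Advance : Subset n → Set
    Advance H = 32 ^ suc j * T ≤ 2 * 31 ^ suc j * independent s i (G ─ H) ⊎
                T ≤ 2 * independent s (suc i) (G ─ H)

    advance : ∀ {H} → H ⊆ G → ∣ H ∣ * R ≤ 4 * k * volume s →
      (∀ f → total (batch (suc i)) ≤ 4 * ∑ (batch (suc i)) (λ v → ⟦ lookup (Y v) f ⟧) → f ∈ H) →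
      ∑ (Finˢ n) (λ f → ∑ (batch (suc i)) (λ v → ⟦ lookup (Y v) f ⟧)) * R ≤ 2 * volume s * total (batch (suc i)) →
      Advance H
    advance {H} H⊆G H-small heavy few = [ (λ h → shrink h outcome) , later ]′ likely
      where
      d = proj₁ (θ-step i)
      a = θ (suc i)
      b = K ∸ a
      v≤ : volume s ≤ 2 ^ (σmax + σ₀)
      v≤ = ^-monoʳ-≤ 2 (+-monoˡ-≤ σ₀ stage≤)
      θ≡ : θ (suc i) ≡ θ i + d
      θ≡ = proj₁ (proj₂ (θ-step i))
      b′≡ : K ∸ θ i ≡ d + b
      b′≡ = +-cancelˡ-≡ (θ i) _ _ (begin
        θ i + (K ∸ θ i)   ≡⟨ θ+ i ⟩
        K                 ≡⟨ θ+ (suc i) ⟨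
        a + b             ≡⟨ cong (_+ b) θ≡ ⟩
        θ i + d + b       ≡⟨ +-assoc (θ i) d b ⟩
        θ i + (d + b)     ∎)
        where open ≡-Reasoning
      later : T ≤ 2 * independent s (suc i) G → Advance H
      later h = inj₂ (≤-trans h (*-monoʳ-≤ 2 (independent-mono (suc i) (p─q⊆p G H))))
      outcome : total (ν (suc i)) ≤ 2 * independent s (suc i) G ⊎ 32 * independent s i H ≤ 31 * total (ν i)
      outcome = absorb M I indI a b (θ i) (K ∸ θ i) d J R (volume s) q G H {{>-nonZero (θ>0 i)}} {{>-nonZero J>0}} {{>-nonZero (≤-trans (s≤s z≤n) R≥4)}}
        θ≡ b′≡ (≤-trans (θ-rate (suc i)) (≤-reflexive (sym (θ+ (suc i)))))
        (≤-trans (*-monoʳ-≤ 32 v≤) J²R-bound) (proj₂ (proj₂ (θ-step i)))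
        (heavy-bound ∣ H ∣ (≤-trans H-small (*-monoʳ-≤ (4 * k) v≤))) H⊆G heavy few
      shrink : 32 ^ j * T ≤ 2 * 31 ^ j * independent s i G →
        total (ν (suc i)) ≤ 2 * independent s (suc i) G ⊎ 32 * independent s i H ≤ 31 * total (ν i) → Advance H
      shrink h (inj₁ l)   = later (≤-trans (≤-reflexive (sym (ν-total (suc i)))) l)
      shrink h (inj₂ few) = inj₁ (likely-step T (independent s i G) (independent s i H) (independent s i (G ─ H)) j {{T≢0}} h
        (≤-trans (≤-reflexive (cong (independent s i G *_) (sym (ν-total i)))) (Estimates.indep-product M I indI (θ i) (K ∸ θ i) H H⊆G))
        (≤-trans few (≤-reflexive (cong (31 *_) (ν-total i)))))

    aside-next : ∀ {H} → H ⊆ G → ∣ H ∣ * R ≤ 4 * k * volume s → ∀ c → suc (spent s) ≤ c →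
      ∣ E ∣ * R ≤ ∣ G ─ H ∣ * R + c * (4 * k * volume s)
    aside-next {H} H⊆G H-small c h = aside-step (∣ E ∣) (∣ G ─ H ∣) (∣ H ∣) R (spent s) (4 * k * volume s) c
      (≤-trans aside (≤-reflexive (cong (λ g → g * R + spent s * (4 * k * volume s)) (sym (∣─∣ H⊆G))))) H-small h

    setAside-drift : ∀ {H} → i ≢ imax → H ⊆ G → ∣ H ∣ * R ≤ 4 * k * volume s → Advance H →
      Invariant (setAside s H) × Φ (setAside s H) ≤ pred (Φ s)
    setAside-drift {H} i≢ H⊆G H-small adv with j ≟ 31
    ... | yes j≡31 = record { indI = indI ; spans = spans ; small = small ; stage≤ = stage≤
      ; staged = inj₂ record
        { G⊆E = G⊆E ∘ p─q⊆p G H ; phase≤ = i<imax ; trial< = s≤s z≤n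
        ; aside = aside-next H⊆G H-small (32 * suc i + 0) (≤-reflexive count)
        ; likely = inj₁ (≤-trans (≤-reflexive (+-identityʳ T)) (settle adv)) } }
      , <⇒≤pred (subst (λ c → potential (suc σ) (∣ E ∣) c < potential (suc σ) (∣ E ∣) (32 * i + j)) count (potential-aside σ (∣ E ∣) c<))
      where
      i<imax : i < imax
      i<imax = ≤∧≢⇒< phase≤ i≢
      -- With j = 31 the step to trial 0 of the next phase also raises `spent` by exactly one.
      count : suc (32 * i + j) ≡ 32 * suc i + 0
      count = trans (sym (+-suc (32 * i) j)) (trans (cong (λ l → 32 * i + suc l) j≡31)
        (trans (+-comm (32 * i) 32) (trans (sym (*-suc 32 i)) (sym (+-identityʳ (32 * suc i))))))
      c< : 32 * i + j < 32 * imax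
      c< = ≤-trans (≤-reflexive (trans count (+-identityʳ (32 * suc i)))) (*-monoʳ-≤ 32 i<imax)
      -- After the last trial the first alternative is impossible, so independence at the next rate
      -- is established.
      settle : Advance H → T ≤ 2 * independent s (suc i) (G ─ H)
      settle (inj₂ h) = h
      settle (inj₁ h) = contradiction h (likely-exhausted j T (independent s i (G ─ H)) {{T≢0}} j≡31
        (≤-trans (∑-mono (ν i) (λ S → ⟦⟧≤1 (ind (I ∪ (S ∩ (G ─ H)))))) (≤-reflexive (ν-total i))))
    ... | no  j≢ = record { indI = indI ; spans = spans ; small = small ; stage≤ = stage≤
      ; staged = inj₂ record
        { G⊆E = G⊆E ∘ p─q⊆p G H ; phase≤ = phase≤ ; trial< = j<31
        ; aside = aside-next H⊆G H-small (32 * i + suc j) (≤-reflexive (sym (+-suc (32 * i) j)))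
        ; likely = adv } }
      , <⇒≤pred (subst (λ c → potential (suc σ) (∣ E ∣) c < potential (suc σ) (∣ E ∣) (32 * i + j)) (sym (+-suc (32 * i) j)) (potential-aside σ (∣ E ∣) c<))
      where
      j<31 : suc j < 32
      j<31 = s≤s (≤∧≢⇒< (≤-pred trial<) j≢)
      c< : 32 * i + j < 32 * imax
      c< = <-≤-trans (+-monoʳ-< (32 * i) trial<) (≤-trans (≤-reflexive (trans (+-comm (32 * i) 32) (sym (*-suc 32 i)))) (*-monoʳ-≤ 32 (≤∧≢⇒< phase≤ i≢)))

    prune-drift : i ≢ imax → ∀ D → Prune.misled s D ≡ false →
      let s′ = prune s (V.map Y D) in Invariant s′ × Φ s′ ≤ pred (Φ s)
    prune-drift i≢ D good with any (plenty s) (V.map Y D) in eq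
    ... | true  = delete-drift (first-All {P = Sound} (plenty s) ⊥ (map⁺ (All.universal (redundant-sound ind I G) D)) eq)
                    (first-any (plenty s) ⊥ (V.map Y D) eq)
    ... | false = setAside-drift i≢ H⊆G H-small (advance H⊆G H-small found
                    (few-hits (batch (suc i)) Y R k (volume s) D good (trans (sym (any-map (plenty s) Y D)) eq)))
      where
      H = union (V.take (4 * k) (V.map Y D))
      H⊆G : H ⊆ G
      H⊆G = union-⊆ (take⁺ (4 * k) (map⁺ (All.universal (proj₁ ∘ redundant-sound ind I G) D)))
      H-small : ∣ H ∣ * R ≤ 4 * k * volume s
      H-small = union-size (take⁺ (4 * k) (All.map (λ {Z} → below-volume (∣ Z ∣ * R)) (any-false (plenty s) (V.map Y D) eq)))
        where
        below-volume : ∀ x → (volume s ≤ᵇ x) ≡ false → x ≤ volume s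
        below-volume x e = <⇒≤ (≰⇒> λ h → subst Bool.T e (≤⇒≤ᵇ h))
      found : ∀ f → total (batch (suc i)) ≤ 4 * ∑ (batch (suc i)) (λ v → ⟦ lookup (Y v) f ⟧) → f ∈ H
      found f heavy = subst (λ Ys → f ∈ union Ys) (sym (take-map Y (4 * k) D))
        (∈-union Y f (V.take (4 * k) D) (hits-found (batch (suc i)) Y R k (volume s) D good f heavy))

  drift : ∀ s w → Invariant s → bad s w ≡ false → Invariant (step ind w s) × Φ (step ind w s) ≤ pred (Φ s)
  drift (state zero    i j I E G) w inv _ = decide-drift inv
  drift (state (suc σ) i j I E G) w inv good with ∣ E ∣ ≤? 2 ^ (σ + σ₀)
  ... | yes h = lower-drift inv h
  ... | no  _ with i ≟ imax
  ...   | yes _  = contract-drift inv (samples (state (suc σ) i j I E G) w) good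
  ...   | no  i≢ = prune-drift inv i≢ (samples (state (suc σ) i j I E G) w) good

-- The choice of parameters

bit-length : ∀ n → ∃[ l ] (2 ^ l ≤ suc n × n < 2 ^ suc l × l ≤ ⌊log₂ n ⌋)
bit-length zero    = 0 , s≤s z≤n , s≤s z≤n , z≤n
bit-length (suc n) = let l , lo , hi = search n in
  l , m≤n⇒m≤1+n lo , hi , ≤-trans (≤-reflexive (sym (⌊log₂[2^n]⌋≡n l))) (⌊log₂⌋-mono-≤ lo)
  where
  search : ∀ n → ∃[ l ] (2 ^ l ≤ suc n × suc n < 2 ^ suc l)
  search zero    = 0 , s≤s z≤n , s≤s (s≤s z≤n)
  search (suc n) with search n
  ... | l , lo , hi with suc (suc n) <? 2 ^ suc l
  ...   | yes h = l , m≤n⇒m≤1+n lo , h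
  ...   | no  h = suc l , ≮⇒≥ h , ≤-<-trans hi (m<m+n (2 ^ suc l) (≤-trans (m^n>0 2 (suc l)) (m≤m+n _ 0)))

module Rates (q cap : ℕ) .{{_ : NonZero q}} where

  -- Starting from q makes the rounded-down increment θ/q at least 1; the cap makes the last rate
  -- exact.
  θ : ℕ → ℕ
  θ zero    = q
  θ (suc i) = (θ i + θ i / q) ⊓ cap

  module _ (q≤cap : q ≤ cap) where

    θ≤cap : ∀ i → θ i ≤ cap
    θ≤cap zero    = q≤cap
    θ≤cap (suc i) = m⊓n≤n _ cap

    θ-increasing : ∀ i → θ i ≤ θ (suc i)
    θ-increasing i = ⊓-glb (m≤m+n (θ i) _) (θ≤cap i)

    q≤θ : ∀ i → q ≤ θ i
    q≤θ zero    = ≤-refl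
    q≤θ (suc i) = ≤-trans (q≤θ i) (θ-increasing i)

    θ-smooth : ∀ i → ∃[ d ] (θ (suc i) ≡ θ i + d × q * d ≤ θ i)
    θ-smooth i = d , sym (m+[n∸m]≡n (θ-increasing i)) , (begin
      q * d            ≤⟨ *-monoʳ-≤ q (m≤n+o⇒m∸n≤o _ (θ i) (m⊓n≤m _ cap)) ⟩
      q * (θ i / q)    ≡⟨ *-comm q _ ⟩
      θ i / q * q      ≤⟨ m/n*n≤m (θ i) q ⟩
      θ i              ∎)
      where
      open ≤-Reasoning
      d = θ (suc i) ∸ θ i

    -- From 2^l · q on, each phase below the cap adds at least 2^l, so q phases double the rate.
    θ-grows : ∀ l i → (2 ^ l * q) ⊓ cap ≤ θ i → ∀ j → (2 ^ l * q + j * 2 ^ l) ⊓ cap ≤ θ (j + i)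
    θ-grows l i base zero    = subst (λ x → x ⊓ cap ≤ θ i) (sym (+-identityʳ _)) base
    θ-grows l i base (suc j) with cap ≤? θ (j + i)
    ... | yes full = ≤-trans (m⊓n≤n _ cap) (≤-trans full (θ-increasing (j + i)))
    ... | no  open′ = ⊓-mono-≤ sum (≤-refl {cap})
      where
      reached : 2 ^ l * q + j * 2 ^ l ≤ θ (j + i)
      reached with ⊓-sel (2 ^ l * q + j * 2 ^ l) cap
      ... | inj₁ e = ≤-trans (≤-reflexive (sym e)) (θ-grows l i base j)
      ... | inj₂ e = contradiction (≤-trans (≤-reflexive (sym e)) (θ-grows l i base j)) open′
      step : 2 ^ l ≤ θ (j + i) / q
      step = ≤-trans (≤-reflexive (sym (m*n/n≡m (2 ^ l) q))) (/-monoˡ-≤ q (≤-trans (m≤m+n _ _) reached))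
      sum : 2 ^ l * q + suc j * 2 ^ l ≤ θ (j + i) + θ (j + i) / q
      sum = ≤-trans (≤-reflexive (trans (cong (2 ^ l * q +_) (+-comm (2 ^ l) (j * 2 ^ l))) (sym (+-assoc (2 ^ l * q) (j * 2 ^ l) (2 ^ l))))) (+-mono-≤ reached step)

    θ-doubles : ∀ l → (2 ^ l * q) ⊓ cap ≤ θ (l * q)
    θ-doubles zero    = ≤-trans (m⊓n≤m _ cap) (≤-reflexive (+-identityʳ q))
    θ-doubles (suc l) = subst (λ x → x ⊓ cap ≤ θ (q + l * q)) (e (2 ^ l) q) (θ-grows l (l * q) (θ-doubles l) q)
      where
      e : ∀ p q → p * q + q * p ≡ 2 * p * q
      e = solve-∀

    θ-full : ∀ l → 2 ^ l * q ≡ cap → θ (l * q) ≡ cap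
    θ-full l e = ≤-antisym (θ≤cap (l * q)) (≤-trans (≤-reflexive (sym (m≥n⇒m⊓n≡n (≤-reflexive (sym e))))) (θ-doubles l))

-- The constant is 6369 = 1 + 32 + 6144 + 192, collected after bounding 1, q³, b·q⁴ and b·q by m.
-- The term 6144 · b·q⁴ comes from q³ contractions, each after 32 · 6bq trials.
width-bound : ∀ c b L q .{{_ : NonZero b}} .{{_ : NonZero L}} .{{_ : NonZero q}} →
  suc (c * (b * L * q ^ 4) + 32 * q ^ 3 * suc (32 * (b * 6 * q)) + 32 * (b * 6 * q)) ≤ (c + 6369) * (b * L * q ^ 4)
width-bound c b L q = begin
  suc (c * m + 32 * q ^ 3 * suc (32 * (b * 6 * q)) + 32 * (b * 6 * q)) ≡⟨ e₁ c m b q ⟩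
  c * m + (1 + 32 * q ^ 3 + 6144 * (b * q ^ 4) + 192 * (b * q))
    ≤⟨ +-monoʳ-≤ (c * m) (+-mono-≤ (+-mono-≤ (+-mono-≤ 1≤m (*-monoʳ-≤ 32 q³≤m)) (*-monoʳ-≤ 6144 bq⁴≤m)) (*-monoʳ-≤ 192 bq≤m)) ⟩
  c * m + (m + 32 * m + 6144 * m + 192 * m)  ≡⟨ e₂ c m ⟩
  (c + 6369) * m                          ∎
  where
  open ≤-Reasoning
  m = b * L * q ^ 4
  e₁ : ∀ c m b q → suc (c * m + 32 * (q * (q * (q * 1))) * suc (32 * (b * 6 * q)) + 32 * (b * 6 * q)) ≡
    c * m + (1 + 32 * (q * (q * (q * 1))) + 6144 * (b * (q * (q * (q * (q * 1))))) + 192 * (b * q))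
  e₁ = solve-∀
  e₂ : ∀ c m → c * m + (m + 32 * m + 6144 * m + 192 * m) ≡ (c + 6369) * m
  e₂ = solve-∀
  bq⁴≤m : b * q ^ 4 ≤ m
  bq⁴≤m = *-monoˡ-≤ (q ^ 4) (m≤m*n b L)
  q⁴≤m : q ^ 4 ≤ m
  q⁴≤m = ≤-trans (m≤n*m (q ^ 4) b) bq⁴≤m
  q³≤m : q ^ 3 ≤ m
  q³≤m = ≤-trans (^-monoʳ-≤ q (n≤1+n 3)) q⁴≤m
  1≤m : 1 ≤ m
  1≤m = ≤-trans (m^n>0 q 4) q⁴≤m
  bq≤m : b * q ≤ m
  bq≤m = ≤-trans (*-monoʳ-≤ b (≤-trans (≤-reflexive (sym (*-identityʳ q))) (^-monoʳ-≤ q {1} {4} (s≤s z≤n)))) bq⁴≤m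

*-mono : ∀ c d x y → c ≤ d → x ≤ y → c * x ≤ d * y
*-mono c d x y = *-mono-≤

1≤m*n : ∀ {m n} → 1 ≤ m → 1 ≤ n → 1 ≤ m * n
1≤m*n = *-mono-≤

J²R-suffices : ∀ c b L q → c ≡ 131072 → 1 ≤ b → 1 ≤ L → 1 ≤ q → 32 * (32 * q ^ 9) ≤ q ^ 3 * q ^ 3 * (c * (b * L * q ^ 4))
J²R-suffices c b L q refl b>0 L>0 q>0 = begin
  32 * (32 * q ^ 9)                             ≡⟨ *-assoc 32 32 (q ^ 9) ⟨
  1024 * q ^ 9                                  ≤⟨ *-mono 1024 131072 (q ^ 9) (q ^ 9) (≤ᵇ⇒≤ 1024 131072 _) ≤-refl ⟩
  131072 * q ^ 9                                ≡⟨ cong (131072 *_) (*-identityˡ (q ^ 9)) ⟨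
  131072 * (1 * q ^ 9)                          ≤⟨ *-mono 131072 131072 (1 * q ^ 9) (b * L * q ^ 10) ≤-refl (*-mono-≤ (*-mono-≤ b>0 L>0) (^-monoʳ-≤ q {{>-nonZero q>0}} (n≤1+n 9))) ⟩
  131072 * (b * L * q ^ 10)                     ≡⟨ cong (λ x → 131072 * (b * L * x)) (trans (^-distribˡ-+-* q 6 4) (cong (_* q ^ 4) (^-distribˡ-+-* q 3 3))) ⟩
  131072 * (b * L * (q ^ 3 * q ^ 3 * q ^ 4))    ≡⟨ l 131072 (b * L) (q ^ 3 * q ^ 3) (q ^ 4) ⟩
  q ^ 3 * q ^ 3 * (131072 * (b * L * q ^ 4))    ∎
  where
  open ≤-Reasoning
  l : ∀ c x y z → c * (x * (y * z)) ≡ y * (c * (x * z))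
  l = solve-∀

heavy-suffices : ∀ c b L q → c ≡ 131072 → 1 ≤ b → 1 ≤ L → 1 ≤ q → ∀ h →
  h * (c * (b * L * q ^ 4)) ≤ 4 * (32 * L) * (32 * q ^ 9) → 2 * h ≤ q * q * q ^ 3
heavy-suffices c b L q refl b>0 L>0 q>0 h le = ≤-trans 2h≤32bh (*-cancelˡ-≤ (4096 * (L * q ^ 4)) {{m*n≢0 4096 (L * q ^ 4) {{it}} {{m*n≢0 L (q ^ 4) {{>-nonZero L>0}} {{m^n≢0 q 4 {{>-nonZero q>0}}}}}}}} (begin
  4096 * (L * q ^ 4) * (32 * b * h)         ≡⟨ l₁ 4096 32 L (q ^ 4) b h ⟩
  h * (131072 * (b * L * q ^ 4))            ≤⟨ le ⟩
  4 * (32 * L) * (32 * q ^ 9)               ≡⟨ l₂ 4 32 32 L (q ^ 9) ⟩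
  4096 * (L * q ^ 9)                        ≡⟨ cong (λ x → 4096 * (L * x)) (^-distribˡ-+-* q 4 5) ⟩
  4096 * (L * (q ^ 4 * q ^ 5))              ≡⟨ l₃ 4096 L (q ^ 4) (q ^ 5) ⟩
  4096 * (L * q ^ 4) * q ^ 5                ≡⟨ cong (4096 * (L * q ^ 4) *_) (*-assoc q q (q ^ 3)) ⟨
  4096 * (L * q ^ 4) * (q * q * q ^ 3)      ∎))
  where
  open ≤-Reasoning
  l₁ : ∀ x y L p b h → x * (L * p) * (y * b * h) ≡ h * (x * y * (b * L * p))
  l₁ = solve-∀
  l₂ : ∀ x y z L p → x * (y * L) * (z * p) ≡ x * y * z * (L * p)
  l₂ = solve-∀
  l₃ : ∀ c L p r → c * (L * (p * r)) ≡ c * (L * p) * r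
  l₃ = solve-∀
  2h≤32bh : 2 * h ≤ 32 * b * h
  2h≤32bh = *-monoˡ-≤ h (≤-trans (≤ᵇ⇒≤ 2 32 _) (≤-trans (≤-reflexive (sym (*-identityʳ 32))) (*-monoʳ-≤ 32 b>0)))

aside-suffices : ∀ c b L q → c ≡ 131072 → 1 ≤ b → 1 ≤ L → 1 ≤ q → 4 * (32 * suc (b * 6 * q) * (4 * (32 * L))) ≤ c * (b * L * q ^ 4)
aside-suffices c b L q refl b>0 L>0 q>0 = begin
  4 * (32 * suc (b * 6 * q) * (4 * (32 * L)))     ≡⟨ l₁ 4 32 4 32 L (suc (b * 6 * q)) ⟩
  16384 * (L * suc (b * 6 * q))                   ≡⟨ cong (λ x → 16384 * (L * x)) (l₀ b q) ⟩
  16384 * (L * (1 + 6 * (b * q)))                 ≤⟨ *-mono 16384 16384 (L * (1 + 6 * (b * q))) (L * (b * q + 6 * (b * q))) ≤-refl (*-monoʳ-≤ L (+-monoˡ-≤ (6 * (b * q)) (1≤m*n b>0 q>0))) ⟩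
  16384 * (L * (b * q + 6 * (b * q)))             ≡⟨ l₂ 16384 b L q ⟩
  -- Here 114688 = 7 · 16384, and 131072 is the next power of two.
  114688 * (b * L * q)                            ≤⟨ *-mono 114688 131072 (b * L * q) (b * L * q ^ 4) (≤ᵇ⇒≤ 114688 131072 _) (*-monoʳ-≤ (b * L) q≤q⁴) ⟩
  131072 * (b * L * q ^ 4)                        ∎
  where
  open ≤-Reasoning
  l₀ : ∀ b q → suc (b * 6 * q) ≡ 1 + 6 * (b * q)
  l₀ = solve-∀
  l₁ : ∀ x y z w L s → x * (y * s * (z * (w * L))) ≡ x * y * z * w * (L * s)
  l₁ = solve-∀
  l₂ : ∀ c b L q → c * (L * (b * q + 6 * (b * q))) ≡ c * 7 * (b * L * q)
  l₂ = solve-∀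
  q≤q⁴ : q ≤ q ^ 4
  q≤q⁴ = ≤-trans (≤-reflexive (sym (*-identityʳ q))) (^-monoʳ-≤ q {{>-nonZero q>0}} {1} {4} (s≤s z≤n))

-- The large constants c and C below are variables with defining equations, as
-- the type checker would unfold multiplication by a literal in unary.
module Choice (n c L b : ℕ) (c≡ : c ≡ 131072) (L>0 : 1 ≤ L) (b>0 : 1 ≤ b) (n<2^L : n < 2 ^ L) (L≤9b : L ≤ b * 9) where

  q : ℕ
  q = 2 ^ b

  J k R σmax σ₀ imax : ℕ
  J    = q ^ 3
  -- Makes the failure bound 2^(-k) beat every polynomial factor that the union bounds bring in.
  k    = 32 * L
  R    = c * (b * L * q ^ 4)
  σmax = b * 6
  σ₀   = b * 3 + 5
  -- From q to the cap q⁷ the rate doubles 6b times, with q phases per doubling.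
  imax = b * 6 * q

  q>0 : 1 ≤ q
  q>0 = m^n>0 2 b

  q^ : ∀ e → q ^ e ≡ 2 ^ (b * e)
  q^ e = ^-*-assoc 2 b e

  private
    instance
      q≢0 : NonZero q
      q≢0 = >-nonZero q>0

  n≤q⁹ : n ≤ q ^ 9
  n≤q⁹ = ≤-trans (<⇒≤ n<2^L) (≤-trans (^-monoʳ-≤ 2 L≤9b) (≤-reflexive (sym (q^ 9))))

  2^volume : 2 ^ (σmax + σ₀) ≡ 32 * q ^ 9
  2^volume = begin
    2 ^ (b * 6 + (b * 3 + 5))   ≡⟨ cong (2 ^_) (e b) ⟩
    2 ^ (5 + b * 9)             ≡⟨ ^-distribˡ-+-* 2 5 (b * 9) ⟩
    32 * 2 ^ (b * 9)            ≡⟨ cong (32 *_) (q^ 9) ⟨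
    32 * q ^ 9                  ∎
    where
    open ≡-Reasoning
    e : ∀ b → b * 6 + (b * 3 + 5) ≡ 5 + b * 9
    e = solve-∀

  -- Chosen so that the cap q⁷ is the rate 1/(2J): 2 · q³ · q⁷ = 2^(1 + 10b).
  κ : ℕ
  κ = suc (b * 10)

  open Rates q (q ^ 7)

  q≤q⁷ : q ≤ q ^ 7
  q≤q⁷ = ≤-trans (≤-reflexive (sym (*-identityʳ q))) (^-monoʳ-≤ q {1} {7} (s≤s z≤n))

  full : 2 * (J * q ^ 7) ≡ 2 ^ κ
  full = cong (2 *_) (trans (sym (^-distribˡ-+-* q 3 7)) (q^ 10))

  θ-imax : θ imax ≡ q ^ 7
  θ-imax = θ-full q≤q⁷ (b * 6) (trans (cong (_* q) (sym (q^ 6))) (*-comm (q ^ 6) q))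

  parameters : Parameters n
  parameters = record
    { κ = κ ; J = J ; R = R ; k = k ; σ₀ = σ₀ ; σmax = σmax ; imax = imax ; q = q ; θ = θ
    ; J>0 = m^n>0 q 3
    ; R≥4 = ≤-trans (≤-trans (≤ᵇ⇒≤ 4 131072 _) (≤-reflexive (sym c≡))) (m≤m*n c (b * L * q ^ 4) {{>-nonZero (1≤m*n (1≤m*n b>0 L>0) (m^n>0 q 4))}})
    ; θ>0 = λ i → ≤-trans q>0 (q≤θ q≤q⁷ i)
    ; θ-step = θ-smooth q≤q⁷
    ; θ-rate = λ i → ≤-trans (*-monoʳ-≤ 2 (*-monoʳ-≤ J (θ≤cap q≤q⁷ i))) (≤-reflexive full)
    ; θ-final = trans (cong (λ x → 2 * (J * x)) θ-imax) full
    ; θ-capped = trans (≤-antisym (θ≤cap q≤q⁷ (suc imax)) (≤-trans (≤-reflexive (sym θ-imax)) (θ-increasing q≤q⁷ imax))) (sym θ-imax)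
    ; θ-start = *-monoʳ-≤ 2 (≤-trans (*-monoˡ-≤ q n≤q⁹) (≤-reflexive (trans (*-comm (q ^ 9) q) (q^ 10))))
    ; σ₀-J = trans (cong (2 ^_) (+-comm (b * 3) 5)) (trans (^-distribˡ-+-* 2 5 (b * 3)) (cong (32 *_) (sym (q^ 3))))
    ; n-bound = ≤-trans n≤q⁹ (≤-trans (m≤n*m (q ^ 9) 32) (≤-reflexive (sym 2^volume)))
    ; J²R-bound = ≤-trans (≤-reflexive (cong (32 *_) 2^volume)) (J²R-suffices c b L q c≡ b>0 L>0 q>0)
    ; heavy-bound = λ h le → heavy-suffices c b L q c≡ b>0 L>0 q>0 h (≤-trans le (≤-reflexive (cong (4 * k *_) 2^volume)))
    ; aside-bound = aside-suffices c b L q c≡ b>0 L>0 q>0 }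

rounds-bound : ∀ c b m s w → 1 ≤ b → s ≤ 32 * m → w ≤ c * m → s + b * 6 * w ≤ (32 + 6 * c) * (b * m)
rounds-bound c b m s w b>0 s≤ w≤ = begin
  s + b * 6 * w                    ≤⟨ +-mono-≤ s≤ (*-monoʳ-≤ (b * 6) w≤) ⟩
  32 * m + b * 6 * (c * m)         ≤⟨ +-monoˡ-≤ (b * 6 * (c * m)) (*-monoʳ-≤ 32 (m≤n*m m b {{>-nonZero b>0}})) ⟩
  32 * (b * m) + b * 6 * (c * m)   ≡⟨ l c b m ⟩
  (32 + 6 * c) * (b * m)           ∎
  where
  open ≤-Reasoning
  l : ∀ c b m → 32 * (b * m) + b * 6 * (c * m) ≡ (32 + 6 * c) * (b * m)
  l = solve-∀

total-bound : ∀ c C b L q s w → 1 ≤ b → 1 ≤ L → 1 ≤ q → b ≤ L → 32 + 6 * (c + 6369) ≤ C → s ≡ 32 * q ^ 3 →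
  w ≡ suc (c * (b * L * q ^ 4) + 32 * q ^ 3 * suc (32 * (b * 6 * q)) + 32 * (b * 6 * q)) →
  s + b * 6 * w ≤ C * (L * (L * L * q ^ 4))
total-bound c C b L q s w b>0 L>0 q>0 b≤L c≤C s≡ w≡ = ≤-trans
  (rounds-bound (c + 6369) b (b * L * q ^ 4) s w b>0 s≤ w≤)
  (*-mono-≤ c≤C (*-mono-≤ b≤L (*-monoˡ-≤ (q ^ 4) (*-monoˡ-≤ L b≤L))))
  where
  s≤ : s ≤ 32 * (b * L * q ^ 4)
  s≤ = ≤-trans (≤-reflexive s≡) (*-monoʳ-≤ 32 (≤-trans (^-monoʳ-≤ q {{>-nonZero q>0}} (n≤1+n 3)) (m≤n*m (q ^ 4) (b * L) {{>-nonZero (1≤m*n b>0 L>0)}})))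
  w≤ : w ≤ (c + 6369) * (b * L * q ^ 4)
  w≤ = ≤-trans (≤-reflexive w≡) (width-bound c b L q {{>-nonZero b>0}} {{>-nonZero L>0}} {{>-nonZero q>0}})

m<2^m : ∀ m → m < 2 ^ m
m<2^m zero    = s≤s z≤n
m<2^m (suc m) = ≤-trans (+-mono-≤ (m^n>0 2 m) (m<2^m m)) (≤-reflexive (cong (2 ^ m +_) (sym (+-identityʳ (2 ^ m)))))

-- Assembly of the algorithm and its bounds

module Solution (n c C L b : ℕ) (c≡ : c ≡ 131072) (C≡ : C ≡ 2 ^ 20) (L>0 : 1 ≤ L) (b>0 : 1 ≤ b) (b≤L : b ≤ L) (n<2^L : n < 2 ^ L) (L≤9b : L ≤ b * 9) where
  open Choice n c L b c≡ L>0 b>0 n<2^L L≤9b public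
  open Parameters parameters using (θ; σ₀-J; n-bound)
  open Algorithm n κ J (4 * k) (R * k) θ imax R σ₀
  open Potential σ₀ R J (32 * imax) σ₀-J

  private
    instance
      q≢0 : NonZero q
      q≢0 = >-nonZero q>0

  X T : ℕ
  X = 2 ^ L
  -- The bound of `potential-bound` for the initial state.
  T = 2 ^ σ₀ + σmax * width

  s₀ : State n
  s₀ = state σmax 0 0 ⊥ ⊤ ⊤

  module P = Protocol sampler queries step (λ φ ψ s w → step-local φ ψ s w) s₀ State.I T

  T>0 : 1 ≤ T
  T>0 = ≤-trans (m^n>0 2 σ₀) (m≤m+n (2 ^ σ₀) (σmax * width))

  T≤ : T ≤ C * (L * (L * L * q ^ 4))
  T≤ = total-bound c C b L q (2 ^ σ₀) width b>0 L>0 q>0 b≤L (enough c≡ C≡) σ₀-J refl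
    where
    enough : ∀ {c C} → c ≡ 131072 → C ≡ 2 ^ 20 → 32 + 6 * (c + 6369) ≤ C
    enough refl refl = ≤ᵇ⇒≤ (32 + 6 * (131072 + 6369)) (2 ^ 20) _

  2≤X : 2 ≤ X
  2≤X = ^-monoʳ-≤ 2 L>0

  X≢0 : NonZero X
  X≢0 = m^n≢0 2 L

  L≤X : L ≤ X
  L≤X = <⇒≤ (m<2^m L)

  b≤X : b ≤ X
  b≤X = ≤-trans b≤L L≤X

  q≤X : q ≤ X
  q≤X = ^-monoʳ-≤ 2 b≤L

  -- Crude bounds by powers of X suffice for the failure probability and the
  -- number of queries.
  infix 4 _≼_
  _≼_ : ℕ → ℕ → Set
  x ≼ e = x ≤ X ^ e

  ≼-* : ∀ x y e f → x ≼ e → y ≼ f → x * y ≼ e + f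
  ≼-* x y e f h h′ = ≤-trans (*-mono-≤ h h′) (≤-reflexive (sym (^-distribˡ-+-* X e f)))

  ≼-^ : ∀ x e k → x ≼ e → x ^ k ≼ e * k
  ≼-^ x e k h = ≤-trans (^-monoˡ-≤ k h) (≤-reflexive (^-*-assoc X e k))

  ≼-mono : ∀ x e f → e ≤ f → x ≼ e → x ≼ f
  ≼-mono x e f e≤f h = ≤-trans h (^-monoʳ-≤ X {{X≢0}} e≤f)

  ≼-+ : ∀ x y e → x ≼ e → y ≼ e → x + y ≼ suc e
  ≼-+ x y e h h′ = ≤-trans (+-mono-≤ h h′) (≤-trans (≤-reflexive (cong (X ^ e +_) (sym (+-identityʳ (X ^ e))))) (*-monoˡ-≤ (X ^ e) 2≤X))

  ≼-X : ∀ x → x ≤ X → x ≼ 1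
  ≼-X x h = ≤-trans h (≤-reflexive (sym (*-identityʳ X)))

  ≼-2^ : ∀ e → 2 ^ e ≼ e
  ≼-2^ e = ^-monoˡ-≤ e 2≤X

  L≼ : L ≼ 1
  L≼ = ≼-X L L≤X

  q⁴≼ : q ^ 4 ≼ 4
  q⁴≼ = ≼-^ q 1 4 (≼-X q q≤X)

  sn≼ : suc n ≼ 1
  sn≼ = ≼-X (suc n) n<2^L

  n≼ : n ≼ 1
  n≼ = ≼-X n (<⇒≤ n<2^L)

  T≼ : T ≼ 27
  T≼ = ≤-trans T≤ (≼-* C (L * (L * L * q ^ 4)) 20 7 (≤-trans (≤-reflexive C≡) (≼-2^ 20))
    (≼-* L (L * L * q ^ 4) 1 6 L≼ (≼-* (L * L) (q ^ 4) 2 4 (≼-* L L 1 1 L≼ L≼) q⁴≼)))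

  -- The factor `suc n` is the union bound within a round, T the one over the rounds, and n the
  -- required confidence.
  failure : suc n * (T * n) ≤ 2 ^ k
  failure = ≤-trans (≼-mono (suc n * (T * n)) 29 32 (≤ᵇ⇒≤ 29 32 _) (≼-* (suc n) (T * n) 1 28 sn≼ (≼-* T n 27 1 T≼ n≼)))
    (≤-reflexive (trans (^-*-assoc 2 L 32) (cong (2 ^_) (*-comm L 32))))

  k≼ : k ≼ 6
  k≼ = ≼-* 32 L 5 1 (≼-2^ 5) L≼

  R≼ : R ≼ 23
  R≼ = ≼-* c (b * L * q ^ 4) 17 6 (≤-trans (≤-reflexive c≡) (≼-2^ 17))
    (≼-* (b * L) (q ^ 4) 2 4 (≼-* b L 1 1 (≼-X b b≤X) L≼) q⁴≼)

  samples≼ : 4 * k + R * k ≼ 30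
  samples≼ = ≼-+ (4 * k) (R * k) 29 (≼-mono (4 * k) 8 29 (≤ᵇ⇒≤ 8 29 _) (≼-* 4 k 2 6 (≼-2^ 2) k≼)) (≼-* R k 23 6 R≼ k≼)

  probes≼ : J * suc (suc n * suc n) ≼ 6
  probes≼ = ≼-* J (suc (suc n * suc n)) 3 3 (≼-^ q 1 3 (≼-X q q≤X))
    (≼-+ 1 (suc n * suc n) 2 (m^n>0 X {{X≢0}} 2) (≼-* (suc n) (suc n) 1 1 sn≼ sn≼))

  query-bound : n + (4 * k + R * k) * (J * suc (suc n * suc n)) ≼ 37
  query-bound = ≼-+ n ((4 * k + R * k) * (J * suc (suc n * suc n))) 36 (≼-mono n 1 36 (≤ᵇ⇒≤ 1 36 _) n≼)
    (≼-* (4 * k + R * k) (J * suc (suc n * suc n)) 30 6 samples≼ probes≼)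

  queries-bound : ∀ r h → length (query P.algorithm r h) ≤ X ^ 37
  queries-bound r h = ≤-trans (P.query-length _ length-queries r h) query-bound

  succeeds : ∀ {ind : Subset n → Bool} → IsMatroid ind → SucceedsWHP P.algorithm ind
  succeeds {ind} M = Dr.whp start Φ≤T ≤-refl {{>-nonZero T>0}} finish
    where
    open IsMatroid M
    open Matroid M
    open Analysis parameters M using (Invariant; bad)
    module D = Drift parameters M
    module Dr = P.Run.Drift ind Invariant D.Φ bad (T * n) (Correctness.rare parameters M (T * n) failure) D.drift
    start : Invariant s₀
    start = D.fresh empty-indep (λ S iS → S , (λ {x} x∈ → q⊆p∪q ⊥ ⊤ ∈⊤) , iS , ≤-refl) (≤-trans (≤-reflexive (∣⊤∣≡n n)) n-bound) ≤-refl
    Φ≤T : D.Φ s₀ ≤ T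
    Φ≤T = potential-bound σmax (32 * 0 + 0) (≤-trans (≤-reflexive (∣⊤∣≡n n)) n-bound)
    finish : ∀ s → Invariant s → D.Φ s ≡ 0 → IsBasis ind (State.I s)
    finish (state zero i j I E G) inv e = spans⇒basis (Invariant.indI inv) (spans-⊆ I∪E⊆I (Invariant.spans inv))
      where
      I∪E⊆I : I ∪ E ⊆ I
      I∪E⊆I = ∪-⊆ id (λ x∈E → contradiction (≤-trans (x∈p⇒∣p-x∣<∣p∣ x∈E) (≤-reflexive e)) λ ())
    -- The potential of a positive stage contains a `suc`, so potential 0 means that stage 0 is
    -- reached with E empty.
    finish (state (suc σ) i j I E G) inv e = contradiction (trans (sym (+-suc (2 ^ σ₀ + σ * width) _)) e) λ ()

-- The ninth power turns q⁴ into (q⁹)⁴, and q⁹ ≤ 2^(L+9) is at most `D * N`: 2^9 is lost by rounding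
-- b up and 2 by rounding N up to a power of two. The three factors L become the power 27 of the
-- logarithm.
ninth-power-bound : ∀ N C L b T s → T ≤ C * (L * (L * L * (2 ^ b) ^ 4)) → b * 9 ≤ L + 9 → 2 ^ L ≤ 2 * N → L ≤ s →
  T ^ 9 ≤ C ^ 9 * (2 * 2 ^ 9) ^ 4 * N ^ 4 * s ^ 27
ninth-power-bound N C L b T s T≤ 9b≤ X≤ L≤s = begin
  T ^ 9                                ≤⟨ ^-monoˡ-≤ 9 T≤ ⟩
  (C * (L * (L * L * q ^ 4))) ^ 9      ≡⟨ ^-distribʳ-* 9 C _ ⟩
  C ^ 9 * (L * (L * L * q ^ 4)) ^ 9    ≡⟨ cong (λ x → C ^ 9 * x ^ 9) (l₁ L (q ^ 4)) ⟩
  C ^ 9 * (L ^ 3 * q ^ 4) ^ 9          ≡⟨ cong (C ^ 9 *_) (trans (^-distribʳ-* 9 (L ^ 3) (q ^ 4)) (cong₂ _*_ (^-*-assoc L 3 9) (^-*-assoc q 4 9))) ⟩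
  C ^ 9 * (L ^ 27 * q ^ 36)            ≤⟨ *-monoʳ-≤ (C ^ 9) (*-mono-≤ (^-monoˡ-≤ 27 L≤s) q³⁶≤) ⟩
  C ^ 9 * (s ^ 27 * (D ^ 4 * N ^ 4)) ≡⟨ l₂ (C ^ 9) (s ^ 27) (D ^ 4) (N ^ 4) ⟩
  C ^ 9 * D ^ 4 * N ^ 4 * s ^ 27   ∎
  where
  open ≤-Reasoning
  q = 2 ^ b
  D = 2 * 2 ^ 9
  l₁ : ∀ L p → L * (L * L * p) ≡ L * (L * (L * 1)) * p
  l₁ = solve-∀
  l₂ : ∀ c s d m → c * (s * (d * m)) ≡ c * d * m * s
  l₂ = solve-∀
  q³⁶≤ : q ^ 36 ≤ D ^ 4 * N ^ 4
  q³⁶≤ = begin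
    q ^ 36                   ≡⟨ ^-*-assoc q 9 4 ⟨
    (q ^ 9) ^ 4              ≡⟨ cong (_^ 4) (^-*-assoc 2 b 9) ⟩
    (2 ^ (b * 9)) ^ 4        ≤⟨ ^-monoˡ-≤ 4 (^-monoʳ-≤ 2 9b≤) ⟩
    (2 ^ (L + 9)) ^ 4        ≡⟨ cong (_^ 4) (^-distribˡ-+-* 2 L 9) ⟩
    (2 ^ L * 2 ^ 9) ^ 4      ≤⟨ ^-monoˡ-≤ 4 (*-monoˡ-≤ (2 ^ 9) X≤) ⟩
    (2 * N * 2 ^ 9) ^ 4  ≡⟨ cong (_^ 4) (l₃ 2 (N) (2 ^ 9)) ⟩
    (D * N) ^ 4          ≡⟨ ^-distribʳ-* 4 D (N) ⟩
    D ^ 4 * N ^ 4        ∎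
    where
    l₃ : ∀ x y z → x * y * z ≡ x * z * y
    l₃ = solve-∀

-- `PolyQueries` uses one constant as both coefficient and exponent; 2^37 is dictated by the former
-- and ample for the latter.
query-power-bound : ∀ N X d → 1 ≤ N → X ≤ 2 * N → d ≡ 2 ^ 37 → X ^ 37 ≤ d * N ^ d
query-power-bound N X d N>0 X≤ d≡ = begin
  X ^ 37            ≤⟨ ^-monoˡ-≤ 37 X≤ ⟩
  (2 * N) ^ 37      ≡⟨ ^-distribʳ-* 37 2 N ⟩
  2 ^ 37 * N ^ 37   ≡⟨ cong (_* N ^ 37) d≡ ⟨
  d * N ^ 37        ≤⟨ *-monoʳ-≤ d (^-monoʳ-≤ N {{>-nonZero N>0}} (≤-trans (≤ᵇ⇒≤ 37 (2 ^ 37) _) (≤-reflexive (sym d≡)))) ⟩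
  d * N ^ d         ∎
  where open ≤-Reasoning

basis-finding : ∀ c C d → c ≡ 131072 → C ≡ 2 ^ 20 → d ≡ 2 ^ 37 → Σ[ A ∈ ((n : ℕ) → Alg n) ]
  (PolyQueries A × RoundsÕn4/9 A × (∀ (n : ℕ) (ind : Subset n → Bool) → IsMatroid ind → SucceedsWHP (A n) ind))
basis-finding c C d c≡ C≡ d≡ = (λ n → S.P.algorithm n) , poly , rounds≤ , (λ n ind M → S.succeeds n M)
  where
  L b : ℕ → ℕ
  L n = suc (proj₁ (bit-length n))
  -- Rounding up gives n ≤ q⁹ and costs at most a factor 2^9 in q⁹.
  b n = suc (L n / 9)
  b≤L : ∀ n → b n ≤ L n
  b≤L n = m/n<m (L n) 9 (s≤s (s≤s z≤n))
  L≤9b : ∀ n → L n ≤ b n * 9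
  L≤9b n = ≤-trans (≤-reflexive (m≡m%n+[m/n]*n (L n) 9)) (+-monoˡ-≤ (L n / 9 * 9) (<⇒≤ (m%n<n (L n) 9)))
  9b≤L+9 : ∀ n → b n * 9 ≤ L n + 9
  9b≤L+9 n = ≤-trans (+-monoʳ-≤ 9 (m/n*n≤m (L n) 9)) (≤-reflexive (+-comm 9 (L n)))
  2^L≤ : ∀ n → 2 ^ L n ≤ 2 * suc n
  2^L≤ n = *-monoʳ-≤ 2 (proj₁ (proj₂ (bit-length n)))
  module S n = Solution n c C (L n) (b n) c≡ C≡ (s≤s z≤n) (s≤s z≤n) (b≤L n) (proj₁ (proj₂ (proj₂ (bit-length n)))) (L≤9b n)
  rounds≤ : RoundsÕn4/9 (λ n → S.P.algorithm n)
  rounds≤ = C ^ 9 * (2 * 2 ^ 9) ^ 4 , 27 , λ n → ninth-power-bound (suc n) C (L n) (b n) (S.T n) (suc ⌊log₂ n ⌋)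
    (S.T≤ n) (9b≤L+9 n) (2^L≤ n) (s≤s (proj₂ (proj₂ (proj₂ (bit-length n)))))
  poly : PolyQueries (λ n → S.P.algorithm n)
  poly = d , λ n r h → ≤-trans (S.queries-bound n r h) (query-power-bound (suc n) (2 ^ L n) d (s≤s z≤n) (2^L≤ n) d≡)

theoremD3 : Σ[ A ∈ ((n : ℕ) → Alg n) ]
    (PolyQueries A × RoundsÕn4/9 A ×
    (∀ (n : ℕ) (ind : Subset n → Bool) → IsMatroid ind → SucceedsWHP (A n) ind))
theoremD3 = basis-finding 131072 (2 ^ 20) (2 ^ 37) refl refl refl
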